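{- Let $k$ be a finite field with $q$ elements, let $\alpha\ge 0$ be a fixed integer, and let $\mu$ be a fixed probability distribution on $k$ with $\|\widehat\mu\|_1<q^{1/2}$. For each $m\ge 0$ let $x_0,\ldots,x_{2m+\alpha}$ be chosen independently from the distribution $\mu$. Then, as $m\to\infty$, the probability that $(x_0,\ldots,x_{2m+\alpha})\in H_m$ approaches $q^{ -(\alpha+1)}$. In particular (case $\alpha=0$), if the $2m+1$ entries $x_0,\ldots,x_{2m}$ of the square Hankel matrix $(x_{i+j})_{0\le i,j\le m}$ of order $m+1$ are chosen independently from $\mu$, then as $m\to\infty$ the matrix is singular with probability approaching $1/q$.
   Context: For integers $m,n$ with $0\le 2m\le n+1$, $H_m\subseteq k^{n+1}$ is the set of sequences $(x_0,\ldots,x_n)$ for which there exist $a_0,\ldots,a_m\in k$, not all zero, such that $\sum_{i=0}^m a_ix_{i+j}=0$ for each $j=0,1,\ldots,n-m$ (here $n=2m+\alpha$). A distribution on $k$ is a function $\mu:k\to\mathbf{R}$ with $\mu(x)\ge 0$ for all $x\in k$ and $\sum_{x\in k}\mu(x)=1$. Fix a nontrivial homomorphism $\psi_0$ from the additive group of $k$ to the unit circle in $\mathbf{C}$. The Fourier transform of $\mu$ is $\widehat\mu(a)=\sum_{x\in k}\mu(x)\psi_0(ax)$ for $a\in k$, and $\|\widehat\mu\|_1=\sum_{a\in k}|\widehat\mu(a)|$. -}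

module Defs where

open import Algebra.Apartness.Bundles using (HeytingField; module HeytingCommutativeRing)
open import Algebra.Bundles using (CommutativeRing; RawMagma)
open import Algebra.Morphism.Structures using (module MagmaMorphisms)
open import Data.Bool.Base using (if_then_else_)
open import Data.Fin.Base
  using (Fin; toℕ; fromℕ<; finToFun; funToFin; combine; remQuot)
import Data.Fin.Properties as Fin
open import Data.Nat.Base as ℕ using (ℕ; zero; suc; NonZero; z≤n; s≤s)
import Data.Nat.Properties as ℕ
open import Data.Product.Base using (∃; ∃-syntax; _×_; _,_; proj₁; proj₂; uncurry)
open import Data.Sum.Base using (_⊎_; inj₁; inj₂)
open import Data.Vec.Functional using (Vector)
open import Function.Base using (_∘_)
open import Function.Bundles using (Inverse)
open import Function.Properties.Inverse using (Inverse⇒Injection)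
import Function.Construct.Symmetry as Symmetry
open import Level using (Level; _⊔_) renaming (suc to lsuc)
open import Relation.Binary.Core using (Rel)
import Relation.Binary.Definitions as B
open import Relation.Binary.PropositionalEquality as ≡ using (_≡_)
open import Relation.Binary.Structures using (IsStrictPartialOrder)
open import Relation.Nullary.Decidable
  using (Dec; does; yes; no; map′; ¬?; _×-dec_; via-injection)
open import Relation.Nullary.Negation using (¬_; contradiction)
open import Relation.Unary using (Pred; Decidable)

import Algebra.Definitions as Definitions
import Algebra.Properties.CommutativeMonoid.Sum as Sum
import Algebra.Properties.Ring as RingProperties
import Algebra.Properties.Semiring.Exp as Exp
import Algebra.Properties.Semiring.Mult as Mult
import Data.Vec.Functional.Relation.Binary.Equality.Setoid as VectorEquality

------------------------------------------------------------------------
-- The standard library has no real numbers, so ℝ is characterised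
-- axiomatically, as a Cauchy-complete Archimedean ordered field.
-- Classically this determines ℝ up to unique isomorphism.

record OrderedField c ℓ₁ ℓ₂ : Set (lsuc (c ⊔ ℓ₁ ⊔ ℓ₂)) where
  infix 4 _<_
  field
    heytingField : HeytingField c ℓ₁ ℓ₂

  open HeytingField heytingField public

  field
    _<_                  : Rel Carrier ℓ₂
    isStrictPartialOrder : IsStrictPartialOrder _≈_ _<_
    -- With tightness of _#_, these two amount classically to trichotomy.
    <⇒#                  : ∀ {x y} → x < y → x # y
    #⇒<⊎>                : ∀ {x y} → x # y → x < y ⊎ y < x
    +-monoˡ-<            : ∀ z {x y} → x < y → x + z < y + z
    *-pos                : ∀ {x y} → 0# < x → 0# < y → 0# < x * y

  open IsStrictPartialOrder isStrictPartialOrder public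
    using (<-respˡ-≈; <-respʳ-≈)
    renaming (irrefl to <-irrefl; trans to <-trans)

  commutativeRing : CommutativeRing c ℓ₁
  commutativeRing = HeytingCommutativeRing.commutativeRing heytingCommutativeRing

  open CommutativeRing commutativeRing public
    using (semiring; +-commutativeMonoid; *-commutativeMonoid; ring)

  infix 4 _≤_
  _≤_ : Rel Carrier ℓ₂
  x ≤ y = ¬ (y < x)

  fromℕ : ℕ → Carrier
  fromℕ n = Mult._×_ semiring n 1#

  ∑ ∏ : ∀ {n} → Vector Carrier n → Carrier
  ∑ = Sum.sum +-commutativeMonoid
  ∏ = Sum.sum *-commutativeMonoid

  infixr 8 _^_
  _^_ : Carrier → ℕ → Carrier
  _^_ = Exp._^_ semiring

  -- Symmetric in m and n, so this bounds |s m - s n|.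
  Cauchy : (ℕ → Carrier) → Set (c ⊔ ℓ₂)
  Cauchy s = ∀ ε → 0# < ε → ∃[ N ] ∀ m n → N ℕ.≤ m → N ℕ.≤ n → s m - s n < ε

  -- The two inequalities say |s n - l| < ε.
  infix 4 _⟶_
  _⟶_ : (ℕ → Carrier) → Carrier → Set (c ⊔ ℓ₂)
  s ⟶ l = ∀ ε → 0# < ε → ∃[ N ] ∀ n → N ℕ.≤ n → s n - l < ε × l - s n < ε

  private
    1≮0 : ¬ (1# < 0#)
    1≮0 1<0 = <-irrefl refl (<-trans 1<0 (<-respʳ-≈ -1*-1≈1 (*-pos 0<-1 0<-1)))
      where
      open RingProperties ring using (-1*x≈-x; -‿involutive)
      0<-1 : 0# < - 1#
      0<-1 = <-respʳ-≈ (+-identityˡ (- 1#)) (<-respˡ-≈ (-‿inverseʳ 1#) (+-monoˡ-< (- 1#) 1<0))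
      -1*-1≈1 : - 1# * - 1# ≈ 1#
      -1*-1≈1 = trans (-1*x≈-x (- 1#)) (-‿involutive 1#)

    1-0≈1 : 1# - 0# ≈ 1#
    1-0≈1 = trans (+-congˡ (RingProperties.-0#≈0# ring)) (+-identityʳ 1#)

  0<1 : 0# < 1#
  0<1 with #⇒<⊎> (invertible⇒# {1#} {0#} (1# , 1*[1-0]≈1 , [1-0]*1≈1))
    where
    1*[1-0]≈1 : 1# * (1# - 0#) ≈ 1#
    1*[1-0]≈1 = trans (*-identityˡ _) 1-0≈1
    [1-0]*1≈1 : (1# - 0#) * 1# ≈ 1#
    [1-0]*1≈1 = trans (*-identityʳ _) 1-0≈1
  ... | inj₁ 1<0 = contradiction 1<0 1≮0
  ... | inj₂ 0<1 = 0<1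

  0<fromℕ : ∀ n .{{_ : NonZero n}} → 0# < fromℕ n
  0<fromℕ (suc zero)    = <-respʳ-≈ (sym (+-identityʳ 1#)) 0<1
  0<fromℕ (suc (suc n)) =
    <-trans (0<fromℕ (suc n))
      (<-respˡ-≈ (+-identityˡ _) (+-monoˡ-< (fromℕ (suc n)) 0<1))

  1/fromℕ : ∀ n .{{_ : NonZero n}} → Carrier
  1/fromℕ n = proj₁ (#⇒invertible (#-sym (<⇒# (0<fromℕ n))))

  1/fromℕ-inverse : ∀ n .{{_ : NonZero n}} → 1/fromℕ n * fromℕ n ≈ 1#
  1/fromℕ-inverse n = trans (*-congˡ (sym n-0≈n))
    (proj₁ (proj₂ (#⇒invertible (#-sym (<⇒# (0<fromℕ n))))))
    where
    n-0≈n : fromℕ n - 0# ≈ fromℕ n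
    n-0≈n = trans (+-congˡ (RingProperties.-0#≈0# ring)) (+-identityʳ _)

-- Square roots of non-negative elements exist (uniquely) in every complete
-- ordered field; they are carried as an operation, so that the modulus of a
-- complex number can be written down.

record RealNumbers c ℓ₁ ℓ₂ : Set (lsuc (c ⊔ ℓ₁ ⊔ ℓ₂)) where
  field
    orderedField : OrderedField c ℓ₁ ℓ₂

  open OrderedField orderedField public

  field
    archimedean : ∀ x → ∃[ n ] x < fromℕ n
    complete    : ∀ s → Cauchy s → ∃[ l ] s ⟶ l
    √           : Carrier → Carrier
    √-nonNeg    : ∀ {x} → 0# ≤ x → 0# ≤ √ x
    √-square    : ∀ {x} → 0# ≤ x → √ x * √ x ≈ x

------------------------------------------------------------------------

module Complex {r r₁ r₂} (R : RealNumbers r r₁ r₂) where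

  open RealNumbers R renaming (Carrier to ℝ)

  record ℂ : Set r where
    constructor _+i_
    field
      re im : ℝ

  open ℂ public

  infix 4 _≈ᶜ_
  _≈ᶜ_ : Rel ℂ r₁
  z ≈ᶜ w = re z ≈ re w × im z ≈ im w

  1ᶜ : ℂ
  1ᶜ = 1# +i 0#

  infixl 7 _*ᶜ_ _·ᶜ_
  _*ᶜ_ : ℂ → ℂ → ℂ
  z *ᶜ w = (re z * re w - im z * im w) +i (re z * im w + im z * re w)

  _·ᶜ_ : ℝ → ℂ → ℂ
  t ·ᶜ z = (t * re z) +i (t * im z)

  ∑ᶜ : ∀ {n} → Vector ℂ n → ℂ
  ∑ᶜ z = ∑ (re ∘ z) +i ∑ (im ∘ z)

  ∣_∣ : ℂ → ℝ
  ∣ z ∣ = √ (re z * re z + im z * im z)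

  *ᶜ-rawMagma : RawMagma r r₁
  *ᶜ-rawMagma = record { Carrier = ℂ ; _≈_ = _≈ᶜ_ ; _∙_ = _*ᶜ_ }

------------------------------------------------------------------------
-- For a finite carrier, equality is decidable and a Heyting field is the
-- same thing as a field in the usual sense.

HasSize : ∀ {c ℓ₁ ℓ₂} → HeytingField c ℓ₁ ℓ₂ → ℕ → Set (c ⊔ ℓ₁)
HasSize K q = Inverse (≡.setoid (Fin q)) (HeytingField.setoid K)

module FiniteField {c ℓ₁ ℓ₂} (K : HeytingField c ℓ₁ ℓ₂)
                   {q : ℕ} (enumeration : HasSize K q) where

  open HeytingField K renaming (Carrier to k)
  open CommutativeRing
    (HeytingCommutativeRing.commutativeRing heytingCommutativeRing) public
    using (+-commutativeMonoid; +-rawMagma)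
  open VectorEquality setoid using (_≋_)
  open Inverse enumeration using (from; strictlyInverseˡ)
    renaming (to to element) public

  instance
    q-nonZero : NonZero q
    q-nonZero = Fin.nonZeroIndex (from 0#)

  infix 4 _≟_
  _≟_ : B.Decidable _≈_
  _≟_ = via-injection (Inverse⇒Injection (Symmetry.inverse enumeration)) Fin._≟_

  -- All of kⁿ, without repetition, indexed by Fin (q ^ n).
  tuple : ∀ {n} → Fin (q ℕ.^ n) → Vector k n
  tuple t i = element (finToFun t i)

  code : ∀ {n} → Vector k n → Fin (q ℕ.^ n)
  code x = funToFin (from ∘ x)

  tuple-code : ∀ {n} (x : Vector k n) → tuple (code x) ≋ x
  tuple-code x i = trans
    (reflexive (≡.cong element (Fin.finToFun-funToFin (from ∘ x) i)))
    (strictlyInverseˡ (x i))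

  ∃-tuple? : ∀ {n p} {P : Pred (Vector k n) p} →
             P B.Respects _≋_ → Decidable P → Dec (∃ P)
  ∃-tuple? resp P? = map′
    (λ (t , p) → tuple t , p)
    (λ (x , p) → code x , resp (λ i → sym (tuple-code x i)) p)
    (Fin.any? (P? ∘ tuple))

  ∑ : ∀ {n} → Vector k n → k
  ∑ = Sum.sum +-commutativeMonoid

  ∑-cong : ∀ {n} {x y : Vector k n} → x ≋ y → ∑ x ≈ ∑ y
  ∑-cong = Sum.sum-cong-≋ +-commutativeMonoid


  Matrix : ℕ → Set c
  Matrix n = Fin n → Fin n → k

  module _ {n : ℕ} where

    infix 4 _≈ᴹ_
    _≈ᴹ_ : Rel (Matrix n) ℓ₁
    A ≈ᴹ B = ∀ i j → A i j ≈ B i j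

    1ᴹ : Matrix n
    1ᴹ i j = if does (i Fin.≟ j) then 1# else 0#

    infixl 7 _*ᴹ_
    _*ᴹ_ : Matrix n → Matrix n → Matrix n
    (A *ᴹ B) i j = ∑ λ l → A i l * B l j

    Singular : Pred (Matrix n) (c ⊔ ℓ₁)
    Singular A = ¬ Definitions.Invertible _≈ᴹ_ 1ᴹ _*ᴹ_ A

    singular? : Decidable Singular
    singular? A = ¬? (map′
        (λ (x , p) → unflatten x , p)
        (λ (B , p) → flatten B , resp (λ i j → sym (flat-un B i j)) p)
        (∃-tuple? (λ x≋y → resp λ i j → x≋y (combine i j))
                  (λ x → inverse? (unflatten x))))
      where
      Inverses : Matrix n → Set ℓ₁
      Inverses B = B *ᴹ A ≈ᴹ 1ᴹ × A *ᴹ B ≈ᴹ 1ᴹ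

      ≈ᴹ? : ∀ B C → Dec (B ≈ᴹ C)
      ≈ᴹ? B C = Fin.all? λ i → Fin.all? λ j → B i j ≟ C i j

      inverse? : Decidable Inverses
      inverse? B = ≈ᴹ? (B *ᴹ A) 1ᴹ ×-dec ≈ᴹ? (A *ᴹ B) 1ᴹ

      resp : Inverses B.Respects _≈ᴹ_
      resp B≈C (p , q) =
        (λ i j → trans (∑-cong λ l → *-congʳ (sym (B≈C i l))) (p i j)) ,
        (λ i j → trans (∑-cong λ l → *-congˡ (sym (B≈C l j))) (q i j))

      unflatten : Vector k (n ℕ.* n) → Matrix n
      unflatten x i j = x (combine i j)

      flatten : Matrix n → Vector k (n ℕ.* n)
      flatten B = uncurry B ∘ remQuot n

      flat-un : ∀ B → unflatten (flatten B) ≈ᴹ B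
      flat-un B i j = reflexive (≡.cong (uncurry B) (Fin.remQuot-combine i j))


  hankel : ∀ m → Vector k (suc (2 ℕ.* m)) → Matrix (suc m)
  hankel m x i j = x (fromℕ< {toℕ i ℕ.+ toℕ j} (s≤s i+j≤2m))
    where
    i+j≤2m : toℕ i ℕ.+ toℕ j ℕ.≤ 2 ℕ.* m
    i+j≤2m = ℕ.+-mono-≤ (Fin.toℕ≤pred[n] i)
               (ℕ.≤-trans (Fin.toℕ≤pred[n] j) (ℕ.m≤m+n m 0))

  2m≤1+n⇒m≤n : ∀ m n → 2 ℕ.* m ℕ.≤ suc n → m ℕ.≤ n
  2m≤1+n⇒m≤n zero    n _         = z≤n
  2m≤1+n⇒m≤n (suc m) n (s≤s le) = ℕ.≤-trans
    (ℕ.≤-trans (ℕ.m≤m+n (suc m) m)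
      (ℕ.≤-reflexive (≡.trans (≡.cong suc (≡.cong (m ℕ.+_) (≡.sym (ℕ.+-identityʳ m))))
                               (≡.sym (ℕ.+-suc m (m ℕ.+ 0))))))
    le

  module _ (m n : ℕ) .(2m≤1+n : 2 ℕ.* m ℕ.≤ suc n) where

    index+ : Fin (suc m) → Fin (suc (n ℕ.∸ m)) → Fin (suc n)
    index+ i j = fromℕ< {toℕ i ℕ.+ toℕ j} (s≤s (i+j≤n 2m≤1+n))
      where
      i+j≤n : 2 ℕ.* m ℕ.≤ suc n → toℕ i ℕ.+ toℕ j ℕ.≤ n
      i+j≤n le = ℕ.≤-trans
        (ℕ.+-mono-≤ (Fin.toℕ≤pred[n] i) (Fin.toℕ≤pred[n] j))
        (ℕ.≤-reflexive (ℕ.m+[n∸m]≡n (2m≤1+n⇒m≤n m n le)))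

    IsRelation : Vector k (suc n) → Pred (Vector k (suc m)) ℓ₁
    IsRelation x a =
      ¬ (∀ i → a i ≈ 0#) × (∀ j → ∑ (λ i → a i * x (index+ i j)) ≈ 0#)

    H : Pred (Vector k (suc n)) (c ⊔ ℓ₁)
    H x = ∃[ a ] IsRelation x a

    H? : Decidable H
    H? x = ∃-tuple? resp λ a →
      ¬? (Fin.all? λ i → a i ≟ 0#) ×-dec
      (Fin.all? λ j → ∑ (λ i → a i * x (index+ i j)) ≟ 0#)
      where
      resp : IsRelation x B.Respects _≋_
      resp a≋b (a≉0 , p) =
        (λ b≈0 → a≉0 λ i → trans (a≋b i) (b≈0 i)) ,
        (λ j → trans (∑-cong λ i → *-congʳ {x (index+ i j)} (sym (a≋b i))) (p j))

------------------------------------------------------------------------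

module Distributions
  {r r₁ r₂ c ℓ₁ ℓ₂} (R : RealNumbers r r₁ r₂) (K : HeytingField c ℓ₁ ℓ₂)
  {q : ℕ} (enumeration : HasSize K q) where

  open FiniteField K enumeration hiding (∑; +-commutativeMonoid)
  open RealNumbers R renaming (Carrier to ℝ)
  open Complex R
  open HeytingField K using () renaming (Carrier to k; _*_ to _*ₖ_; _≈_ to _≈ₖ_)
  open MagmaMorphisms +-rawMagma *ᶜ-rawMagma using (IsMagmaHomomorphism)

  -- Preservation of units is automatic: ψ 0 is idempotent and of modulus 1,
  -- so the multiplicative structure alone gives a group homomorphism.
  record IsNontrivialCharacter (ψ : k → ℂ) : Set (c ⊔ ℓ₁ ⊔ r₁) where
    field
      isMagmaHomomorphism : IsMagmaHomomorphism ψ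
      unitCircle          : ∀ x → ∣ ψ x ∣ ≈ 1#
      nontrivial          : ∃[ x ] ¬ (ψ x ≈ᶜ 1ᶜ)

  record IsDistribution (μ : k → ℝ) : Set (c ⊔ ℓ₁ ⊔ r₁ ⊔ r₂) where
    field
      cong   : ∀ {x y} → x ≈ₖ y → μ x ≈ μ y
      nonNeg : ∀ x → 0# ≤ μ x
      total  : ∑ (λ t → μ (element t)) ≈ 1#

  module _ (ψ₀ : k → ℂ) where

    fourier : (k → ℝ) → k → ℂ
    fourier μ a = ∑ᶜ λ t → μ (element t) ·ᶜ ψ₀ (a *ₖ element t)

  ‖_‖₁ : (k → ℂ) → ℝ
  ‖ f ‖₁ = ∑ λ t → ∣ f (element t) ∣

  -- The probability that (x₀, …, xₙ₋₁) ∈ E when the xᵢ are chosen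
  -- independently from μ.
  Pr : (k → ℝ) → ∀ {n e} {E : Pred (Vector k n) e} → Decidable E → ℝ
  Pr μ {n} E? = ∑ {q ℕ.^ n} λ t →
    if does (E? (tuple t)) then ∏ {n} (λ i → μ (tuple t i)) else 0#

2m≤1+[2m+α] : ∀ m α → 2 ℕ.* m ℕ.≤ suc (2 ℕ.* m ℕ.+ α)
2m≤1+[2m+α] m α = ℕ.m≤n⇒m≤1+n (ℕ.m≤m+n (2 ℕ.* m) α)

{-# OPTIONS --safe #-}
-- Write N for the length of x, p for the number of equations, and let M and M′ be the numbers of
-- relations of length m + 1 and m of x.  If x satisfies a non-trivial relation, multiplication by X
-- and the relation of least degree give q M′ ≤ M, so that (q - 1) [x ∉ H] + M - q M′ ≥ 0 for all x.
-- Prolonging sequences by their least recurrence shows #H ≥ q²ᵐ, and summing over all x then forces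
-- (q - 1) [x ∉ H] + M = q M′.  It remains to find the means of M and M′.  Poisson summation turns
-- qᵖ E[M] into the sum of ∏ μ̂((a c)ₗ) over pairs of polynomials a, c of lengths m + 1 and p.  The
-- pairs with a c = 0 give the main term; the others contribute at most ‖μ̂‖₁ᴺ times the largest
-- number of divisors of a non-zero polynomial of degree below N.  That number is O(2^(N / L)) for
-- every L, so ‖μ̂‖₁ < √q makes the error negligible against qᵖ.

module Submission where

open import Algebra.Apartness.Bundles using (HeytingField; module HeytingCommutativeRing)
open import Algebra.Bundles using (CommutativeRing; CommutativeSemiring; module CommutativeRing)
open import Algebra.Morphism.Structures using (module MagmaMorphisms)
import Algebra.Properties.CommutativeMonoid.Sum as Sum
import Algebra.Properties.Ring as RingProperties
import Algebra.Properties.Semiring.Exp as Exp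
import Algebra.Properties.Semiring.Mult as Mult
import Algebra.Properties.Semiring.Mult.TCOptimised as Mult′
import Algebra.Properties.Semiring.Sum as SemiringSum
import Algebra.Solver.Ring as RingSolver
open import Algebra.Solver.Ring.AlmostCommutativeRing using (_-Raw-AlmostCommutative⟶_; fromCommutativeRing)
open import Data.Bool.Base using (if_then_else_)
open import Data.Empty using (⊥)
open import Data.Fin.Base as Fin using (Fin; _↑ʳ_; _↑ˡ_; combine; finToFun; fromℕ<; inject₁; punchOut; suc; toℕ; zero)
open import Data.Fin.Permutation as Permutation using (Permutation; permutation)
import Data.Fin.Properties as Fin
open import Data.Integer.Base as ℤ using (+_; -[1+_]; ℤ)
import Data.Integer.Properties as ℤ
open import Data.List.Base as List using (List; []; _++_; _∷_; length)
import Data.List.Properties as List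
open import Data.List.Relation.Unary.Any as Any using (Any; here; there)
import Data.List.Relation.Unary.Any.Properties as Any
open import Data.Maybe.Base using (Maybe; just; nothing)
open import Data.Nat.Base as ℕ using (suc; s≤s; zero; z≤n; ℕ)
import Data.Nat.DivMod as ℕ
open import Data.Nat.Induction using (<-wellFounded)
import Data.Nat.Properties as ℕ
open import Data.Nat.Solver using (module +-*-Solver)
open import Data.Product.Base using (_,_; _×_; proj₁; proj₂; ∃; ∃-syntax; ∃₂)
open import Data.Sum.Base using (_⊎_; inj₁; inj₂)
import Data.Vec.Functional as Vector
open import Data.Vec.Functional using (Vector; insertAt; tail)
open import Data.Vec.Functional.Properties using (insertAt-punchIn)
open import Defs
open import Function.Base using (_∘_; case_of_)
open import Function.Bundles using (Inverse)
open import Induction.WellFounded using (Acc; acc)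
open import Level using (Level; _⊔_) renaming (suc to lsuc)
open import Relation.Binary.Definitions using (Decidable; tri<; tri>; tri≈)
open import Relation.Binary.PropositionalEquality as ≡ using (_≡_)
import Relation.Binary.Reasoning.Base.Triple as Triple
import Relation.Binary.Reasoning.Setoid as SetoidReasoning
open import Relation.Binary.Structures using (IsPreorder)
open import Relation.Nullary.Decidable using (Dec; _×-dec_; does; map′; no; yes; ¬?)
open import Relation.Nullary.Negation using (contradiction; ¬_)
import Relation.Unary as Unary

module IntegerCoefficients {c ℓ} (R : CommutativeRing c ℓ) where
  open CommutativeRing R
  open RingProperties ring
  open Mult semiring using (×-homo-+; ×1-homo-*) renaming (_×_ to _×ₙ_)
  open Mult′ semiring using (×ᵤ≈×) renaming (_×_ to _×′_)
  open SetoidReasoning setoid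

  ⟦_⟧ : ℤ → Carrier
  ⟦ + n ⟧      = n ×′ 1#
  ⟦ -[1+ n ] ⟧ = - (suc n ×′ 1#)

  private
    ι : ℕ → Carrier
    ι n = n ×ₙ 1#

    pos : ∀ n → ⟦ + n ⟧ ≈ ι n
    pos n = sym (×ᵤ≈× n 1#)

    neg : ∀ n → ⟦ ℤ.- (+ n) ⟧ ≈ - ι n
    neg zero    = sym -0#≈0#
    neg (suc n) = -‿cong (pos (suc n))

    cancel : ∀ x y z → (x + y) - (x + z) ≈ y - z
    cancel x y z = begin
      (x + y) - (x + z)     ≈⟨ +-cong (+-comm x y) (sym (⁻¹-∙-comm′ x z)) ⟩
      (y + x) + (- x - z)   ≈⟨ +-assoc y x _ ⟩
      y + (x + (- x - z))   ≈⟨ +-congˡ (+-assoc x (- x) (- z)) ⟨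
      y + ((x - x) - z)     ≈⟨ +-congˡ (+-congʳ (-‿inverseʳ x)) ⟩
      y + (0# - z)          ≈⟨ +-congˡ (+-identityˡ _) ⟩
      y - z                 ∎
      where
      ⁻¹-∙-comm′ : ∀ u v → - u - v ≈ - (u + v)
      ⁻¹-∙-comm′ u v = trans (+-comm _ _) (sym (-‿anti-homo-+ u v))

    ⊖-homo : ∀ m n → ⟦ m ℤ.⊖ n ⟧ ≈ ι m - ι n
    ⊖-homo m zero = begin
      ⟦ m ℤ.⊖ 0 ⟧  ≡⟨⟩
      ⟦ + m ⟧      ≈⟨ pos m ⟩
      ι m          ≈⟨ +-identityʳ _ ⟨
      ι m + 0#     ≈⟨ +-congˡ -0#≈0# ⟨
      ι m - 0#     ∎
    ⊖-homo zero (suc n) = begin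
      ⟦ 0 ℤ.⊖ suc n ⟧ ≡⟨⟩
      - (suc n ×′ 1#) ≈⟨ neg (suc n) ⟩
      - ι (suc n)     ≈⟨ +-identityˡ _ ⟨
      0# - ι (suc n)  ∎
    ⊖-homo (suc m) (suc n) = begin
      ⟦ suc m ℤ.⊖ suc n ⟧   ≡⟨ ≡.cong ⟦_⟧ (ℤ.[1+m]⊖[1+n]≡m⊖n m n) ⟩
      ⟦ m ℤ.⊖ n ⟧           ≈⟨ ⊖-homo m n ⟩
      ι m - ι n             ≈⟨ cancel 1# _ _ ⟨
      ι (suc m) - ι (suc n) ∎

    -homo : ∀ i → ⟦ ℤ.- i ⟧ ≈ - ⟦ i ⟧
    -homo (+ n)    = trans (neg n) (-‿cong (sym (pos n)))
    -homo -[1+ n ] = sym (-‿involutive _)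

    +-homo : ∀ i j → ⟦ i ℤ.+ j ⟧ ≈ ⟦ i ⟧ + ⟦ j ⟧
    +-homo (+ m) (+ n) =
      trans (pos (m ℕ.+ n)) (trans (×-homo-+ 1# m n) (sym (+-cong (pos m) (pos n))))
    +-homo (+ m) -[1+ n ] = trans (⊖-homo m (suc n)) (+-cong (sym (pos m)) (sym (neg (suc n))))
    +-homo -[1+ m ] (+ n) = trans (⊖-homo n (suc m))
      (trans (+-comm _ _) (+-cong (sym (neg (suc m))) (sym (pos n))))
    +-homo -[1+ m ] -[1+ n ] = begin
      - (suc (suc (m ℕ.+ n)) ×′ 1#)  ≈⟨ -‿cong (pos (suc (suc (m ℕ.+ n)))) ⟩
      - ι (suc (suc (m ℕ.+ n)))      ≡⟨ ≡.cong (λ l → - ι (suc l)) (ℕ.+-suc m n) ⟨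
      - ι (suc m ℕ.+ suc n)          ≈⟨ -‿cong (×-homo-+ 1# (suc m) (suc n)) ⟩
      - (ι (suc m) + ι (suc n))      ≈⟨ -‿anti-homo-+ _ _ ⟩
      - ι (suc n) - ι (suc m)        ≈⟨ +-comm _ _ ⟩
      - ι (suc m) - ι (suc n)        ≈⟨ +-cong (neg (suc m)) (neg (suc n)) ⟨
      ⟦ -[1+ m ] ⟧ + ⟦ -[1+ n ] ⟧    ∎

    pos-*-homo : ∀ m n → ⟦ + (m ℕ.* n) ⟧ ≈ ⟦ + m ⟧ * ⟦ + n ⟧
    pos-*-homo m n =
      trans (pos (m ℕ.* n)) (trans (×1-homo-* m n) (sym (*-cong (pos m) (pos n))))

    +*-homo : ∀ m j → ⟦ + m ℤ.* j ⟧ ≈ ⟦ + m ⟧ * ⟦ j ⟧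
    +*-homo m (+ n) = trans (reflexive (≡.cong ⟦_⟧ (≡.sym (ℤ.pos-* m n)))) (pos-*-homo m n)
    +*-homo m -[1+ n ] = begin
      ⟦ + m ℤ.* ℤ.- (+ suc n) ⟧     ≡⟨ ≡.cong ⟦_⟧ (ℤ.neg-distribʳ-* (+ m) (+ suc n)) ⟨
      ⟦ ℤ.- (+ m ℤ.* + suc n) ⟧     ≈⟨ -homo (+ m ℤ.* + suc n) ⟩
      - ⟦ + m ℤ.* + suc n ⟧         ≈⟨ -‿cong (+*-homo m (+ suc n)) ⟩
      - (⟦ + m ⟧ * ⟦ + suc n ⟧)     ≈⟨ -‿distribʳ-* _ _ ⟩
      ⟦ + m ⟧ * ⟦ -[1+ n ] ⟧        ∎

    *-homo : ∀ i j → ⟦ i ℤ.* j ⟧ ≈ ⟦ i ⟧ * ⟦ j ⟧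
    *-homo (+ m)    j = +*-homo m j
    *-homo -[1+ m ] j = begin
      ⟦ ℤ.- (+ suc m) ℤ.* j ⟧       ≡⟨ ≡.cong ⟦_⟧ (ℤ.neg-distribˡ-* (+ suc m) j) ⟨
      ⟦ ℤ.- (+ suc m ℤ.* j) ⟧       ≈⟨ -homo (+ suc m ℤ.* j) ⟩
      - ⟦ + suc m ℤ.* j ⟧           ≈⟨ -‿cong (+*-homo (suc m) j) ⟩
      - (⟦ + suc m ⟧ * ⟦ j ⟧)       ≈⟨ -‿distribˡ-* _ _ ⟩
      ⟦ -[1+ m ] ⟧ * ⟦ j ⟧          ∎

    morphism : ℤ.+-*-rawRing -Raw-AlmostCommutative⟶ fromCommutativeRing R
    morphism = record
      { ⟦_⟧    = ⟦_⟧
      ; +-homo = +-homo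
      ; *-homo = *-homo
      ; -‿homo = -homo
      ; 0-homo = refl
      ; 1-homo = refl
      }

    _≟_ : ∀ i j → Maybe (⟦ i ⟧ ≈ ⟦ j ⟧)
    i ≟ j with i ℤ.≟ j
    ... | yes i≡j = just (reflexive (≡.cong ⟦_⟧ i≡j))
    ... | no  _   = nothing

  open RingSolver ℤ.+-*-rawRing (fromCommutativeRing R) morphism _≟_ public
    using (solve; _:=_; _:+_; _:*_; _:-_; :-_; _:^_; con)

-- Ordered fields

module OrderedFieldProperties {c ℓ₁ ℓ₂} (F : OrderedField c ℓ₁ ℓ₂) where
  open OrderedField F hiding (zero)
  open RingProperties ring using (-0#≈0#)
  open IntegerCoefficients commutativeRing using (solve; _:=_; _:+_; _:*_; _:-_; :-_)

  <-asym : ∀ {x y} → x < y → ¬ (y < x)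
  <-asym x<y y<x = <-irrefl refl (<-trans x<y y<x)

  <⇒≤ : ∀ {x y} → x < y → x ≤ y
  <⇒≤ = <-asym

  <-cotrans : ∀ {x y} → x < y → ∀ z → x < z ⊎ z < y
  <-cotrans x<y z with #-cotrans (<⇒# x<y) z
  ... | inj₁ x#z with #⇒<⊎> x#z
  ...   | inj₁ x<z = inj₁ x<z
  ...   | inj₂ z<x = inj₂ (<-trans z<x x<y)
  <-cotrans x<y z | inj₂ z#y with #⇒<⊎> z#y
  ...   | inj₁ z<y = inj₂ z<y
  ...   | inj₂ y<z = inj₁ (<-trans x<y y<z)

  ≤-reflexive : ∀ {x y} → x ≈ y → x ≤ y
  ≤-reflexive x≈y = <-irrefl (sym x≈y)

  ≤-refl : ∀ {x} → x ≤ x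
  ≤-refl = ≤-reflexive refl

  ≤-trans : ∀ {x y z} → x ≤ y → y ≤ z → x ≤ z
  ≤-trans {y = y} x≤y y≤z z<x with <-cotrans z<x y
  ... | inj₁ z<y = y≤z z<y
  ... | inj₂ y<x = x≤y y<x

  ≤-antisym : ∀ {x y} → x ≤ y → y ≤ x → x ≈ y
  ≤-antisym {x} {y} x≤y y≤x = proj₁ (tight x y) λ x#y → contradict (#⇒<⊎> x#y)
    where
    contradict : ¬ (x < y ⊎ y < x)
    contradict (inj₁ x<y) = y≤x x<y
    contradict (inj₂ y<x) = x≤y y<x

  ≤-<-trans : ∀ {x y z} → x ≤ y → y < z → x < z
  ≤-<-trans {x} x≤y y<z with <-cotrans y<z x
  ... | inj₁ y<x = contradiction y<x x≤y
  ... | inj₂ x<z = x<z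

  <-≤-trans : ∀ {x y z} → x < y → y ≤ z → x < z
  <-≤-trans {z = z} x<y y≤z with <-cotrans x<y z
  ... | inj₁ x<z = x<z
  ... | inj₂ z<y = contradiction z<y y≤z

  ≤-isPreorder : IsPreorder _≈_ _≤_
  ≤-isPreorder = record
    { isEquivalence = isEquivalence ; reflexive = ≤-reflexive ; trans = ≤-trans }

  module ≤-Reasoning = Triple ≤-isPreorder <-asym <-trans
    (<-respʳ-≈ , <-respˡ-≈) <⇒≤ <-≤-trans ≤-<-trans
  open ≤-Reasoning

  +-monoˡ-≤ : ∀ z {x y} → x ≤ y → x + z ≤ y + z
  +-monoˡ-≤ z {x} {y} x≤y y+z<x+z = x≤y
    (<-respˡ-≈ (cancel y) (<-respʳ-≈ (cancel x) (+-monoˡ-< (- z) y+z<x+z)))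
    where
    cancel : ∀ w → w + z - z ≈ w
    cancel w = solve 2 (λ w z → w :+ z :- z := w) refl w z

  +-monoʳ-≤ : ∀ z {x y} → x ≤ y → z + x ≤ z + y
  +-monoʳ-≤ z {x} {y} x≤y = begin
    z + x ≈⟨ +-comm z x ⟩
    x + z ≤⟨ +-monoˡ-≤ z x≤y ⟩
    y + z ≈⟨ +-comm y z ⟩
    z + y ∎

  +-mono-≤ : ∀ {x y u v} → x ≤ y → u ≤ v → x + u ≤ y + v
  +-mono-≤ {y = y} {u} x≤y u≤v = ≤-trans (+-monoˡ-≤ u x≤y) (+-monoʳ-≤ y u≤v)

  -‿mono-≤ : ∀ {x y} → x ≤ y → - y ≤ - x
  -‿mono-≤ {x} {y} x≤y = begin
    - y              ≈⟨ solve 2 (λ x y → :- y := x :+ (:- x :- y)) refl x y ⟩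
    x + (- x - y)    ≤⟨ +-monoˡ-≤ _ x≤y ⟩
    y + (- x - y)    ≈⟨ solve 2 (λ x y → y :+ (:- x :- y) := :- x) refl x y ⟩
    - x              ∎

  x≤y⇒0≤y-x : ∀ {x y} → x ≤ y → 0# ≤ y - x
  x≤y⇒0≤y-x {x} {y} x≤y = begin
    0#     ≈⟨ -‿inverseʳ x ⟨
    x - x  ≤⟨ +-monoˡ-≤ (- x) x≤y ⟩
    y - x  ∎

  0≤y-x⇒x≤y : ∀ {x y} → 0# ≤ y - x → x ≤ y
  0≤y-x⇒x≤y {x} {y} 0≤y-x = begin
    x            ≈⟨ +-identityˡ x ⟨
    0# + x       ≤⟨ +-monoˡ-≤ x 0≤y-x ⟩
    y - x + x    ≈⟨ solve 2 (λ x y → y :- x :+ x := y) refl x y ⟩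
    y            ∎

  x<y⇒0<y-x : ∀ {x y} → x < y → 0# < y - x
  x<y⇒0<y-x {x} x<y = <-respˡ-≈ (-‿inverseʳ x) (+-monoˡ-< (- x) x<y)

  0<y-x⇒x<y : ∀ {x y} → 0# < y - x → x < y
  0<y-x⇒x<y {x} {y} 0<y-x = <-respˡ-≈ (+-identityˡ x)
    (<-respʳ-≈ (solve 2 (λ x y → y :- x :+ x := y) refl x y) (+-monoˡ-< x 0<y-x))

  private
    x-0≈x : ∀ {x} → x - 0# ≈ x
    x-0≈x = trans (+-congˡ -0#≈0#) (+-identityʳ _)

  #0⇒invertible : ∀ {x} → x # 0# → ∃[ y ] y * x ≈ 1#
  #0⇒invertible {x} x#0 with #⇒invertible x#0
  ... | y , y[x-0]≈1 , _ = y , trans (*-congˡ (sym x-0≈x)) y[x-0]≈1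

  invertible⇒#0 : ∀ {x y} → y * x ≈ 1# → x # 0#
  invertible⇒#0 {x} {y} yx≈1 = invertible⇒#
    (y , trans (*-congˡ x-0≈x) yx≈1 , trans (*-congʳ x-0≈x) (trans (*-comm x y) yx≈1))

  xy#0⇒x#0 : ∀ {x y} → x * y # 0# → x # 0#
  xy#0⇒x#0 {x} {y} xy#0 with #0⇒invertible xy#0
  ... | z , z[xy]≈1 = invertible⇒#0 {y = z * y}
    (trans (solve 3 (λ x y z → z :* y :* x := z :* (x :* y)) refl x y z) z[xy]≈1)

  xy#0⇒y#0 : ∀ {x y} → x * y # 0# → y # 0#
  xy#0⇒y#0 {x} {y} xy#0 with #0⇒invertible xy#0
  ... | z , z[xy]≈1 = invertible⇒#0 (trans (*-assoc z x y) z[xy]≈1)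

  0≤∧#0⇒0< : ∀ {x} → 0# ≤ x → x # 0# → 0# < x
  0≤∧#0⇒0< 0≤x x#0 with #⇒<⊎> x#0
  ... | inj₁ x<0 = contradiction x<0 0≤x
  ... | inj₂ 0<x = 0<x

  *-nonNeg : ∀ {x y} → 0# ≤ x → 0# ≤ y → 0# ≤ x * y
  *-nonNeg 0≤x 0≤y xy<0 = <-asym xy<0
    (*-pos (0≤∧#0⇒0< 0≤x (xy#0⇒x#0 (<⇒# xy<0))) (0≤∧#0⇒0< 0≤y (xy#0⇒y#0 (<⇒# xy<0))))

  *-monoˡ-≤ : ∀ {z x y} → 0# ≤ z → x ≤ y → z * x ≤ z * y
  *-monoˡ-≤ {z} {x} {y} 0≤z x≤y = 0≤y-x⇒x≤y (begin
    0#              ≤⟨ *-nonNeg 0≤z (x≤y⇒0≤y-x x≤y) ⟩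
    z * (y - x)     ≈⟨ solve 3 (λ x y z → z :* (y :- x) := z :* y :- z :* x) refl x y z ⟩
    z * y - z * x   ∎)

  *-monoʳ-≤ : ∀ {z x y} → 0# ≤ z → x ≤ y → x * z ≤ y * z
  *-monoʳ-≤ {z} {x} {y} 0≤z x≤y = begin
    x * z ≈⟨ *-comm x z ⟩
    z * x ≤⟨ *-monoˡ-≤ 0≤z x≤y ⟩
    z * y ≈⟨ *-comm z y ⟩
    y * z ∎

  *-mono-≤ : ∀ {x y u v} → 0# ≤ u → 0# ≤ y → x ≤ y → u ≤ v → x * u ≤ y * v
  *-mono-≤ 0≤u 0≤y x≤y u≤v = ≤-trans (*-monoʳ-≤ 0≤u x≤y) (*-monoˡ-≤ 0≤y u≤v)

  *-monoˡ-< : ∀ {z x y} → 0# < z → x < y → z * x < z * y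
  *-monoˡ-< {z} {x} {y} 0<z x<y = 0<y-x⇒x<y (<-respʳ-≈
    (solve 3 (λ x y z → z :* (y :- x) := z :* y :- z :* x) refl x y z)
    (*-pos 0<z (x<y⇒0<y-x x<y)))

  *-cancelˡ-≤ : ∀ {z x y} → 0# < z → z * x ≤ z * y → x ≤ y
  *-cancelˡ-≤ 0<z zx≤zy y<x = zx≤zy (*-monoˡ-< 0<z y<x)

  *-cancelˡ-< : ∀ {z x y} → 0# < z → z * x < z * y → x < y
  *-cancelˡ-< {z} {x} {y} 0<z zx<zy = 0<y-x⇒x<y (0≤∧#0⇒0<
    (x≤y⇒0≤y-x (*-cancelˡ-≤ 0<z (<⇒≤ zx<zy)))
    (xy#0⇒y#0 {z} (#-sym (<⇒# (<-respʳ-≈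
      (solve 3 (λ x y z → z :* y :- z :* x := z :* (y :- x)) refl x y z)
      (x<y⇒0<y-x zx<zy))))))

  0≤x*x : ∀ x → 0# ≤ x * x
  0≤x*x x xx<0 with #⇒<⊎> (xy#0⇒x#0 (<⇒# xx<0))
  ... | inj₂ 0<x = <-asym xx<0 (*-pos 0<x 0<x)
  ... | inj₁ x<0 = <-asym xx<0 (<-respʳ-≈
    (solve 1 (λ x → :- x :* :- x := x :* x) refl x) (*-pos 0<-x 0<-x))
    where
    0<-x : 0# < - x
    0<-x = <-respʳ-≈ (+-identityˡ _) (x<y⇒0<y-x x<0)

  square-cancel-≤ : ∀ {x y} → 0# ≤ y → x * x ≤ y * y → x ≤ y
  square-cancel-≤ {x} {y} 0≤y xx≤yy y<x = xx≤yy (≤-<-trans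
    (*-monoˡ-≤ 0≤y (<⇒≤ y<x)) (<-respˡ-≈ (*-comm x y) (*-monoˡ-< (≤-<-trans 0≤y y<x) y<x)))

  square-cancel-≈ : ∀ {x y} → 0# ≤ x → 0# ≤ y → x * x ≈ y * y → x ≈ y
  square-cancel-≈ 0≤x 0≤y xx≈yy = ≤-antisym (square-cancel-≤ 0≤y (≤-reflexive xx≈yy))
                                            (square-cancel-≤ 0≤x (≤-reflexive (sym xx≈yy)))

  1≤x⇒0<x : ∀ {x} → 1# ≤ x → 0# < x
  1≤x⇒0<x = <-≤-trans 0<1

  ^-pos : ∀ n {x} → 0# < x → 0# < x ^ n
  ^-pos zero    0<x = 0<1
  ^-pos (suc n) 0<x = *-pos 0<x (^-pos n 0<x)

  ^-nonNeg : ∀ n {x} → 0# ≤ x → 0# ≤ x ^ n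
  ^-nonNeg zero    0≤x = <⇒≤ 0<1
  ^-nonNeg (suc n) 0≤x = *-nonNeg 0≤x (^-nonNeg n 0≤x)

  ^-monoˡ-≤ : ∀ n {x y} → 0# ≤ x → x ≤ y → x ^ n ≤ y ^ n
  ^-monoˡ-≤ zero    0≤x x≤y = ≤-refl
  ^-monoˡ-≤ (suc n) 0≤x x≤y = *-mono-≤ (^-nonNeg n 0≤x) (≤-trans 0≤x x≤y) x≤y (^-monoˡ-≤ n 0≤x x≤y)

  ^-distrib-* : ∀ n x y → (x * y) ^ n ≈ x ^ n * y ^ n
  ^-distrib-* zero    x y = sym (*-identityˡ 1#)
  ^-distrib-* (suc n) x y = trans (*-congˡ (^-distrib-* n x y))
    (solve 4 (λ x y a b → x :* y :* (a :* b) := x :* a :* (y :* b)) refl x y (x ^ n) (y ^ n))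

  ^-antimonoʳ-≤ : ∀ {x} → 0# ≤ x → x ≤ 1# → ∀ {m n} → m ℕ.≤ n → x ^ n ≤ x ^ m
  ^-antimonoʳ-≤ {x} 0≤x x≤1 {m} {n} m≤n = begin
    x ^ n                   ≡⟨ ≡.cong (x ^_) (ℕ.m+[n∸m]≡n m≤n) ⟨
    x ^ (m ℕ.+ (n ℕ.∸ m))   ≈⟨ Exp.^-homo-* semiring x m (n ℕ.∸ m) ⟩
    x ^ m * x ^ (n ℕ.∸ m)   ≤⟨ *-monoˡ-≤ (^-nonNeg m 0≤x) (x^l≤1 (n ℕ.∸ m)) ⟩
    x ^ m * 1#              ≈⟨ *-identityʳ _ ⟩
    x ^ m                   ∎
    where
    x^l≤1 : ∀ l → x ^ l ≤ 1#
    x^l≤1 zero    = ≤-refl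
    x^l≤1 (suc l) = ≤-trans (*-mono-≤ (^-nonNeg l 0≤x) (<⇒≤ 0<1) x≤1 (x^l≤1 l))
                            (≤-reflexive (*-identityˡ 1#))

  1^n≈1 : ∀ n → 1# ^ n ≈ 1#
  1^n≈1 zero    = refl
  1^n≈1 (suc n) = trans (*-identityˡ _) (1^n≈1 n)

  1≤x^n : ∀ {x} → 1# ≤ x → ∀ n → 1# ≤ x ^ n
  1≤x^n 1≤x zero    = ≤-refl
  1≤x^n {x} 1≤x (suc n) = begin
    1#         ≈⟨ *-identityˡ 1# ⟨
    1# * 1#    ≤⟨ *-mono-≤ (<⇒≤ 0<1) (<⇒≤ (1≤x⇒0<x 1≤x)) 1≤x (1≤x^n 1≤x n) ⟩
    x * x ^ n  ∎

  ^-monoʳ-≤ : ∀ {x} → 1# ≤ x → ∀ {m n} → m ℕ.≤ n → x ^ m ≤ x ^ n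
  ^-monoʳ-≤ {x} 1≤x {m} {n} m≤n = begin
    x ^ m                   ≈⟨ *-identityʳ _ ⟨
    x ^ m * 1#              ≤⟨ *-monoˡ-≤ (^-nonNeg m (<⇒≤ (1≤x⇒0<x 1≤x))) (1≤x^n 1≤x (n ℕ.∸ m)) ⟩
    x ^ m * x ^ (n ℕ.∸ m)   ≈⟨ Exp.^-homo-* semiring x m (n ℕ.∸ m) ⟨
    x ^ (m ℕ.+ (n ℕ.∸ m))   ≡⟨ ≡.cong (x ^_) (ℕ.m+[n∸m]≡n m≤n) ⟩
    x ^ n                   ∎

  ∑-mono-≤ : ∀ {n} {f g : Vector Carrier n} → (∀ i → f i ≤ g i) → ∑ f ≤ ∑ g
  ∑-mono-≤ {zero}  f≤g = ≤-refl
  ∑-mono-≤ {suc n} f≤g = +-mono-≤ (f≤g zero) (∑-mono-≤ (f≤g ∘ suc))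

  0≤fromℕ : ∀ n → 0# ≤ fromℕ n
  0≤fromℕ zero    = ≤-refl
  0≤fromℕ (suc n) = <⇒≤ (0<fromℕ (suc n))

  fromℕ-mono-≤ : ∀ {m n} → m ℕ.≤ n → fromℕ m ≤ fromℕ n
  fromℕ-mono-≤ {n = n} ℕ.z≤n       = 0≤fromℕ n
  fromℕ-mono-≤ (ℕ.s≤s m≤n) = +-monoʳ-≤ 1# (fromℕ-mono-≤ m≤n)

  fromℕ-* : ∀ m n → fromℕ (m ℕ.* n) ≈ fromℕ m * fromℕ n
  fromℕ-* = Mult.×1-homo-* semiring

  fromℕ-^ : ∀ m n → fromℕ (m ℕ.^ n) ≈ fromℕ m ^ n
  fromℕ-^ m zero    = +-identityʳ 1#
  fromℕ-^ m (suc n) = trans (fromℕ-* m (m ℕ.^ n)) (*-congˡ (fromℕ-^ m n))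

module Convergence {c ℓ₁ ℓ₂} (R : RealNumbers c ℓ₁ ℓ₂) where
  open RealNumbers R hiding (zero)
  open OrderedFieldProperties orderedField
  open IntegerCoefficients commutativeRing using (solve; _:=_; _:+_; _:*_; _:-_; :-_; con)
  open ≤-Reasoning

  -- σⁿ ≤ 1 / (1 + n (1 - σ)), Bernoulli's inequality for 1 / σ.
  bernoulli : ∀ {σ} → 0# ≤ σ → σ ≤ 1# → ∀ n → σ ^ n * (1# + fromℕ n * (1# - σ)) ≤ 1#
  bernoulli {σ} 0≤σ σ≤1 zero = ≤-reflexive
    (solve 1 (λ s → con (+ 1) :* (con (+ 1) :+ con (+ 0) :* (con (+ 1) :- s)) := con (+ 1)) refl σ)
  bernoulli {σ} 0≤σ σ≤1 (suc n) = begin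
    σ * s * (1# + (1# + ν) * δ)
      ≈⟨ solve 3 (λ σ s ν → let δ = con (+ 1) :- σ in
           σ :* s :* (con (+ 1) :+ (con (+ 1) :+ ν) :* δ) :=
           s :* (con (+ 1) :+ ν :* δ) :+ :- (s :* (con (+ 1) :+ ν) :* (δ :* δ)))
           refl σ s ν ⟩
    s * (1# + ν * δ) + - (s * (1# + ν) * (δ * δ))
      ≤⟨ +-monoʳ-≤ _ (-‿mono-≤ (*-nonNeg (*-nonNeg (^-nonNeg n 0≤σ) (0≤fromℕ (suc n))) (0≤x*x δ))) ⟩
    s * (1# + ν * δ) + - 0#
      ≈⟨ solve 1 (λ x → x :+ :- con (+ 0) := x) refl _ ⟩
    s * (1# + ν * δ)
      ≤⟨ bernoulli 0≤σ σ≤1 n ⟩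
    1# ∎
    where
    s = σ ^ n
    ν = fromℕ n
    δ = 1# - σ

  archimedean-* : ∀ {x} → 0# < x → ∃[ n ] 1# < fromℕ n * x
  archimedean-* {x} 0<x = n , (begin-strict
    1#            ≈⟨ yx≈1 ⟨
    y * x         ≈⟨ *-comm y x ⟩
    x * y         <⟨ *-monoˡ-< 0<x y<n ⟩
    x * fromℕ n   ≈⟨ *-comm x _ ⟩
    fromℕ n * x   ∎)
    where
    y    = proj₁ (#0⇒invertible (#-sym (<⇒# 0<x)))
    yx≈1 = proj₂ (#0⇒invertible (#-sym (<⇒# 0<x)))
    n    = proj₁ (archimedean y)
    y<n  = proj₂ (archimedean y)

  ^-eventually-< : ∀ {σ} → 0# ≤ σ → σ < 1# → ∀ {ε} → 0# < ε → ∃[ N ] ∀ n → N ℕ.≤ n → σ ^ n < ε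
  ^-eventually-< {σ} 0≤σ σ<1 {ε} 0<ε = bound (archimedean-* (*-pos 0<ε 0<δ))
    where
    δ = 1# - σ
    0<δ = x<y⇒0<y-x σ<1

    bound : (∃[ N ] 1# < fromℕ N * (ε * δ)) → ∃[ N ] ∀ n → N ℕ.≤ n → σ ^ n < ε
    bound (N , 1<Nεδ) = N , λ n N≤n →
      let
        1≤D : 1# ≤ 1# + fromℕ n * δ
        1≤D = begin
          1#                          ≈⟨ +-identityʳ 1# ⟨
          1# + 0#                     ≤⟨ +-monoʳ-≤ 1# (*-nonNeg (0≤fromℕ n) (<⇒≤ 0<δ)) ⟩
          1# + fromℕ n * δ            ∎
      in
      *-cancelˡ-< (1≤x⇒0<x 1≤D) (begin-strict
        (1# + fromℕ n * δ) * σ ^ n    ≈⟨ *-comm _ _ ⟩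
        σ ^ n * (1# + fromℕ n * δ)    ≤⟨ bernoulli 0≤σ (<⇒≤ σ<1) n ⟩
        1#                            <⟨ 1<Nεδ ⟩
        fromℕ N * (ε * δ)             ≤⟨ *-monoʳ-≤ (<⇒≤ (*-pos 0<ε 0<δ)) (fromℕ-mono-≤ N≤n) ⟩
        fromℕ n * (ε * δ)             ≈⟨ +-identityˡ _ ⟨
        0# + fromℕ n * (ε * δ)        ≤⟨ +-monoˡ-≤ _ (<⇒≤ 0<ε) ⟩
        ε + fromℕ n * (ε * δ)         ≈⟨ solve 3 (λ ε ν δ → ε :+ ν :* (ε :* δ) :=
                                           (con (+ 1) :+ ν :* δ) :* ε) refl ε (fromℕ n) δ ⟩
        (1# + fromℕ n * δ) * ε        ∎)

  geometric-error⇒⟶ : ∀ {s : ℕ → Carrier} {l σ C : Carrier} → 0# ≤ σ → σ < 1# → 0# ≤ C →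
    (∀ m → s (suc m) - l ≤ C * σ ^ m × l - s (suc m) ≤ C * σ ^ m) → s ⟶ l
  geometric-error⇒⟶ {s} {l} {σ} {C} 0≤σ σ<1 0≤C close ε 0<ε = suc N , bound
    where
    1+C>0 : 0# < 1# + C
    1+C>0 = begin-strict
      0#        <⟨ 0<1 ⟩
      1#        ≈⟨ +-identityʳ 1# ⟨
      1# + 0#   ≤⟨ +-monoʳ-≤ 1# 0≤C ⟩
      1# + C    ∎
    inverse = #0⇒invertible (#-sym (<⇒# 1+C>0))
    y = proj₁ inverse
    y[1+C]≈1 = proj₂ inverse
    0<y : 0# < y
    0<y = 0≤∧#0⇒0<
      (*-cancelˡ-≤ 1+C>0 (≤-trans (≤-reflexive (zeroʳ _))
        (≤-trans (<⇒≤ 0<1) (≤-reflexive (sym (trans (*-comm _ y) y[1+C]≈1))))))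
      (invertible⇒#0 (trans (*-comm _ y) y[1+C]≈1))
    eventually = ^-eventually-< 0≤σ σ<1 (*-pos 0<y 0<ε)
    N = proj₁ eventually

    small : ∀ m → N ℕ.≤ m → C * σ ^ m < ε
    small m N≤m = begin-strict
      C * σ ^ m          ≈⟨ +-identityˡ _ ⟨
      0# + C * σ ^ m     ≤⟨ +-monoˡ-≤ _ (^-nonNeg m 0≤σ) ⟩
      σ ^ m + C * σ ^ m  ≈⟨ solve 2 (λ s C → s :+ C :* s := (con (+ 1) :+ C) :* s) refl (σ ^ m) C ⟩
      (1# + C) * σ ^ m   <⟨ *-monoˡ-< 1+C>0 (proj₂ eventually m N≤m) ⟩
      (1# + C) * (y * ε) ≈⟨ solve 3 (λ a y ε → a :* (y :* ε) := y :* a :* ε) refl (1# + C) y ε ⟩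
      y * (1# + C) * ε   ≈⟨ *-congʳ y[1+C]≈1 ⟩
      1# * ε             ≈⟨ *-identityˡ ε ⟩
      ε                  ∎

    bound : ∀ n → suc N ℕ.≤ n → s n - l < ε × l - s n < ε
    bound (suc m) (ℕ.s≤s N≤m) =
      ≤-<-trans (proj₁ (close m)) (small m N≤m) , ≤-<-trans (proj₂ (close m)) (small m N≤m)

module GeometricDecay {c ℓ₁ ℓ₂} (R : RealNumbers c ℓ₁ ℓ₂) (A ρ : RealNumbers.Carrier R)
  (0≤A : RealNumbers._≤_ R (RealNumbers.0# R) A) (1≤ρ : RealNumbers._≤_ R (RealNumbers.1# R) ρ)
  (A<ρ : RealNumbers._<_ R A ρ) where
  open RealNumbers R hiding (zero)
  open OrderedFieldProperties orderedField
  open Convergence R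
  open IntegerCoefficients commutativeRing using (solve; _:=_; _:*_)
  open Exp semiring using (^-homo-*; ^-assocʳ; ^-congˡ)
  open ≤-Reasoning

  private
    0<ρ : 0# < ρ
    0<ρ = 1≤x⇒0<x 1≤ρ

    ρ⁻¹ : ∃[ y ] y * ρ ≈ 1#
    ρ⁻¹ = #0⇒invertible (#-sym (<⇒# 0<ρ))

  σ : Carrier
  σ = proj₁ ρ⁻¹ * A

  ρ*σ : ρ * σ ≈ A
  ρ*σ = trans (sym (*-assoc _ _ _)) (trans (*-congʳ (trans (*-comm _ _) (proj₂ ρ⁻¹))) (*-identityˡ A))

  0≤σ : 0# ≤ σ
  0≤σ = *-cancelˡ-≤ 0<ρ (≤-trans (≤-reflexive (zeroʳ _)) (≤-trans 0≤A (≤-reflexive (sym ρ*σ))))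

  σ<1 : σ < 1#
  σ<1 = *-cancelˡ-< 0<ρ (begin-strict
    ρ * σ     ≈⟨ ρ*σ ⟩
    A         <⟨ A<ρ ⟩
    ρ         ≈⟨ *-identityʳ _ ⟨
    ρ * 1#    ∎)

  A^N≤ : ∀ {m p} → m ℕ.≤ p → A ^ (m ℕ.+ p) ≤ (ρ * ρ) ^ p * σ ^ (m ℕ.+ p)
  A^N≤ {m} {p} m≤p = begin
    A ^ (m ℕ.+ p)                        ≈⟨ ^-congˡ (m ℕ.+ p) ρ*σ ⟨
    (ρ * σ) ^ (m ℕ.+ p)                  ≈⟨ ^-distrib-* (m ℕ.+ p) ρ σ ⟩
    ρ ^ (m ℕ.+ p) * σ ^ (m ℕ.+ p)        ≤⟨ *-monoʳ-≤ (^-nonNeg (m ℕ.+ p) 0≤σ) (^-monoʳ-≤ 1≤ρ (ℕ.+-monoˡ-≤ p m≤p)) ⟩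
    ρ ^ (p ℕ.+ p) * σ ^ (m ℕ.+ p)        ≈⟨ *-congʳ (trans (^-homo-* ρ p p) (sym (^-distrib-* p ρ ρ))) ⟩
    (ρ * ρ) ^ p * σ ^ (m ℕ.+ p)          ∎

  halving : ∃[ h ] σ ^ suc h * fromℕ 2 ≤ 1#
  halving = choose (#0⇒invertible (#-sym (<⇒# (0<fromℕ 2))))
    where
    choose : (∃[ y ] y * fromℕ 2 ≈ 1#) → ∃[ h ] σ ^ suc h * fromℕ 2 ≤ 1#
    choose (y , y*2≈1) = proj₁ small , (begin
      σ ^ suc (proj₁ small) * fromℕ 2   ≤⟨ *-monoʳ-≤ (0≤fromℕ 2) (<⇒≤ (proj₂ small _ (ℕ.n≤1+n _))) ⟩
      y * fromℕ 2                       ≈⟨ y*2≈1 ⟩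
      1#                                ∎)
      where
      0<y : 0# < y
      0<y = *-cancelˡ-< (0<fromℕ 2) (begin-strict
        fromℕ 2 * 0#   ≈⟨ zeroʳ _ ⟩
        0#             <⟨ 0<1 ⟩
        1#             ≈⟨ y*2≈1 ⟨
        y * fromℕ 2    ≈⟨ *-comm _ _ ⟩
        fromℕ 2 * y    ∎)
      small = ^-eventually-< 0≤σ σ<1 0<y

  module _ (h : ℕ) (half : σ ^ suc h * fromℕ 2 ≤ 1#) {m p : ℕ} (m≤p : m ℕ.≤ p) where
    private
      N J : ℕ
      N = m ℕ.+ p
      J = N ℕ./ (2 ℕ.* suc h)

    m+hJ≤N : m ℕ.+ suc h ℕ.* J ℕ.≤ N
    m+hJ≤N = ℕ.+-monoʳ-≤ m (ℕ.*-cancelˡ-≤ 2 (ℕ.≤-trans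
      (ℕ.≤-reflexive (≡.trans (≡.sym (ℕ.*-assoc 2 (suc h) J)) (ℕ.*-comm (2 ℕ.* suc h) J)))
      (ℕ.≤-trans (ℕ.m/n*n≤m N (2 ℕ.* suc h))
        (ℕ.≤-trans (ℕ.+-monoˡ-≤ p m≤p) (ℕ.≤-reflexive (≡.cong (p ℕ.+_) (≡.sym (ℕ.+-identityʳ p))))))))

    2^J*σ^N≤ : fromℕ 2 ^ J * σ ^ N ≤ σ ^ m
    2^J*σ^N≤ = begin
      fromℕ 2 ^ J * σ ^ N
        ≤⟨ *-monoˡ-≤ (^-nonNeg J (0≤fromℕ 2)) (^-antimonoʳ-≤ 0≤σ (<⇒≤ σ<1) m+hJ≤N) ⟩
      fromℕ 2 ^ J * σ ^ (m ℕ.+ suc h ℕ.* J)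
        ≈⟨ *-congˡ (trans (^-homo-* σ m (suc h ℕ.* J)) (*-congˡ (sym (^-assocʳ σ (suc h) J)))) ⟩
      fromℕ 2 ^ J * (σ ^ m * (σ ^ suc h) ^ J)
        ≈⟨ solve 3 (λ a b c → a :* (b :* c) := b :* (c :* a)) refl (fromℕ 2 ^ J) (σ ^ m) ((σ ^ suc h) ^ J) ⟩
      σ ^ m * ((σ ^ suc h) ^ J * fromℕ 2 ^ J)
        ≈⟨ *-congˡ (^-distrib-* J (σ ^ suc h) (fromℕ 2)) ⟨
      σ ^ m * (σ ^ suc h * fromℕ 2) ^ J
        ≤⟨ *-monoˡ-≤ (^-nonNeg m 0≤σ) (≤-trans
             (^-monoˡ-≤ J (*-nonNeg (^-nonNeg (suc h) 0≤σ) (0≤fromℕ 2)) half) (≤-reflexive (1^n≈1 J))) ⟩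
      σ ^ m * 1#
        ≈⟨ *-identityʳ _ ⟩
      σ ^ m ∎

    -- Once σ^(L / 2) ≤ 1 / 2, the decay of A^N against ρ^(2p) beats the growth 2^(N / L).
    2^J*A^N≤ : ∀ M → fromℕ (M ℕ.* 2 ℕ.^ J) * A ^ N ≤ fromℕ M * ((ρ * ρ) ^ p * σ ^ m)
    2^J*A^N≤ M = begin
      fromℕ (M ℕ.* 2 ℕ.^ J) * A ^ N
        ≤⟨ *-monoˡ-≤ (0≤fromℕ (M ℕ.* 2 ℕ.^ J)) (A^N≤ m≤p) ⟩
      fromℕ (M ℕ.* 2 ℕ.^ J) * ((ρ * ρ) ^ p * σ ^ N)
        ≈⟨ *-congʳ (trans (fromℕ-* M (2 ℕ.^ J)) (*-congˡ (fromℕ-^ 2 J))) ⟩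
      fromℕ M * fromℕ 2 ^ J * ((ρ * ρ) ^ p * σ ^ N)
        ≈⟨ solve 4 (λ a b c d → a :* b :* (c :* d) := a :* (c :* (b :* d))) refl (fromℕ M) (fromℕ 2 ^ J) ((ρ * ρ) ^ p) (σ ^ N) ⟩
      fromℕ M * ((ρ * ρ) ^ p * (fromℕ 2 ^ J * σ ^ N))
        ≤⟨ *-monoˡ-≤ (0≤fromℕ M) (*-monoˡ-≤ (^-nonNeg p (<⇒≤ (*-pos 0<ρ 0<ρ))) 2^J*σ^N≤) ⟩
      fromℕ M * ((ρ * ρ) ^ p * σ ^ m) ∎

-- Finite sums

module FiniteSums {a ℓ} (A : CommutativeSemiring a ℓ) where
  open CommutativeSemiring A hiding (zero)
  open SemiringSum semiring public
    using (sum; sum-cong-≋; ∑-distrib-+; ∑-comm; sum-permute; *-distribˡ-sum; *-distribʳ-sum; sum-replicate; sum-replicate-zero)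
  open Sum *-commutativeMonoid public
    using () renaming (sum to prod; sum-cong-≋ to prod-cong; ∑-distrib-+ to prod-distrib-*)
  open SetoidReasoning setoid

  [_] : ∀ {p} {P : Set p} → Dec P → Carrier
  [ P? ] = if does P? then 1# else 0#

  [yes] : ∀ {p} {P : Set p} (P? : Dec P) → P → [ P? ] ≈ 1#
  [yes] (yes _) _ = refl
  [yes] (no ¬p) p = contradiction p ¬p

  [no] : ∀ {p} {P : Set p} (P? : Dec P) → ¬ P → [ P? ] ≈ 0#
  [no] (yes p) ¬p = contradiction p ¬p
  [no] (no _)  _  = refl

  []-cong : ∀ {p q} {P : Set p} {Q : Set q} (P? : Dec P) (Q? : Dec Q) →
            (P → Q) → (Q → P) → [ P? ] ≈ [ Q? ]
  []-cong (yes p) Q? P⇒Q _   = sym ([yes] Q? (P⇒Q p))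
  []-cong (no ¬p) Q? _   Q⇒P = sym ([no] Q? (¬p ∘ Q⇒P))

  if-then-0≈* : ∀ {p} {P : Set p} (P? : Dec P) x → (if does P? then x else 0#) ≈ [ P? ] * x
  if-then-0≈* (yes _) x = sym (*-identityˡ x)
  if-then-0≈* (no _)  x = sym (zeroˡ x)

  sum-zero : ∀ {n} (f : Vector Carrier n) → (∀ i → f i ≈ 0#) → sum f ≈ 0#
  sum-zero {n} f f≈0 = trans (sum-cong-≋ f≈0) (sum-replicate-zero n)

  sum-single : ∀ {n} (f : Vector Carrier n) i → (∀ j → ¬ (j ≡ i) → f j ≈ 0#) → sum f ≈ f i
  sum-single f zero off = trans (+-congˡ (sum-zero _ λ j → off (suc j) λ ())) (+-identityʳ _)
  sum-single f (suc i) off = trans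
    (+-cong (off zero λ ()) (sum-single (f ∘ suc) i λ j j≢i → off (suc j) (j≢i ∘ Fin.suc-injective)))
    (+-identityˡ _)

  prod-zero : ∀ {n} (f : Vector Carrier n) i → f i ≈ 0# → prod f ≈ 0#
  prod-zero f zero    fi≈0 = trans (*-congʳ fi≈0) (zeroˡ _)
  prod-zero f (suc i) fi≈0 = trans (*-congˡ (prod-zero (f ∘ suc) i fi≈0)) (zeroʳ _)

  sum-++ : ∀ m {n} (f : Vector Carrier (m ℕ.+ n)) →
           sum f ≈ sum (λ i → f (i ↑ˡ n)) + sum (λ j → f (m ↑ʳ j))
  sum-++ zero    f = sym (+-identityˡ _)
  sum-++ (suc m) f = trans (+-congˡ (sum-++ m (f ∘ suc))) (sym (+-assoc _ _ _))

  sum-combine : ∀ m {n} (f : Vector Carrier (m ℕ.* n)) →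
                sum f ≈ sum {m} (λ i → sum {n} (λ j → f (combine i j)))
  sum-combine zero        f = refl
  sum-combine (suc m) {n} f = trans (sum-++ n f) (+-congˡ (sum-combine m (f ∘ (n ↑ʳ_))))

module TupleSums {c ℓ₁ ℓ₂} (K : HeytingField c ℓ₁ ℓ₂) {q : ℕ} (enumeration : HasSize K q)
                 {a ℓ} (A : CommutativeSemiring a ℓ) where
  open FiniteField K enumeration using (element; tuple; code; tuple-code)
  open HeytingField K using () renaming (Carrier to k; _≈_ to _≈ₖ_)
  open Inverse enumeration using (from-cong; strictlyInverseʳ)
  open CommutativeSemiring A hiding (zero)
  open FiniteSums A
  open SetoidReasoning setoid

  tuple-injective : ∀ n {s t : Fin (q ℕ.^ n)} → (∀ i → tuple s i ≈ₖ tuple t i) → s ≡ t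
  tuple-injective zero    {zero} {zero} _   = ≡.refl
  tuple-injective (suc n) {s}    {t}    s≈t = s≡t
    where
    digit : ∀ i → finToFun {q} {suc n} s i ≡ finToFun t i
    digit i = ≡.trans (≡.sym (strictlyInverseʳ _)) (≡.trans (from-cong (s≈t i)) (strictlyInverseʳ _))
    s≡t : s ≡ t
    s≡t = ≡.trans (≡.sym (Fin.combine-remQuot {q} (q ℕ.^ n) s))
      (≡.trans (≡.cong₂ combine (digit zero)
        (tuple-injective n λ i → HeytingField.reflexive K (≡.cong element (digit (suc i)))))
      (Fin.combine-remQuot {q} (q ℕ.^ n) t))

  tuple-combine-head : ∀ {n} s (t : Fin (q ℕ.^ n)) → tuple {suc n} (combine s t) zero ≡ element s
  tuple-combine-head {n} s t = ≡.cong (element ∘ proj₁) (Fin.remQuot-combine {q} {q ℕ.^ n} s t)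

  tuple-combine-tail : ∀ {n} s (t : Fin (q ℕ.^ n)) i →
                       tuple {suc n} (combine s t) (suc i) ≡ tuple t i
  tuple-combine-tail {n} s t i =
    ≡.cong (λ p → tuple {n} (proj₂ p) i) (Fin.remQuot-combine {q} {q ℕ.^ n} s t)

  tupleSum : ∀ n → (Vector k n → Carrier) → Carrier
  tupleSum n F = sum {q ℕ.^ n} (λ t → F (tuple t))

  tupleSum-head-tail : ∀ n (F : k → Vector k n → Carrier) →
    (∀ {x y} {u v : Vector k n} → x ≈ₖ y → (∀ i → u i ≈ₖ v i) → F x u ≈ F y v) →
    tupleSum (suc n) (λ x → F (x zero) (x ∘ suc)) ≈ sum (λ s → tupleSum n (F (element s)))
  tupleSum-head-tail n F F-cong = trans
    (sum-combine q (λ t → F (tuple {suc n} t zero) (tuple {suc n} t ∘ suc)))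
    (sum-cong-≋ λ s → sum-cong-≋ {q ℕ.^ n} λ t →
      F-cong (HeytingField.reflexive K (tuple-combine-head {n} s t))
             (λ i → HeytingField.reflexive K (tuple-combine-tail {n} s t i)))

  tupleSum-prod : ∀ n (g : Fin n → k → Carrier) → (∀ i {x y} → x ≈ₖ y → g i x ≈ g i y) →
    tupleSum n (λ x → prod (λ i → g i (x i))) ≈ prod (λ i → sum (λ s → g i (element s)))
  tupleSum-prod zero    g g-cong = +-identityʳ 1#
  tupleSum-prod (suc n) g g-cong = begin
    tupleSum (suc n) (λ x → g zero (x zero) * prod (λ i → g (suc i) (x (suc i))))
      ≈⟨ tupleSum-head-tail n (λ x u → g zero x * prod (λ i → g (suc i) (u i)))
           (λ x≈y u≈v → *-cong (g-cong zero x≈y) (prod-cong λ i → g-cong (suc i) (u≈v i))) ⟩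
    sum (λ s → tupleSum n (λ u → g zero (element s) * prod (λ i → g (suc i) (u i))))
      ≈⟨ sum-cong-≋ (λ s → *-distribˡ-sum {q ℕ.^ n} (g zero (element s)) _) ⟨
    sum (λ s → g zero (element s) * tupleSum n (λ u → prod (λ i → g (suc i) (u i))))
      ≈⟨ *-distribʳ-sum _ (λ s → g zero (element s)) ⟨
    sum (λ s → g zero (element s)) * tupleSum n (λ u → prod (λ i → g (suc i) (u i)))
      ≈⟨ *-congˡ (tupleSum-prod n (g ∘ suc) (λ i → g-cong (suc i))) ⟩
    prod (λ i → sum (λ s → g i (element s))) ∎

  tupleSum-single : ∀ n (F : Vector k n → Carrier) (y : Vector k n) →
    (∀ {u v} → (∀ i → u i ≈ₖ v i) → F u ≈ F v) →
    (∀ x → ¬ (∀ i → x i ≈ₖ y i) → F x ≈ 0#) → tupleSum n F ≈ F y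
  tupleSum-single n F y F-cong off = trans
    (sum-single (λ t → F (tuple t)) (code y) λ t t≢y → off (tuple t) λ t≈y →
      t≢y (tuple-injective n λ i → HeytingField.trans K (t≈y i) (HeytingField.sym K (tuple-code y i))))
    (F-cong (tuple-code y))

module Counting {c ℓ₁ ℓ₂} (F : OrderedField c ℓ₁ ℓ₂) where
  open OrderedField F hiding (zero)
  open OrderedFieldProperties F
  commutativeSemiring : CommutativeSemiring c ℓ₁
  commutativeSemiring = CommutativeRing.commutativeSemiring commutativeRing
  open FiniteSums commutativeSemiring
  open ≤-Reasoning

  0≤[] : ∀ {p} {P : Set p} (P? : Dec P) → 0# ≤ [ P? ]
  0≤[] (yes _) = <⇒≤ 0<1
  0≤[] (no _)  = ≤-refl

  []≤1 : ∀ {p} {P : Set p} (P? : Dec P) → [ P? ] ≤ 1#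
  []≤1 (yes _) = ≤-refl
  []≤1 (no _)  = <⇒≤ 0<1

  sum-nonNeg : ∀ {n} {f : Vector Carrier n} → (∀ i → 0# ≤ f i) → 0# ≤ sum f
  sum-nonNeg {n} {f} 0≤f = begin
    0#                          ≈⟨ sum-replicate-zero n ⟨
    sum (Vector.replicate n 0#) ≤⟨ ∑-mono-≤ 0≤f ⟩
    sum f                       ∎

  summand≤sum : ∀ {n} {f : Vector Carrier n} → (∀ i → 0# ≤ f i) → ∀ i → f i ≤ sum f
  summand≤sum {f = f} 0≤f zero = begin
    f zero                  ≈⟨ +-identityʳ _ ⟨
    f zero + 0#             ≤⟨ +-monoʳ-≤ _ (sum-nonNeg (0≤f ∘ suc)) ⟩
    f zero + sum (f ∘ suc)  ∎
  summand≤sum {f = f} 0≤f (suc i) = begin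
    f (suc i)               ≈⟨ +-identityˡ _ ⟨
    0# + f (suc i)          ≤⟨ +-mono-≤ (0≤f zero) (summand≤sum (0≤f ∘ suc) i) ⟩
    f zero + sum (f ∘ suc)  ∎

  sum-ones : ∀ n → sum {n} (λ _ → 1#) ≈ fromℕ n
  sum-ones n = sum-replicate n

  sum-const : ∀ n x → sum {n} (λ _ → x) ≈ fromℕ n * x
  sum-const n x = begin-equality
    sum {n} (λ _ → x)       ≈⟨ sum-cong-≋ {n} (λ _ → *-identityˡ x) ⟨
    sum {n} (λ _ → 1# * x)  ≈⟨ *-distribʳ-sum {n} x _ ⟨
    sum {n} (λ _ → 1#) * x  ≈⟨ *-congʳ (sum-ones n) ⟩
    fromℕ n * x             ∎

  prod-const : ∀ n {x} → prod {n} (λ _ → x) ≈ x ^ n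
  prod-const zero    = refl
  prod-const (suc n) = *-congˡ (prod-const n)

  count≤1 : ∀ {n p} {P : Fin n → Set p} (P? : ∀ i → Dec (P i)) →
            (∀ {i j} → P i → P j → i ≡ j) → sum (λ i → [ P? i ]) ≤ 1#
  count≤1 P? unique with Fin.any? P?
  ... | yes (i , p) = ≤-trans (≤-reflexive (sum-single _ i
          λ j j≢i → [no] (P? j) λ p′ → j≢i (unique p′ p))) ([]≤1 (P? i))
  ... | no ¬∃p = ≤-trans (≤-reflexive (sum-zero _ λ i → [no] (P? i) λ p → ¬∃p (i , p))) (<⇒≤ 0<1)

  count-injection : ∀ {m n p r} {P : Fin m → Set p} {Q : Fin n → Set r}
    (P? : ∀ i → Dec (P i)) (Q? : ∀ j → Dec (Q j)) (f : ∀ i → P i → Fin n) →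
    (∀ i p → Q (f i p)) → (∀ {i j} (p : P i) (p′ : P j) → f i p ≡ f j p′ → i ≡ j) →
    sum (λ i → [ P? i ]) ≤ sum (λ j → [ Q? j ])
  count-injection {m} {n} {P = P} {Q = Q} P? Q? f f-Q f-injective = begin
    sum (λ i → [ P? i ])                  ≤⟨ ∑-mono-≤ (λ i → hit (P? i)) ⟩
    sum (λ i → sum (λ j → [ hit? (P? i) j ]))    ≈⟨ ∑-comm (λ i j → [ hit? (P? i) j ]) ⟩
    sum (λ j → sum (λ i → [ hit? (P? i) j ]))    ≤⟨ ∑-mono-≤ (λ j → fibre (Q? j)) ⟩
    sum (λ j → [ Q? j ])                  ∎
    where
    Hit : ∀ {i} → Dec (P i) → Fin n → Set
    Hit {i} (yes p) j = f i p ≡ j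
    Hit     (no _)  j = ⊥

    hit? : ∀ {i} (d : Dec (P i)) j → Dec (Hit d j)
    hit? {i} (yes p) j = f i p Fin.≟ j
    hit?     (no _)  j = no λ ()

    witness : ∀ {i j} (d : Dec (P i)) → Hit d j → ∃ λ p → f i p ≡ j
    witness (yes p) fi≡j = p , fi≡j

    hit : ∀ {i} (d : Dec (P i)) → [ d ] ≤ sum (λ j → [ hit? d j ])
    hit (no ¬p) = sum-nonNeg {n} {λ j → [ hit? (no ¬p) j ]} λ j → 0≤[] (hit? (no ¬p) j)
    hit {i} (yes p) = ≤-trans (≤-reflexive (sym ([yes] (f i p Fin.≟ f i p) ≡.refl)))
                              (summand≤sum (λ j → 0≤[] (f i p Fin.≟ j)) (f i p))

    fibre : ∀ {j} (d : Dec (Q j)) → sum (λ i → [ hit? (P? i) j ]) ≤ [ d ]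
    fibre (yes _) = count≤1 (λ i → hit? (P? i) _) λ {i} {i′} h h′ →
      f-injective (proj₁ (witness (P? i) h)) (proj₁ (witness (P? i′) h′))
        (≡.trans (proj₂ (witness (P? i) h)) (≡.sym (proj₂ (witness (P? i′) h′))))
    fibre (no ¬q) = ≤-reflexive (sum-zero _ λ i → [no] (hit? (P? i) _) λ h →
      ¬q (≡.subst Q (proj₂ (witness (P? i) h)) (f-Q i (proj₁ (witness (P? i) h)))))

-- Characters and Fourier transforms

module ComplexProperties {r r₁ r₂} (R : RealNumbers r r₁ r₂) where
  open RealNumbers R hiding (zero)
  open Complex R
  open OrderedFieldProperties orderedField
  open IntegerCoefficients commutativeRing using (solve; _:=_; _:+_; _:*_; _:-_; :-_; con)
  open Counting orderedField

  infixl 6 _+ᶜ_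
  _+ᶜ_ : ℂ → ℂ → ℂ
  z +ᶜ w = (re z + re w) +i (im z + im w)

  0ᶜ : ℂ
  0ᶜ = 0# +i 0#

  real : Carrier → ℂ
  real x = x +i 0#

  +ᶜ-*ᶜ-commutativeSemiring : CommutativeSemiring r r₁
  +ᶜ-*ᶜ-commutativeSemiring = record
    { _≈_ = _≈ᶜ_ ; _+_ = _+ᶜ_ ; _*_ = _*ᶜ_ ; 0# = 0ᶜ ; 1# = 1ᶜ
    ; isCommutativeSemiring = record
      { isSemiring = record
        { isSemiringWithoutAnnihilatingZero = record
          { +-isCommutativeMonoid = record
            { isMonoid = record
              { isSemigroup = record
                { isMagma = record
                  { isEquivalence = record
                    { refl  = refl , refl
                    ; sym   = λ (p , q) → sym p , sym q
                    ; trans = λ (p , q) (p′ , q′) → trans p p′ , trans q q′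
                    }
                  ; ∙-cong = λ (p , q) (p′ , q′) → +-cong p p′ , +-cong q q′
                  }
                ; assoc = λ x y z → +-assoc _ _ _ , +-assoc _ _ _
                }
              ; identity = (λ x → +-identityˡ _ , +-identityˡ _) , (λ x → +-identityʳ _ , +-identityʳ _)
              }
            ; comm = λ x y → +-comm _ _ , +-comm _ _
            }
          ; *-cong = λ (p , q) (p′ , q′) →
              +-cong (*-cong p p′) (-‿cong (*-cong q q′)) , +-cong (*-cong p q′) (*-cong q p′)
          ; *-assoc = λ (a +i b) (c +i d) (e +i f) →
              solve 6 (λ a b c d e f →
                (a :* c :- b :* d) :* e :- (a :* d :+ b :* c) :* f :=
                a :* (c :* e :- d :* f) :- b :* (c :* f :+ d :* e)) refl a b c d e f ,
              solve 6 (λ a b c d e f →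
                (a :* c :- b :* d) :* f :+ (a :* d :+ b :* c) :* e :=
                a :* (c :* f :+ d :* e) :+ b :* (c :* e :- d :* f)) refl a b c d e f
          ; *-identity =
              (λ (a +i b) →
                solve 2 (λ a b → con (+ 1) :* a :- con (+ 0) :* b := a) refl a b ,
                solve 2 (λ a b → con (+ 1) :* b :+ con (+ 0) :* a := b) refl a b) ,
              (λ (a +i b) →
                solve 2 (λ a b → a :* con (+ 1) :- b :* con (+ 0) := a) refl a b ,
                solve 2 (λ a b → a :* con (+ 0) :+ b :* con (+ 1) := b) refl a b)
          ; distrib =
              (λ (a +i b) (c +i d) (e +i f) →
                solve 6 (λ a b c d e f → a :* (c :+ e) :- b :* (d :+ f) :=
                  (a :* c :- b :* d) :+ (a :* e :- b :* f)) refl a b c d e f ,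
                solve 6 (λ a b c d e f → a :* (d :+ f) :+ b :* (c :+ e) :=
                  (a :* d :+ b :* c) :+ (a :* f :+ b :* e)) refl a b c d e f) ,
              (λ (a +i b) (c +i d) (e +i f) →
                solve 6 (λ a b c d e f → (c :+ e) :* a :- (d :+ f) :* b :=
                  (c :* a :- d :* b) :+ (e :* a :- f :* b)) refl a b c d e f ,
                solve 6 (λ a b c d e f → (c :+ e) :* b :+ (d :+ f) :* a :=
                  (c :* b :+ d :* a) :+ (e :* b :+ f :* a)) refl a b c d e f)
          }
        ; zero =
            (λ (a +i b) →
              solve 2 (λ a b → con (+ 0) :* a :- con (+ 0) :* b := con (+ 0)) refl a b ,
              solve 2 (λ a b → con (+ 0) :* b :+ con (+ 0) :* a := con (+ 0)) refl a b) ,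
            (λ (a +i b) →
              solve 2 (λ a b → a :* con (+ 0) :- b :* con (+ 0) := con (+ 0)) refl a b ,
              solve 2 (λ a b → a :* con (+ 0) :+ b :* con (+ 0) := con (+ 0)) refl a b)
        }
      ; *-comm = λ (a +i b) (c +i d) →
          solve 4 (λ a b c d → a :* c :- b :* d := c :* a :- d :* b) refl a b c d ,
          solve 4 (λ a b c d → a :* d :+ b :* c := c :* b :+ d :* a) refl a b c d
      }
    }

  module ℂ′ = CommutativeSemiring +ᶜ-*ᶜ-commutativeSemiring
  module ℝΣ = FiniteSums commutativeSemiring
  module ℂΣ = FiniteSums +ᶜ-*ᶜ-commutativeSemiring

  ∑ᶜ≈sum : ∀ {n} (z : Vector ℂ n) → ∑ᶜ z ≈ᶜ ℂΣ.sum z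
  ∑ᶜ≈sum {zero}  z = ℂ′.refl
  ∑ᶜ≈sum {suc n} z = ℂ′.+-congˡ {z zero} (∑ᶜ≈sum (z ∘ suc))

  re-sum : ∀ {n} (z : Vector ℂ n) → re (ℂΣ.sum z) ≈ ℝΣ.sum (re ∘ z)
  re-sum z = sym (proj₁ (∑ᶜ≈sum z))

  real-cong : ∀ {x y} → x ≈ y → real x ≈ᶜ real y
  real-cong x≈y = x≈y , refl

  real-* : ∀ x y → real (x * y) ≈ᶜ real x *ᶜ real y
  real-* x y = solve 2 (λ x y → x :* y := x :* y :- con (+ 0) :* con (+ 0)) refl x y ,
               solve 2 (λ x y → con (+ 0) := x :* con (+ 0) :+ con (+ 0) :* y) refl x y

  real-+ : ∀ x y → real (x + y) ≈ᶜ real x +ᶜ real y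
  real-+ x y = refl , sym (+-identityˡ 0#)

  ·ᶜ≈*ᶜ : ∀ t z → t ·ᶜ z ≈ᶜ real t *ᶜ z
  ·ᶜ≈*ᶜ t (x +i y) =
    solve 3 (λ t x y → t :* x := t :* x :- con (+ 0) :* y) refl t x y ,
    solve 3 (λ t x y → t :* y := t :* y :+ con (+ 0) :* x) refl t x y

  real-sum : ∀ {n} (f : Vector Carrier n) → real (ℝΣ.sum f) ≈ᶜ ℂΣ.sum (real ∘ f)
  real-sum {zero}  f = ℂ′.refl
  real-sum {suc n} f = ℂ′.trans (real-+ (f zero) _) (ℂ′.+-congˡ {real (f zero)} (real-sum (f ∘ suc)))

  real-prod : ∀ {n} (f : Vector Carrier n) → real (ℝΣ.prod f) ≈ᶜ ℂΣ.prod (real ∘ f)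
  real-prod {zero}  f = ℂ′.refl
  real-prod {suc n} f = ℂ′.trans (real-* (f zero) _) (ℂ′.*-congˡ {real (f zero)} (real-prod (f ∘ suc)))

  normSquared : ℂ → Carrier
  normSquared z = re z * re z + im z * im z

  0≤normSquared : ∀ z → 0# ≤ normSquared z
  0≤normSquared z = ≤-trans (≤-reflexive (sym (+-identityˡ 0#)))
                            (+-mono-≤ (0≤x*x (re z)) (0≤x*x (im z)))

  normSquared-* : ∀ z w → normSquared (z *ᶜ w) ≈ normSquared z * normSquared w
  normSquared-* (a +i b) (c +i d) = solve 4 (λ a b c d →
    (a :* c :- b :* d) :* (a :* c :- b :* d) :+ (a :* d :+ b :* c) :* (a :* d :+ b :* c) :=
    (a :* a :+ b :* b) :* (c :* c :+ d :* d)) refl a b c d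

  0≤∣_∣ : ∀ z → 0# ≤ ∣ z ∣
  0≤∣ z ∣ = √-nonNeg (0≤normSquared z)

  prod-modulus : ∀ {n} (z : Vector ℂ n) → 0# ≤ ℝΣ.prod (λ i → ∣ z i ∣) ×
    ℝΣ.prod (λ i → ∣ z i ∣) * ℝΣ.prod (λ i → ∣ z i ∣) ≈ normSquared (ℂΣ.prod z)
  prod-modulus {zero} z = <⇒≤ 0<1 ,
    solve 1 (λ _ → con (+ 1) :* con (+ 1) := con (+ 1) :* con (+ 1) :+ con (+ 0) :* con (+ 0)) refl 0#
  prod-modulus {suc n} z with prod-modulus (z ∘ suc)
  ... | 0≤p , pp≈N = *-nonNeg 0≤∣ z zero ∣ 0≤p ,
    trans (solve 2 (λ a p → a :* p :* (a :* p) := a :* a :* (p :* p)) refl _ _)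
      (trans (*-cong (√-square (0≤normSquared (z zero))) pp≈N) (sym (normSquared-* (z zero) _)))

  ∣re-prod∣≤ : ∀ {n} (z : Vector ℂ n) →
    re (ℂΣ.prod z) ≤ ℝΣ.prod (λ i → ∣ z i ∣) × - re (ℂΣ.prod z) ≤ ℝΣ.prod (λ i → ∣ z i ∣)
  ∣re-prod∣≤ z = square-cancel-≤ 0≤p re²≤p² ,
    square-cancel-≤ 0≤p (≤-trans (≤-reflexive (solve 1 (λ x → :- x :* :- x := x :* x) refl _)) re²≤p²)
    where
    0≤p = proj₁ (prod-modulus z)
    re²≤p² = ≤-trans (≤-trans (≤-reflexive (sym (+-identityʳ _))) (+-monoʳ-≤ _ (0≤x*x (im (ℂΣ.prod z)))))
                     (≤-reflexive (sym (proj₂ (prod-modulus z))))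

  unit-idempotent : ∀ z → normSquared z ≈ 1# → z *ᶜ z ≈ᶜ z → z ≈ᶜ 1ᶜ
  unit-idempotent z@(a +i b) N≈1 (p , q) =
    trans (trans (sym (*-identityʳ a)) (trans (*-congˡ (sym N≈1))
      (trans (solve 2 (λ a b → a :* (a :* a :+ b :* b) :=
        (a :* a :- b :* b) :* a :+ (a :* b :+ b :* a) :* b) refl a b)
      (+-cong (*-congʳ p) (*-congʳ q))))) N≈1 ,
    trans (trans (sym (*-identityʳ b)) (trans (*-congˡ (sym N≈1))
      (trans (solve 2 (λ a b → b :* (a :* a :+ b :* b) :=
        (a :* b :+ b :* a) :* a :- (a :* a :- b :* b) :* b) refl a b)
      (+-cong (*-congʳ q) (-‿cong (*-congʳ p))))))
      (solve 2 (λ a b → b :* a :- a :* b := con (+ 0)) refl a b)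

  x*x≈0⇒x≈0 : ∀ {x} → x * x ≈ 0# → x ≈ 0#
  x*x≈0⇒x≈0 {x} xx≈0 = proj₁ (tight x 0#) λ x#0 → proj₂ (tight x 0#) (x≈0 (#0⇒invertible x#0)) x#0
    where
    x≈0 : (∃[ y ] y * x ≈ 1#) → x ≈ 0#
    x≈0 (y , yx≈1) = trans (sym (*-identityˡ x)) (trans (*-congʳ (sym yx≈1))
      (trans (*-assoc y x x) (trans (*-congˡ xx≈0) (zeroʳ y))))

  normSquared≈0⇒≈0 : ∀ z → normSquared z ≈ 0# → z ≈ᶜ 0ᶜ
  normSquared≈0⇒≈0 (a +i b) N≈0 =
    x*x≈0⇒x≈0 (≤-antisym (≤-trans (x≤x+y (0≤x*x b)) (≤-reflexive N≈0)) (0≤x*x a)) ,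
    x*x≈0⇒x≈0 (≤-antisym (≤-trans (x≤x+y (0≤x*x a)) (≤-reflexive (trans (+-comm _ _) N≈0))) (0≤x*x b))
    where
    x≤x+y : ∀ {x y} → 0# ≤ y → x ≤ x + y
    x≤x+y 0≤y = ≤-trans (≤-reflexive (sym (+-identityʳ _))) (+-monoʳ-≤ _ 0≤y)

  fixed⇒≈0 : ∀ u z → ¬ (u ≈ᶜ 1ᶜ) → u *ᶜ z ≈ᶜ z → z ≈ᶜ 0ᶜ
  fixed⇒≈0 u@(c +i d) z@(a +i b) u≉1 (p , q) =
    normSquared≈0⇒≈0 z (proj₁ (tight _ _) λ N#0 → u≉1 (u≈1 (#0⇒invertible N#0)))
    where
    v = (c - 1#) +i d
    vz≈0 : normSquared v * normSquared z ≈ 0#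
    vz≈0 = begin
      normSquared v * normSquared z
        ≈⟨ solve 4 (λ a b c d →
             ((c :- con (+ 1)) :* (c :- con (+ 1)) :+ d :* d) :* (a :* a :+ b :* b) :=
             ((c :* a :- d :* b) :- a) :* ((c :* a :- d :* b) :- a) :+
             ((c :* b :+ d :* a) :- b) :* ((c :* b :+ d :* a) :- b)) refl a b c d ⟩
      ((c * a - d * b) - a) * ((c * a - d * b) - a) + ((c * b + d * a) - b) * ((c * b + d * a) - b)
        ≈⟨ +-cong (*-cong (+-congʳ p) (+-congʳ p)) (*-cong (+-congʳ q) (+-congʳ q)) ⟩
      (a - a) * (a - a) + (b - b) * (b - b)
        ≈⟨ solve 2 (λ a b → (a :- a) :* (a :- a) :+ (b :- b) :* (b :- b) := con (+ 0)) refl a b ⟩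
      0# ∎
      where open SetoidReasoning setoid
    u≈1 : (∃[ y ] y * normSquared z ≈ 1#) → u ≈ᶜ 1ᶜ
    u≈1 (y , yN≈1) = trans (solve 1 (λ c → c := (c :- con (+ 1)) :+ con (+ 1)) refl c)
                       (trans (+-congʳ (proj₁ v≈0)) (+-identityˡ 1#)) , proj₂ v≈0
      where
      v≈0 : v ≈ᶜ 0ᶜ
      v≈0 = normSquared≈0⇒≈0 v (trans (sym (*-identityˡ _)) (trans (*-congʳ (sym yN≈1))
        (trans (solve 3 (λ y n m → y :* n :* m := y :* (m :* n)) refl y (normSquared z) (normSquared v))
        (trans (*-congˡ vz≈0) (zeroʳ y)))))

module FiniteFieldProperties {c ℓ₁ ℓ₂} (K : HeytingField c ℓ₁ ℓ₂) {q : ℕ} (enumeration : HasSize K q) where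
  open HeytingField K hiding (zero) renaming (Carrier to k)
  open FiniteField K enumeration
  open Inverse enumeration using (from-cong; strictlyInverseʳ)

  private
    commutativeRing : CommutativeRing c ℓ₁
    commutativeRing = HeytingCommutativeRing.commutativeRing heytingCommutativeRing
  open CommutativeRing commutativeRing public using () renaming (commutativeSemiring to +-*-commutativeSemiring)

  1≉0 : ¬ (1# ≈ 0#)
  1≉0 1≈0 = proj₂ (tight 1# 0#) 1≈0 (invertible⇒# (1# , 1*[1-0]≈1 , trans (*-comm _ _) 1*[1-0]≈1))
    where
    1*[1-0]≈1 : 1# * (1# - 0#) ≈ 1#
    1*[1-0]≈1 = trans (*-identityˡ _) (trans (+-congˡ (RingProperties.-0#≈0# (CommutativeRing.ring commutativeRing))) (+-identityʳ 1#))

  -- x ≉ 0 only makes x # 0 not false; finiteness lets us search for the inverse.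
  inverse : ∀ {x} → ¬ (x ≈ 0#) → ∃[ y ] y * x ≈ 1#
  inverse {x} x≉0 with Fin.any? (λ t → element t * x ≟ 1#)
  ... | yes (t , tx≈1) = element t , tx≈1
  ... | no ¬invertible = contradiction (proj₁ (tight x 0#) x¬#0) x≉0
    where
    x¬#0 : ¬ (x # 0#)
    x¬#0 x#0 with #⇒invertible x#0
    ... | y , y[x-0]≈1 , _ = ¬invertible (from y ,
      trans (*-congʳ (strictlyInverseˡ y)) (trans
        (*-congˡ (sym (trans (+-congˡ (RingProperties.-0#≈0# (CommutativeRing.ring commutativeRing))) (+-identityʳ x))))
        y[x-0]≈1))

  x*y≈0⇒y≈0 : ∀ {x y} → ¬ (x ≈ 0#) → x * y ≈ 0# → y ≈ 0#
  x*y≈0⇒y≈0 {x} {y} x≉0 xy≈0 with inverse x≉0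
  ... | z , zx≈1 = trans (sym (*-identityˡ y)) (trans (*-congʳ (sym zx≈1))
    (trans (*-assoc z x y) (trans (*-congˡ xy≈0) (zeroʳ z))))

  translation : k → Permutation q q
  translation x = permutation (λ t → from (x + element t)) (λ t → from (- x + element t))
    (λ t → shift x (- x) (trans (sym (+-assoc _ _ _)) (trans (+-congʳ (-‿inverseʳ x)) (+-identityˡ _))))
    (λ t → shift (- x) x (trans (sym (+-assoc _ _ _)) (trans (+-congʳ (-‿inverseˡ x)) (+-identityˡ _))))
    where
    shift : ∀ u v {t} → u + (v + element t) ≈ element t →
            from (u + element (from (v + element t))) ≡ t
    shift u v {t} cancel = ≡.trans
      (from-cong (trans (+-congˡ (strictlyInverseˡ _)) cancel)) (strictlyInverseʳ t)

module CharacterSums {r r₁ r₂ c ℓ₁ ℓ₂} (R : RealNumbers r r₁ r₂) (K : HeytingField c ℓ₁ ℓ₂)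
  {q : ℕ} (enumeration : HasSize K q)
  (ψ : HeytingField.Carrier K → Complex.ℂ R) (ψ-character : Distributions.IsNontrivialCharacter R K enumeration ψ) where
  open Distributions R K enumeration
  open RealNumbers R hiding (zero)
  open Complex R
  open ComplexProperties R
  open OrderedFieldProperties orderedField
  open Counting orderedField
  open FiniteField K enumeration using (element; tuple; _≟_; strictlyInverseˡ)
  open FiniteFieldProperties K enumeration
  private module K = HeytingField K
  open K using () renaming (Carrier to k; _≈_ to _≈ₖ_; _*_ to _*ₖ_; _+_ to _+ₖ_; 0# to 0ₖ)
  private module KΣ = FiniteSums +-*-commutativeSemiring
  private module ℝᵀ = TupleSums K enumeration commutativeSemiring
  private module ℂᵀ = TupleSums K enumeration +ᶜ-*ᶜ-commutativeSemiring
  open IsNontrivialCharacter ψ-character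
  open SetoidReasoning ℂ′.setoid

  private module ψ = MagmaMorphisms.IsMagmaHomomorphism isMagmaHomomorphism

  ψ-0 : ψ 0ₖ ≈ᶜ 1ᶜ
  ψ-0 = unit-idempotent (ψ 0ₖ)
    (trans (sym (√-square (0≤normSquared (ψ 0ₖ)))) (trans (*-cong (unitCircle 0ₖ) (unitCircle 0ₖ)) (*-identityˡ 1#)))
    (ℂ′.trans (ℂ′.sym (ψ.homo 0ₖ 0ₖ)) (ψ.⟦⟧-cong (K.+-identityˡ 0ₖ)))

  ψ-sum : ∀ {n} (x : Vector k n) → ψ (KΣ.sum x) ≈ᶜ ℂΣ.prod (ψ ∘ x)
  ψ-sum {zero}  x = ψ-0
  ψ-sum {suc n} x = ℂ′.trans (ψ.homo _ _) (ℂ′.*-congˡ {ψ (x zero)} (ψ-sum (x ∘ suc)))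

  sum-ψ-≈0 : ∀ {u} → u ≈ₖ 0ₖ → ℂΣ.sum (λ t → ψ (u *ₖ element t)) ≈ᶜ real (fromℕ q)
  sum-ψ-≈0 {u} u≈0 = begin
    ℂΣ.sum (λ t → ψ (u *ₖ element t))
      ≈⟨ ℂΣ.sum-cong-≋ {q} (λ t → ℂ′.trans (ψ.⟦⟧-cong (K.trans (K.*-congʳ u≈0) (K.zeroˡ _))) ψ-0) ⟩
    ℂΣ.sum {q} (λ _ → real 1#)     ≈⟨ real-sum {q} (λ _ → 1#) ⟨
    real (ℝΣ.sum {q} (λ _ → 1#))   ≈⟨ real-cong (sum-ones q) ⟩
    real (fromℕ q) ∎

  sum-ψ-≉0 : ∀ {u} → ¬ (u ≈ₖ 0ₖ) → ℂΣ.sum (λ t → ψ (u *ₖ element t)) ≈ᶜ 0ᶜ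
  sum-ψ-≉0 {u} u≉0 = fixed⇒≈0 (ψ x₀) _ ψx₀≉1 (begin
    ψ x₀ *ᶜ ℂΣ.sum (λ t → ψ (u *ₖ element t))
      ≈⟨ ℂΣ.*-distribˡ-sum {q} (ψ x₀) _ ⟩
    ℂΣ.sum (λ t → ψ x₀ *ᶜ ψ (u *ₖ element t))
      ≈⟨ ℂΣ.sum-cong-≋ {q} (λ t → ℂ′.trans (ℂ′.sym (ψ.homo _ _)) (ψ.⟦⟧-cong (shift t))) ⟩
    ℂΣ.sum (λ t → ψ (u *ₖ element (translation y Permutation.⟨$⟩ʳ t)))
      ≈⟨ ℂΣ.sum-permute (λ t → ψ (u *ₖ element t)) (translation y) ⟨
    ℂΣ.sum (λ t → ψ (u *ₖ element t)) ∎)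
    where
    x₀ = proj₁ nontrivial
    ψx₀≉1 = proj₂ nontrivial
    y = proj₁ (inverse u≉0) *ₖ x₀
    shift : ∀ t → x₀ +ₖ u *ₖ element t ≈ₖ u *ₖ element (translation y Permutation.⟨$⟩ʳ t)
    shift t = K.sym (K.trans (K.*-congˡ (strictlyInverseˡ _)) (K.trans (K.distribˡ u y _) (K.+-congʳ
      (K.trans (K.sym (K.*-assoc _ _ _)) (K.trans
        (K.*-congʳ (K.trans (K.*-comm _ _) (proj₂ (inverse u≉0)))) (K.*-identityˡ x₀))))))

  tupleSum-ψ : ∀ p (u : Vector k p) (all? : Dec (∀ j → u j ≈ₖ 0ₖ)) →
    ℂᵀ.tupleSum p (λ c → ψ (KΣ.sum (λ j → u j *ₖ c j))) ≈ᶜ real (fromℕ q ^ p * ℝΣ.[ all? ])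
  tupleSum-ψ p u all? = begin
    ℂᵀ.tupleSum p (λ c → ψ (KΣ.sum (λ j → u j *ₖ c j)))
      ≈⟨ ℂΣ.sum-cong-≋ {q ℕ.^ p} (λ t → ψ-sum (λ j → u j *ₖ tuple t j)) ⟩
    ℂᵀ.tupleSum p (λ c → ℂΣ.prod (λ j → ψ (u j *ₖ c j)))
      ≈⟨ ℂᵀ.tupleSum-prod p (λ j x → ψ (u j *ₖ x)) (λ j x≈y → ψ.⟦⟧-cong (K.*-congˡ x≈y)) ⟩
    ℂΣ.prod (λ j → ℂΣ.sum (λ t → ψ (u j *ₖ element t)))
      ≈⟨ evaluate all? ⟩
    real (fromℕ q ^ p * ℝΣ.[ all? ]) ∎
    where
    prod-q : ∀ n → ℂΣ.prod {n} (λ _ → real (fromℕ q)) ≈ᶜ real (fromℕ q ^ n)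
    prod-q zero = ℂ′.refl
    prod-q (suc n) = ℂ′.trans (ℂ′.*-congˡ {real (fromℕ q)} (prod-q n)) (ℂ′.sym (real-* _ _))

    evaluate : (d : Dec (∀ j → u j ≈ₖ 0ₖ)) →
      ℂΣ.prod (λ j → ℂΣ.sum (λ t → ψ (u j *ₖ element t))) ≈ᶜ real (fromℕ q ^ p * ℝΣ.[ d ])
    evaluate (yes u≈0) = ℂ′.trans (ℂΣ.prod-cong (λ j → sum-ψ-≈0 (u≈0 j)))
      (ℂ′.trans (prod-q p) (real-cong (sym (*-identityʳ _))))
    evaluate (no u≉0) with Fin.¬∀⟶∃¬ p _ (λ j → u j ≟ 0ₖ) u≉0
    ... | j , uj≉0 = ℂ′.trans (ℂΣ.prod-zero _ j (sum-ψ-≉0 uj≉0)) (real-cong (sym (zeroʳ _)))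

  fourier≈ : ∀ μ a → fourier ψ μ a ≈ᶜ ℂΣ.sum (λ t → real (μ (element t)) *ᶜ ψ (a *ₖ element t))
  fourier≈ μ a = ℂ′.trans (∑ᶜ≈sum {q} _) (ℂΣ.sum-cong-≋ {q} λ t → ·ᶜ≈*ᶜ _ _)

  fourier-cong : ∀ μ {a b} → a ≈ₖ b → fourier ψ μ a ≈ᶜ fourier ψ μ b
  fourier-cong μ {a} {b} a≈b = ℂ′.trans (fourier≈ μ a) (ℂ′.trans
    (ℂΣ.sum-cong-≋ {q} λ t → ℂ′.*-congˡ {real (μ (element t))} (ψ.⟦⟧-cong (K.*-congʳ a≈b)))
    (ℂ′.sym (fourier≈ μ _)))

  fourier-0 : ∀ μ {a} → a ≈ₖ 0ₖ → fourier ψ μ a ≈ᶜ real (ℝΣ.sum (λ t → μ (element t)))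
  fourier-0 μ {a} a≈0 = begin
    fourier ψ μ a
      ≈⟨ fourier≈ μ a ⟩
    ℂΣ.sum (λ t → real (μ (element t)) *ᶜ ψ (a *ₖ element t))
      ≈⟨ ℂΣ.sum-cong-≋ {q} (λ t → ℂ′.trans (ℂ′.*-congˡ {real (μ (element t))}
           (ℂ′.trans (ψ.⟦⟧-cong (K.trans (K.*-congʳ a≈0) (K.zeroˡ _))) ψ-0)) (ℂ′.*-identityʳ _)) ⟩
    ℂΣ.sum (λ t → real (μ (element t)))
      ≈⟨ real-sum (λ t → μ (element t)) ⟨
    real (ℝΣ.sum (λ t → μ (element t))) ∎

  fourier-constant : ∀ {a} → ¬ (a ≈ₖ 0ₖ) → fourier ψ (λ _ → 1#) a ≈ᶜ 0ᶜ
  fourier-constant {a} a≉0 = ℂ′.trans (fourier≈ _ a)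
    (ℂ′.trans (ℂΣ.sum-cong-≋ {q} λ t → ℂ′.*-identityˡ _) (sum-ψ-≉0 a≉0))

  -- Poisson summation for the code {x ∣ u x = 0}, whose dual is the image of y.
  poisson : ∀ N p (μ : k → Carrier) → (∀ {x y} → x ≈ₖ y → μ x ≈ μ y) →
    (u : Vector k N → Vector k p) (y : Vector k p → Vector k N) →
    (∀ x c → KΣ.sum (λ j → u x j *ₖ c j) ≈ₖ KΣ.sum (λ l → y c l *ₖ x l)) →
    (u? : ∀ x → Dec (∀ j → u x j ≈ₖ 0ₖ)) →
    real (fromℕ q ^ p * ℝᵀ.tupleSum N (λ x → ℝΣ.prod (μ ∘ x) * ℝΣ.[ u? x ])) ≈ᶜ
    ℂᵀ.tupleSum p (λ c → ℂΣ.prod (λ l → fourier ψ μ (y c l)))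
  poisson N p μ μ-cong u y adjoint u? = begin
    real (fromℕ q ^ p * ℝᵀ.tupleSum N (λ x → w x * ℝΣ.[ u? x ]))
      ≈⟨ real-cong (ℝΣ.*-distribˡ-sum {q ℕ.^ N} _ _) ⟩
    real (ℝᵀ.tupleSum N (λ x → fromℕ q ^ p * (w x * ℝΣ.[ u? x ])))
      ≈⟨ real-sum {q ℕ.^ N} _ ⟩
    ℂᵀ.tupleSum N (λ x → real (fromℕ q ^ p * (w x * ℝΣ.[ u? x ])))
      ≈⟨ ℂΣ.sum-cong-≋ {q ℕ.^ N} (λ t → expand (tuple t)) ⟩
    ℂᵀ.tupleSum N (λ x → ℂᵀ.tupleSum p (λ c → ℂΣ.prod (λ l → g c l (x l))))
      ≈⟨ ℂΣ.∑-comm {q ℕ.^ N} {q ℕ.^ p} _ ⟩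
    ℂᵀ.tupleSum p (λ c → ℂᵀ.tupleSum N (λ x → ℂΣ.prod (λ l → g c l (x l))))
      ≈⟨ ℂΣ.sum-cong-≋ {q ℕ.^ p} (λ t → ℂᵀ.tupleSum-prod N (g (tuple t)) (λ l x≈y →
           ℂ′.*-cong (real-cong (μ-cong x≈y)) (ψ.⟦⟧-cong (K.*-congˡ x≈y)))) ⟩
    ℂᵀ.tupleSum p (λ c → ℂΣ.prod (λ l → ℂΣ.sum (λ s → g c l (element s))))
      ≈⟨ ℂΣ.sum-cong-≋ {q ℕ.^ p} (λ t → ℂΣ.prod-cong λ l → fourier≈ μ (y (tuple t) l)) ⟨
    ℂᵀ.tupleSum p (λ c → ℂΣ.prod (λ l → fourier ψ μ (y c l))) ∎
    where
    w : Vector k N → Carrier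
    w x = ℝΣ.prod (μ ∘ x)
    g : Vector k p → Fin N → k → ℂ
    g c l x = real (μ x) *ᶜ ψ (y c l *ₖ x)

    expand : ∀ x → real (fromℕ q ^ p * (w x * ℝΣ.[ u? x ])) ≈ᶜ
                   ℂᵀ.tupleSum p (λ c → ℂΣ.prod (λ l → g c l (x l)))
    expand x = begin
      real (fromℕ q ^ p * (w x * ℝΣ.[ u? x ]))
        ≈⟨ real-cong (trans (sym (*-assoc _ _ _)) (trans (*-congʳ (*-comm _ _)) (*-assoc _ _ _))) ⟩
      real (w x * (fromℕ q ^ p * ℝΣ.[ u? x ]))
        ≈⟨ real-* (w x) _ ⟩
      real (w x) *ᶜ real (fromℕ q ^ p * ℝΣ.[ u? x ])
        ≈⟨ ℂ′.*-cong (real-prod (μ ∘ x)) (ℂ′.sym (tupleSum-ψ p (u x) (u? x))) ⟩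
      ℂΣ.prod (real ∘ μ ∘ x) *ᶜ ℂᵀ.tupleSum p (λ c → ψ (KΣ.sum (λ j → u x j *ₖ c j)))
        ≈⟨ ℂΣ.*-distribˡ-sum {q ℕ.^ p} _ _ ⟩
      ℂᵀ.tupleSum p (λ c → ℂΣ.prod (real ∘ μ ∘ x) *ᶜ ψ (KΣ.sum (λ j → u x j *ₖ c j)))
        ≈⟨ ℂΣ.sum-cong-≋ {q ℕ.^ p} (λ t → ℂ′.*-congˡ {ℂΣ.prod (real ∘ μ ∘ x)}
             (ℂ′.trans (ψ.⟦⟧-cong (adjoint x (tuple t))) (ψ-sum (λ l → y (tuple t) l *ₖ x l)))) ⟩
      ℂᵀ.tupleSum p (λ c → ℂΣ.prod (real ∘ μ ∘ x) *ᶜ ℂΣ.prod (λ l → ψ (y c l *ₖ x l)))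
        ≈⟨ ℂΣ.sum-cong-≋ {q ℕ.^ p} (λ t → ℂΣ.prod-distrib-* (real ∘ μ ∘ x) (λ l → ψ (y (tuple t) l *ₖ x l))) ⟨
      ℂᵀ.tupleSum p (λ c → ℂΣ.prod (λ l → g c l (x l))) ∎

-- Polynomials

-- Polynomials are treated as finitely supported power series.
module Series {c ℓ} (R : CommutativeRing c ℓ) where
  open CommutativeRing R hiding (zero)
  open IntegerCoefficients R using (solve; _:=_; _:+_; _:*_; _:-_; :-_; con)
  open SetoidReasoning setoid

  Series : Set c
  Series = ℕ → Carrier

  infix 4 _≈ˢ_
  _≈ˢ_ : Series → Series → Set ℓ
  f ≈ˢ g = ∀ i → f i ≈ g i

  infixl 7 _⋆_
  _⋆_ : Series → Series → Series
  (f ⋆ g) zero    = f 0 * g 0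
  (f ⋆ g) (suc l) = f 0 * g (suc l) + ((f ∘ suc) ⋆ g) l

  constant : Carrier → Series
  constant x zero    = x
  constant x (suc _) = 0#

  ⋆-cong : ∀ {f f′ g g′} → f ≈ˢ f′ → g ≈ˢ g′ → f ⋆ g ≈ˢ f′ ⋆ g′
  ⋆-cong f≈ g≈ zero    = *-cong (f≈ 0) (g≈ 0)
  ⋆-cong f≈ g≈ (suc l) = +-cong (*-cong (f≈ 0) (g≈ (suc l))) (⋆-cong (f≈ ∘ suc) g≈ l)

  ⋆-zeroˡ : ∀ {f} g → (∀ i → f i ≈ 0#) → ∀ l → (f ⋆ g) l ≈ 0#
  ⋆-zeroˡ g f≈0 zero    = trans (*-congʳ (f≈0 0)) (zeroˡ _)
  ⋆-zeroˡ g f≈0 (suc l) = trans (+-cong (trans (*-congʳ (f≈0 0)) (zeroˡ _)) (⋆-zeroˡ g (f≈0 ∘ suc) l))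
                                (+-identityˡ 0#)

  ⋆-constantˡ : ∀ {f} g → (∀ i → f (suc i) ≈ 0#) → ∀ l → (f ⋆ g) l ≈ f 0 * g l
  ⋆-constantˡ g f≈0 zero    = refl
  ⋆-constantˡ g f≈0 (suc l) = trans (+-congˡ (⋆-zeroˡ g f≈0 l)) (+-identityʳ _)

  ⋆-distribʳ : ∀ h f g l → ((λ i → f i + g i) ⋆ h) l ≈ (f ⋆ h) l + (g ⋆ h) l
  ⋆-distribʳ h f g zero    = distribʳ _ _ _
  ⋆-distribʳ h f g (suc l) = trans (+-congˡ (⋆-distribʳ h (f ∘ suc) (g ∘ suc) l))
    (solve 5 (λ a b c x y → (a :+ b) :* c :+ (x :+ y) := (a :* c :+ x) :+ (b :* c :+ y)) refl
      (f 0) (g 0) (h (suc l)) (((f ∘ suc) ⋆ h) l) (((g ∘ suc) ⋆ h) l))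

  ⋆-scaleˡ : ∀ x f g l → ((λ i → x * f i) ⋆ g) l ≈ x * (f ⋆ g) l
  ⋆-scaleˡ x f g zero    = *-assoc _ _ _
  ⋆-scaleˡ x f g (suc l) = trans (+-congˡ (⋆-scaleˡ x (f ∘ suc) g l))
    (solve 4 (λ x a b y → x :* a :* b :+ x :* y := x :* (a :* b :+ y)) refl
      x (f 0) (g (suc l)) (((f ∘ suc) ⋆ g) l))

  ⋆-suc′ : ∀ f g l → (f ⋆ g) (suc l) ≈ g 0 * f (suc l) + (f ⋆ (g ∘ suc)) l
  ⋆-suc′ f g zero    = solve 4 (λ a b c d → a :* b :+ c :* d := d :* c :+ a :* b) refl
    (f 0) (g 1) (f 1) (g 0)
  ⋆-suc′ f g (suc l) = trans (+-congˡ (⋆-suc′ (f ∘ suc) g l))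
    (solve 3 (λ a b c → a :+ (b :+ c) := b :+ (a :+ c)) refl
      (f 0 * g (suc (suc l))) (g 0 * f (suc (suc l))) (((f ∘ suc) ⋆ (g ∘ suc)) l))

  ⋆-comm : ∀ f g l → (f ⋆ g) l ≈ (g ⋆ f) l
  ⋆-comm f g zero    = *-comm _ _
  ⋆-comm f g (suc l) = trans (⋆-suc′ f g l) (+-congˡ (⋆-comm f (g ∘ suc) l))

  ⋆-assoc : ∀ f g h l → ((f ⋆ g) ⋆ h) l ≈ (f ⋆ (g ⋆ h)) l
  ⋆-assoc f g h zero    = *-assoc _ _ _
  ⋆-assoc f g h (suc l) = begin
    f 0 * g 0 * h (suc l) + ((λ i → f 0 * g (suc i) + (f′ ⋆ g) i) ⋆ h) l
      ≈⟨ +-congˡ (⋆-distribʳ h (λ i → f 0 * g (suc i)) (f′ ⋆ g) l) ⟩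
    f 0 * g 0 * h (suc l) + (((λ i → f 0 * g (suc i)) ⋆ h) l + ((f′ ⋆ g) ⋆ h) l)
      ≈⟨ +-congˡ (+-cong (⋆-scaleˡ (f 0) (g ∘ suc) h l) (⋆-assoc f′ g h l)) ⟩
    f 0 * g 0 * h (suc l) + (f 0 * ((g ∘ suc) ⋆ h) l + (f′ ⋆ (g ⋆ h)) l)
      ≈⟨ solve 5 (λ a b c x y → a :* b :* c :+ (a :* x :+ y) := a :* (b :* c :+ x) :+ y) refl
           (f 0) (g 0) (h (suc l)) (((g ∘ suc) ⋆ h) l) ((f′ ⋆ (g ⋆ h)) l) ⟩
    f 0 * (g ⋆ h) (suc l) + (f′ ⋆ (g ⋆ h)) l ∎
    where f′ = f ∘ suc

  Below : ℕ → Series → Set ℓ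
  Below n f = ∀ i → n ℕ.≤ i → f i ≈ 0#

  Below-⋆ : ∀ m {n f g} → Below (suc m) f → Below n g → Below (m ℕ.+ n) (f ⋆ g)
  Below-⋆ zero    {g = g} f< g< l n≤l = trans (⋆-constantˡ g (λ i → f< (suc i) (s≤s z≤n)) l)
    (trans (*-congˡ (g< l n≤l)) (zeroʳ _))
  Below-⋆ (suc m) f< g< (suc l) (s≤s m+n≤l) = trans (+-cong
    (trans (*-congˡ (g< (suc l) (ℕ.m≤n⇒m≤1+n (ℕ.≤-trans (ℕ.m≤n+m _ m) m+n≤l)))) (zeroʳ _))
    (Below-⋆ m (λ i m<i → f< (suc i) (s≤s m<i)) g< l m+n≤l)) (+-identityˡ 0#)

  ⋆-top : ∀ m {n f g} → Below (suc m) f → Below (suc n) g → (f ⋆ g) (m ℕ.+ n) ≈ f m * g n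
  ⋆-top zero    {g = g} f< g< = ⋆-constantˡ g (λ i → f< (suc i) (s≤s z≤n)) _
  ⋆-top (suc m) f< g< = trans (+-cong
    (trans (*-congˡ (g< _ (s≤s (ℕ.m≤n+m _ m)))) (zeroʳ _))
    (⋆-top m (λ i m<i → f< (suc i) (s≤s m<i)) g<)) (+-identityˡ _)

  Polynomial : Set _
  Polynomial = ∃[ f ] ∃[ n ] Below (suc n) f

  coefficients : Polynomial → Series
  coefficients = proj₁

  polynomialRing : CommutativeRing _ _
  polynomialRing = record
    { Carrier = Polynomial
    ; _≈_ = λ f g → coefficients f ≈ˢ coefficients g
    ; _+_ = λ (f , m , f<) (g , n , g<) → (λ i → f i + g i) , m ℕ.+ n , λ i m+n<i →
        trans (+-cong (f< i (ℕ.≤-trans (s≤s (ℕ.m≤m+n m n)) m+n<i))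
                      (g< i (ℕ.≤-trans (s≤s (ℕ.m≤n+m n m)) m+n<i))) (+-identityˡ 0#)
    ; _*_ = λ (f , m , f<) (g , n , g<) → f ⋆ g , m ℕ.+ n , λ i m+n<i →
        Below-⋆ m f< g< i (ℕ.≤-trans (ℕ.≤-reflexive (ℕ.+-suc m n)) m+n<i)
    ; -_ = λ (f , n , f<) → (λ i → - f i) , n , λ i n<i → trans (-‿cong (f< i n<i))
        (solve 0 (:- con (+ 0) := con (+ 0)) refl)
    ; 0# = (λ _ → 0#) , 0 , λ _ _ → refl
    ; 1# = constant 1# , 0 , λ { (suc _) _ → refl }
    ; isCommutativeRing = record
      { isRing = record
        { +-isAbelianGroup = record
          { isGroup = record
            { isMonoid = record
              { isSemigroup = record
                { isMagma = record
                  { isEquivalence = record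
                    { refl  = λ i → refl
                    ; sym   = λ p i → sym (p i)
                    ; trans = λ p q i → trans (p i) (q i)
                    }
                  ; ∙-cong = λ p q i → +-cong (p i) (q i)
                  }
                ; assoc = λ f g h i → +-assoc _ _ _
                }
              ; identity = (λ f i → +-identityˡ _) , (λ f i → +-identityʳ _)
              }
            ; inverse = (λ f i → -‿inverseˡ _) , (λ f i → -‿inverseʳ _)
            ; ⁻¹-cong = λ p i → -‿cong (p i)
            }
          ; comm = λ f g i → +-comm _ _
          }
        ; *-cong = λ p q → ⋆-cong p q
        ; *-assoc = λ (f , _) (g , _) (h , _) → ⋆-assoc f g h
        ; *-identity = (λ (f , _) → 1⋆ f) , λ (f , _) l → trans (⋆-comm f (constant 1#) l) (1⋆ f l)
        ; distrib = (λ (f , _) (g , _) (h , _) l → trans (⋆-comm f _ l)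
                      (trans (⋆-distribʳ f g h l) (+-cong (⋆-comm g f l) (⋆-comm h f l)))) ,
                    (λ (f , _) (g , _) (h , _) → ⋆-distribʳ f g h)
        }
      ; *-comm = λ (f , _) (g , _) → ⋆-comm f g
      }
    }
    where
    1⋆ : ∀ f l → (constant 1# ⋆ f) l ≈ f l
    1⋆ f l = trans (⋆-constantˡ f (λ _ → refl) l) (*-identityˡ _)

  Deg : ℕ → Polynomial → Set ℓ
  Deg d (f , _) = ¬ (f d ≈ 0#) × Below (suc d) f

module PolynomialDegree {c ℓ} (R : CommutativeRing c ℓ)
  (_≟_ : Decidable (CommutativeRing._≈_ R))
  (inverse : ∀ {x} → ¬ (CommutativeRing._≈_ R x (CommutativeRing.0# R)) →
             ∃[ y ] CommutativeRing._≈_ R (CommutativeRing._*_ R y x) (CommutativeRing.1# R)) where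
  open CommutativeRing R hiding (zero)
  open IntegerCoefficients R using (solve; _:=_; _:+_; _:*_; _:-_; :-_; con)
  open Series R
  private module P = CommutativeRing polynomialRing

  degree : ∀ f → f P.≈ P.0# ⊎ (∃[ d ] Deg d f)
  degree (f , n , f<) = search (suc n) f<
    where
    search : ∀ n → Below n f → (∀ i → f i ≈ 0#) ⊎ (∃[ d ] (¬ (f d ≈ 0#) × Below (suc d) f))
    search zero    f< = inj₁ λ i → f< i z≤n
    search (suc n) f< with f n ≟ 0#
    ... | no fn≉0 = inj₂ (n , fn≉0 , f<)
    ... | yes fn≈0 = search n below
      where
      below : Below n f
      below i n≤i with n ℕ.≟ i
      ... | yes ≡.refl = fn≈0
      ... | no n≢i = f< i (ℕ.≤∧≢⇒< n≤i n≢i)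

  Deg-cong : ∀ {d f g} → f P.≈ g → Deg d f → Deg d g
  Deg-cong f≈g (fd≉0 , f<) = (λ gd≈0 → fd≉0 (trans (f≈g _) gd≈0)) , λ i d<i → trans (sym (f≈g i)) (f< i d<i)

  Deg⇒≉0 : ∀ {d f} → Deg d f → ¬ (f P.≈ P.0#)
  Deg⇒≉0 (fd≉0 , _) f≈0 = fd≉0 (f≈0 _)

  Below⇒< : ∀ {d n f} → Deg d f → Below n (coefficients f) → d ℕ.< n
  Below⇒< {d} {n} (fd≉0 , _) f< with n ℕ.≤? d
  ... | yes n≤d = contradiction (f< d n≤d) fd≉0
  ... | no  n≰d = ℕ.≰⇒> n≰d

  Deg-unique : ∀ {d e f} → Deg d f → Deg e f → d ≡ e
  Deg-unique {f = f} D E = ℕ.≤-antisym (ℕ.≤-pred (Below⇒< {f = f} D (proj₂ E)))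
                                       (ℕ.≤-pred (Below⇒< {f = f} E (proj₂ D)))

  x*y≈0⇒y≈0 : ∀ {x y} → ¬ (x ≈ 0#) → x * y ≈ 0# → y ≈ 0#
  x*y≈0⇒y≈0 {x} {y} x≉0 xy≈0 with inverse x≉0
  ... | z , zx≈1 = trans (sym (*-identityˡ y)) (trans (*-congʳ (sym zx≈1))
    (trans (*-assoc z x y) (trans (*-congˡ xy≈0) (zeroʳ z))))

  Deg-* : ∀ {d e f g} → Deg d f → Deg e g → Deg (d ℕ.+ e) (f P.* g)
  Deg-* {d} {e} {f} {g} (fd≉0 , f<) (ge≉0 , g<) =
    (λ top≈0 → ge≉0 (x*y≈0⇒y≈0 fd≉0 (trans (sym (⋆-top d f< g<)) top≈0))) ,
    λ i d+e<i → Below-⋆ d f< g< i (ℕ.≤-trans (ℕ.≤-reflexive (ℕ.+-suc d e)) d+e<i)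

  Deg0⇒unit : ∀ {f} → Deg 0 f → ∃[ g ] g P.* f P.≈ P.1#
  Deg0⇒unit {f , _} (f0≉0 , f<) with inverse f0≉0
  ... | y , yf0≈1 = (constant y , 0 , λ { (suc _) _ → refl }) , λ
    { zero    → yf0≈1
    ; (suc l) → trans (⋆-constantˡ {constant y} f (λ _ → refl) (suc l)) (trans (*-congˡ (f< (suc l) (s≤s z≤n))) (zeroʳ y)) }

  Below⇒degree : ∀ {d} f → Below d (coefficients f) → f P.≈ P.0# ⊎ (∃[ e ] e ℕ.< d × Deg e f)
  Below⇒degree f f< with degree f
  ... | inj₁ f≈0 = inj₁ f≈0
  ... | inj₂ (e , D) = inj₂ (e , Below⇒< {f = f} D f< , D)

  divide : ∀ {d b} → Deg d b → ∀ f →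
    ∃₂ λ s r → f P.≈ s P.* b P.+ r × (r P.≈ P.0# ⊎ (∃[ e ] e ℕ.< d × Deg e r))
  divide {d} {B@(b , _)} (bd≉0 , b<) (f , n , f<) = convert (long f (suc n) f<)
    where
    y = proj₁ (inverse bd≉0)
    ybd≈1 = proj₂ (inverse bd≉0)

    Quotient : Series → Set _
    Quotient f = ∃₂ λ s r → (∃[ m ] Below (suc m) s) × Below d r × (∀ i → f i ≈ (s ⋆ b) i + r i)

    long : ∀ f n → Below n f → Quotient f
    long f zero    f< = (λ _ → 0#) , (λ _ → 0#) , (0 , λ _ _ → refl) , (λ _ _ → refl) ,
      λ i → trans (f< i z≤n) (sym (trans (+-identityʳ _) (⋆-zeroˡ b (λ _ → refl) i)))
    long f (suc n) f< with long (f ∘ suc) n (λ i n≤i → f< (suc i) (s≤s n≤i))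
    ... | s , r , (m , s<) , r< , f′≈ = s′ , r′ , (suc m , s′<) , r′< , f≈
      where
      shifted : Series
      shifted zero    = f 0
      shifted (suc i) = r i
      t = shifted d * y
      s′ : Series
      s′ zero    = t
      s′ (suc i) = s i
      r′ : Series
      r′ i = shifted i - t * b i
      s′< : Below (suc (suc m)) s′
      s′< (suc i) (s≤s m<i) = s< i m<i
      shifted< : ∀ i → d ℕ.< i → shifted i ≈ 0#
      shifted< (suc i) (s≤s d≤i) = r< i d≤i
      r′< : Below d r′
      r′< i d≤i with d ℕ.≟ i
      ... | yes ≡.refl = trans
        (+-congˡ (-‿cong (trans (*-assoc _ _ _) (trans (*-congˡ ybd≈1) (*-identityʳ _))))) (-‿inverseʳ _)
      ... | no d≢i = trans (+-cong (shifted< i d<i) (-‿cong (*-congˡ (b< i d<i))))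
          (solve 1 (λ t → con (+ 0) :- t :* con (+ 0) := con (+ 0)) refl t)
        where d<i = ℕ.≤∧≢⇒< d≤i d≢i
      f≈ : ∀ i → f i ≈ (s′ ⋆ b) i + r′ i
      f≈ zero = solve 3 (λ t b f → f := t :* b :+ (f :- t :* b)) refl t (b 0) (f 0)
      f≈ (suc i) = trans (f′≈ i) (solve 4 (λ t b x r → x :+ r := (t :* b :+ x) :+ (r :- t :* b)) refl
        t (b (suc i)) ((s ⋆ b) i) (r i))

    convert : Quotient f → _
    convert (s , r , s< , r< , f≈) =
      (s , s<) , (r , d , r<′) , f≈ , Below⇒degree (r , d , r<′) r<
      where
      r<′ : Below (suc d) r
      r<′ i d<i = r< i (ℕ.<⇒≤ d<i)

-- The number of divisors of a polynomial

record EuclideanDegree {c ℓ} (P : CommutativeRing c ℓ) δ : Set (c ⊔ ℓ ⊔ lsuc δ) where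
  open CommutativeRing P
  field
    Deg        : ℕ → Carrier → Set δ
    degree     : ∀ f → f ≈ 0# ⊎ (∃[ d ] Deg d f)
    Deg-cong   : ∀ {d f g} → f ≈ g → Deg d f → Deg d g
    Deg⇒≉0     : ∀ {d f} → Deg d f → ¬ (f ≈ 0#)
    Deg-unique : ∀ {d e f} → Deg d f → Deg e f → d ≡ e
    Deg-*      : ∀ {d e f g} → Deg d f → Deg e g → Deg (d ℕ.+ e) (f * g)
    Deg0⇒unit  : ∀ {f} → Deg 0 f → ∃[ g ] g * f ≈ 1#
    divide     : ∀ {d g} → Deg d g → ∀ f →
                 ∃₂ λ s r → f ≈ s * g + r × (r ≈ 0# ⊎ (∃[ e ] e ℕ.< d × Deg e r))
    enumerate  : ∀ n → ∃[ fs ] ∀ {d f} → Deg d f → d ℕ.≤ n → Any (f ≈_) fs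

module DivisorBound {c ℓ δ} (P : CommutativeRing c ℓ) (euclidean : EuclideanDegree P δ) where
  open CommutativeRing P hiding (zero)
  open EuclideanDegree euclidean
  open IntegerCoefficients P using (solve; _:=_; _:+_; _:*_; _:-_; :-_; con)

  infix 4 _∣_
  _∣_ : Carrier → Carrier → Set _
  a ∣ f = ∃[ b ] b * a ≈ f

  ∣-trans : ∀ {a b f} → a ∣ b → b ∣ f → a ∣ f
  ∣-trans (s , sa≈b) (t , tb≈f) = t * s , trans (*-assoc _ _ _) (trans (*-congˡ sa≈b) tb≈f)

  ∣-respˡ : ∀ {a b f} → a ≈ b → a ∣ f → b ∣ f
  ∣-respˡ a≈b (s , sa≈f) = s , trans (*-congˡ (sym a≈b)) sa≈f

  ∣-respʳ : ∀ {a f g} → f ≈ g → a ∣ f → a ∣ g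
  ∣-respʳ f≈g (s , sa≈f) = s , trans sa≈f f≈g

  factor-degrees : ∀ {n f a b} → Deg n f → b * a ≈ f → ∃₂ λ d e → Deg d a × Deg e b × e ℕ.+ d ≡ n
  factor-degrees {n} {f} {a} {b} F ba≈f with degree a | degree b
  ... | inj₁ a≈0 | _ = contradiction (trans (sym ba≈f) (trans (*-congˡ a≈0) (zeroʳ b))) (Deg⇒≉0 F)
  ... | inj₂ _ | inj₁ b≈0 = contradiction (trans (sym ba≈f) (trans (*-congʳ b≈0) (zeroˡ a))) (Deg⇒≉0 F)
  ... | inj₂ (d , A) | inj₂ (e , B) = d , e , A , B , Deg-unique (Deg-cong ba≈f (Deg-* B A)) F

  *-cancelˡ : ∀ {d p f g} → Deg d p → p * f ≈ p * g → f ≈ g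
  *-cancelˡ {p = p} {f} {g} D pf≈pg with degree (f - g)
  ... | inj₁ f-g≈0 = trans (solve 2 (λ f g → f := (f :- g) :+ g) refl f g)
                           (trans (+-congʳ f-g≈0) (+-identityˡ g))
  ... | inj₂ (e , E) = contradiction
    (trans (solve 3 (λ p f g → p :* (f :- g) := p :* f :- p :* g) refl p f g)
           (trans (+-congʳ pf≈pg) (-‿inverseʳ _)))
    (Deg⇒≉0 (Deg-* D E))

  _∣?_ : ∀ a {n f} → Deg n f → Dec (a ∣ f)
  _∣?_ a {n} {f} F with Any.any? (λ b → b*a≟f b) (proj₁ (enumerate n))
    where
    b*a≟f : ∀ b → Dec (b * a ≈ f)
    b*a≟f b with degree (b * a - f)
    ... | inj₁ ≈0 = yes (trans (solve 2 (λ x y → x := (x :- y) :+ y) refl (b * a) f)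
                               (trans (+-congʳ ≈0) (+-identityˡ f)))
    ... | inj₂ (d , D) = no λ ba≈f → Deg⇒≉0 D (trans (+-congʳ ba≈f) (-‿inverseʳ f))
  ... | yes found = yes (Any.satisfied found)
  ... | no ¬found = no λ (b , ba≈f) →
    let d , e , _ , B , e+d≡n = factor-degrees F ba≈f in
    ¬found (Any.map (λ b≈b′ → trans (*-congʳ (sym b≈b′)) ba≈f)
      (proj₂ (enumerate n) B (ℕ.≤-trans (ℕ.m≤m+n e d) (ℕ.≤-reflexive e+d≡n))))

  bézout : ∀ n f g → (g ≈ 0# ⊎ (∃[ e ] e ℕ.< n × Deg e g)) →
           ∃[ h ] (∃₂ λ u v → h ≈ u * f + v * g) × h ∣ f × h ∣ g
  bézout n f g (inj₁ g≈0) = f ,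
    (1# , 0# , solve 2 (λ f g → f := con (+ 1) :* f :+ con (+ 0) :* g) refl f g) ,
    (1# , *-identityˡ f) , (0# , trans (zeroˡ f) (sym g≈0))
  bézout (suc n) f g (inj₂ (e , s≤s e≤n , G)) with divide G f
  ... | s , r , f≈sg+r , small with bézout n g r (bound small)
    where
    bound : (r ≈ 0# ⊎ (∃[ d ] d ℕ.< e × Deg d r)) → (r ≈ 0# ⊎ (∃[ d ] d ℕ.< n × Deg d r))
    bound (inj₁ r≈0) = inj₁ r≈0
    bound (inj₂ (d , d<e , D)) = inj₂ (d , ℕ.<-≤-trans d<e e≤n , D)
  ...   | h , (u , v , h≈ug+vr) , (a , ah≈g) , (b , bh≈r) = h ,
    (v , u - v * s , trans h≈ug+vr (trans (+-congˡ (*-congˡ r≈f-sg))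
      (solve 5 (λ u v g f s → u :* g :+ v :* (f :- s :* g) := v :* f :+ (u :- v :* s) :* g) refl u v g f s))) ,
    (s * a + b , trans (solve 4 (λ s a b h → (s :* a :+ b) :* h := s :* (a :* h) :+ b :* h) refl s a b h)
      (trans (+-cong (*-congˡ ah≈g) bh≈r) (sym f≈sg+r))) ,
    (a , ah≈g)
    where
    r≈f-sg : r ≈ f - s * g
    r≈f-sg = trans (solve 2 (λ x r → r := (x :+ r) :- x) refl (s * g) r) (+-congʳ (sym f≈sg+r))

  record Irreducible (d : ℕ) (p : Carrier) : Set (c ⊔ ℓ ⊔ δ) where
    field
      Deg-p    : Deg (suc d) p
      trivial  : ∀ {a e} → a ∣ p → Deg e a → e ≡ 0 ⊎ e ≡ suc d

  open Irreducible

  irreducible⇒prime : ∀ {d p a f} → Irreducible d p → ¬ (p ∣ a) → a ∣ p * f → a ∣ f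
  irreducible⇒prime {d} {p} {a} {f} irr p∤a (s , sa≈pf) with degree a
  ... | inj₁ a≈0 = contradiction (0# , trans (zeroˡ p) (sym a≈0)) p∤a
  ... | inj₂ (e , A) with bézout (suc e) p a (inj₂ (e , ℕ.≤-refl , A))
  ...   | h , (u , v , h≈up+va) , (t , th≈p) , h∣a with factor-degrees (Deg-p irr) th≈p
  ...     | dh , dt , H , T , dt+dh≡1+d with trivial irr (t , th≈p) H
  ...       | inj₁ ≡.refl = let w , wh≈1 = Deg0⇒unit H in
    w * (u * s + v * f) , trans
      (solve 6 (λ w u s v f a → w :* (u :* s :+ v :* f) :* a := w :* (u :* (s :* a) :+ v :* (a :* f)))
         refl w u s v f a)
      (trans (*-congˡ (+-congʳ (*-congˡ sa≈pf)))
      (trans (solve 6 (λ w u p v f a → w :* (u :* (p :* f) :+ v :* (a :* f)) :=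
                w :* (u :* p :+ v :* a) :* f) refl w u p v f a)
      (trans (*-congʳ (trans (*-congˡ (sym h≈up+va)) wh≈1)) (*-identityˡ f))))
  ...       | inj₂ ≡.refl = contradiction (∣-trans p∣h h∣a) p∤a
    where
    T0 : Deg 0 t
    T0 = ≡.subst (λ n → Deg n t) (ℕ.+-cancelʳ-≡ dh dt 0 dt+dh≡1+d) T
    p∣h : p ∣ h
    p∣h = let w , wt≈1 = Deg0⇒unit T0 in
      w , trans (*-congˡ (sym th≈p)) (trans (sym (*-assoc w t h)) (trans (*-congʳ wt≈1) (*-identityˡ h)))

  irreducible-or-divisor : ∀ {d p} → Deg (suc d) p →
    Irreducible d p ⊎ (∃₂ λ a e → a ∣ p × 0 ℕ.< e × e ℕ.< suc d × Deg e a)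
  irreducible-or-divisor {d} {p} D with Any.any? proper? (proj₁ (enumerate d))
    where
    Proper : Carrier → Set _
    Proper a = ∃[ e ] a ∣ p × 0 ℕ.< e × e ℕ.< suc d × Deg e a
    proper? : ∀ a → Dec (Proper a)
    proper? a with degree a | a ∣? D
    ... | inj₁ a≈0 | _ = no λ (e , _ , _ , _ , A) → Deg⇒≉0 A a≈0
    ... | inj₂ _ | no a∤p = no λ (_ , a∣p , _) → a∤p a∣p
    ... | inj₂ (e , A) | yes a∣p with 0 ℕ.<? e | e ℕ.<? suc d
    ...   | yes 0<e | yes e≤d = yes (e , a∣p , 0<e , e≤d , A)
    ...   | no ¬0<e | _ = no λ (e′ , _ , 0<e′ , _ , A′) → ¬0<e (≡.subst (0 ℕ.<_) (Deg-unique A′ A) 0<e′)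
    ...   | yes _ | no ¬e≤d = no λ (e′ , _ , _ , e′≤d , A′) →
      ¬e≤d (≡.subst (ℕ._< suc d) (Deg-unique A′ A) e′≤d)
  ... | yes found = let a , e , rest = Any.satisfied found in inj₂ (a , e , rest)
  ... | no ¬found = inj₁ record { Deg-p = D ; trivial = λ {a} {e} → triv a e }
    where
    triv : ∀ a e → a ∣ p → Deg e a → e ≡ 0 ⊎ e ≡ suc d
    triv a zero    a∣p@(b , ba≈p) A = inj₁ ≡.refl
    triv a (suc e) a∣p@(b , ba≈p) A with suc e ℕ.<? suc d
    ... | yes e<d = contradiction
      (Any.map (λ a≈a′ → suc e , ∣-respˡ a≈a′ a∣p , s≤s z≤n , e<d , Deg-cong a≈a′ A)
        (proj₂ (enumerate d) A (ℕ.≤-pred e<d))) ¬found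
    ... | no e≮d with factor-degrees D ba≈p
    ...   | d′ , e′ , A′ , B , e′+d′≡1+d = inj₂ (ℕ.≤-antisym
      (ℕ.≤-trans (ℕ.≤-reflexive (Deg-unique A A′)) (ℕ.≤-trans (ℕ.m≤n+m d′ e′) (ℕ.≤-reflexive e′+d′≡1+d)))
      (ℕ.≮⇒≥ e≮d))

  irreducible-divisor : ∀ {n f} → Deg (suc n) f → ∃₂ λ d p → Irreducible d p × p ∣ f
  irreducible-divisor {n} F = go n F (<-wellFounded n)
    where
    go : ∀ n {f} → Deg (suc n) f → Acc ℕ._<_ n → ∃₂ λ d p → Irreducible d p × p ∣ f
    go n {f} F (acc rec) with irreducible-or-divisor F
    ... | inj₁ irr = n , f , irr , (1# , *-identityˡ f)
    ... | inj₂ (a , suc e , a∣f , _ , s≤s e<n , A) with go e A (rec e<n)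
    ...   | d , p , irr , p∣a = d , p , irr , ∣-trans p∣a a∣f

  Covers : List Carrier → Carrier → Set _
  Covers as f = ∀ {a} → a ∣ f → Any (a ≈_) as

  any-map : ∀ {p a b as} → a ≈ p * b → Any (b ≈_) as → Any (a ≈_) (List.map (p *_) as)
  any-map a≈pb = Any.map⁺ ∘ Any.map (λ b≈b′ → trans a≈pb (*-congˡ b≈b′))

  covers-* : ∀ {d p f n as bs} → Irreducible d p → Deg n f →
    (∀ {a} → ¬ (p ∣ a) → a ∣ f → Any (a ≈_) as) → Covers bs f →
    Covers (as ++ List.map (p *_) bs) (p * f)
  covers-* {d} {p} {f} {n} {as} {bs} irr F as-covers bs-covers {a} a∣pf@(s , sa≈pf)
    with factor-degrees (Deg-* (Deg-p irr) F) sa≈pf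
  ... | _ , _ , A , _ with p ∣? A
  ...   | no p∤a = Any.++⁺ˡ (as-covers p∤a (irreducible⇒prime irr p∤a a∣pf))
  ...   | yes (b , bp≈a) = Any.++⁺ʳ as (any-map (trans (sym bp≈a) (*-comm b p)) (bs-covers
    (s , *-cancelˡ (Deg-p irr) (trans (solve 3 (λ p s b → p :* (s :* b) := s :* (b :* p)) refl p s b)
                                      (trans (*-congˡ bp≈a) sa≈pf)))))

  module _ (L : ℕ) .{{_ : ℕ.NonZero L}} where

    private
      units : List Carrier
      units = proj₁ (enumerate 0)

    record Bounded (M : ℕ) (n : ℕ) (f : Carrier) : Set (c ⊔ ℓ) where
      constructor bounded
      field
        divisors : List Carrier
        exponent : ℕ
        L*exponent≤n : L ℕ.* exponent ℕ.≤ n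
        length≤ : length divisors ℕ.≤ M ℕ.* 2 ℕ.^ exponent
        covers  : Covers divisors f

    Bounded-resp : ∀ {M n f g} → f ≈ g → Bounded M n f → Bounded M n g
    Bounded-resp f≈g (bounded as j Lj≤n len cov) = bounded as j Lj≤n len (cov ∘ ∣-respʳ (sym f≈g))

    Rough : Carrier → Set _
    Rough f = ∀ {d p} → Irreducible d p → p ∣ f → L ℕ.≤ suc d

    rough⇒bounded : ∀ {n f} → Deg n f → Rough f → Bounded (length units) n f
    rough⇒bounded {n} F rough = go n F rough (<-wellFounded n)
      where
      go : ∀ n {f} → Deg n f → Rough f → Acc ℕ._<_ n → Bounded (length units) n f
      go zero F rough _ = bounded units 0 (ℕ.≤-reflexive (ℕ.*-zeroʳ L))
        (ℕ.≤-reflexive (≡.sym (ℕ.*-identityʳ _)))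
        λ (b , ba≈f) → let d , e , A , B , e+d≡0 = factor-degrees F ba≈f in
          proj₂ (enumerate 0) A (ℕ.≤-trans (ℕ.m≤n+m d e) (ℕ.≤-reflexive e+d≡0))
      go (suc n) {f} F rough (acc rec) with irreducible-divisor F
      ... | d , p , irr , p∣f@(b , bp≈f) with factor-degrees F bp≈f
      ...   | d′ , e , D′ , B , e+d′≡1+n with Deg-unique D′ (Deg-p irr)
      ...     | ≡.refl with go e B (λ irr′ p′∣b → rough irr′ (∣-trans p′∣b (p , trans (*-comm p b) bp≈f)))
                          (rec (s≤s (ℕ.≤-trans (ℕ.m≤m+n e d) (ℕ.≤-reflexive
                            (ℕ.suc-injective (≡.trans (≡.sym (ℕ.+-suc e d)) e+d′≡1+n))))))
      ...       | bounded as j Lj≤e len cov = Bounded-resp (trans (*-comm p b) bp≈f) (bounded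
        (as ++ List.map (p *_) as) (suc j)
        (ℕ.≤-trans (ℕ.≤-reflexive (≡.trans (ℕ.*-suc L j) (ℕ.+-comm L _)))
          (ℕ.≤-trans (ℕ.+-mono-≤ Lj≤e (rough irr p∣f)) (ℕ.≤-reflexive e+d′≡1+n)))
        length≤ (covers-* irr B (λ _ → cov) cov))
        where
        open ℕ.≤-Reasoning
        U = length units
        length≤ : length (as ++ List.map (p *_) as) ℕ.≤ U ℕ.* (2 ℕ.* 2 ℕ.^ j)
        length≤ = begin
          length (as ++ List.map (p *_) as)         ≡⟨ List.length-++ as ⟩
          length as ℕ.+ length (List.map (p *_) as) ≡⟨ ≡.cong (length as ℕ.+_) (List.length-map _ as) ⟩
          length as ℕ.+ length as                   ≤⟨ ℕ.+-mono-≤ len len ⟩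
          U ℕ.* 2 ℕ.^ j ℕ.+ U ℕ.* 2 ℕ.^ j           ≡⟨ ℕ.*-distribˡ-+ U _ _ ⟨
          U ℕ.* (2 ℕ.^ j ℕ.+ 2 ℕ.^ j)               ≡⟨ ≡.cong (λ x → U ℕ.* (2 ℕ.^ j ℕ.+ x)) (ℕ.+-identityʳ _) ⟨
          U ℕ.* (2 ℕ.* 2 ℕ.^ j)                     ∎

    infixr 8 _^*_
    _^*_ : Carrier → ℕ → Carrier → Carrier
    (p ^* zero)  f = f
    (p ^* suc e) f = p * (p ^* e) f

    strip : ∀ {d p} → Irreducible d p → ∀ {n f} → Deg n f →
      ∃₂ λ e g → (p ^* e) g ≈ f × ¬ (p ∣ g) × (∃[ m ] Deg m g × m ℕ.+ e ℕ.≤ n)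
    strip {d} {p} irr {n} F = go n F (<-wellFounded n)
      where
      go : ∀ n {f} → Deg n f → Acc ℕ._<_ n →
        ∃₂ λ e g → (p ^* e) g ≈ f × ¬ (p ∣ g) × (∃[ m ] Deg m g × m ℕ.+ e ℕ.≤ n)
      go n {f} F (acc rec) with p ∣? F
      ... | no p∤f = 0 , f , refl , p∤f , n , F , ℕ.≤-reflexive (ℕ.+-identityʳ n)
      ... | yes (b , bp≈f) with factor-degrees F bp≈f
      ...   | d′ , i , D′ , B , i+d′≡n with Deg-unique D′ (Deg-p irr)
      ...     | ≡.refl with go i B (rec i<n)
        where
        i<n : i ℕ.< n
        i<n = ℕ.≤-trans (ℕ.≤-trans (s≤s (ℕ.m≤m+n i d)) (ℕ.≤-reflexive (≡.sym (ℕ.+-suc i d)))) (ℕ.≤-reflexive i+d′≡n)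
      ...       | e , g , pᵉg≈b , p∤g , m , G , m+e≤i = suc e , g ,
        trans (*-congˡ pᵉg≈b) (trans (*-comm p b) bp≈f) , p∤g , m , G ,
        ℕ.≤-trans (ℕ.≤-reflexive (ℕ.+-suc m e)) (ℕ.≤-trans (s≤s m+e≤i)
          (ℕ.≤-trans (ℕ.≤-trans (s≤s (ℕ.m≤m+n i d)) (ℕ.≤-reflexive (≡.sym (ℕ.+-suc i d)))) (ℕ.≤-reflexive i+d′≡n)))

    Deg-^* : ∀ {d p m g} → Irreducible d p → Deg m g → ∀ e → ∃[ n ] Deg n ((p ^* e) g)
    Deg-^* {m = m} irr G zero = m , G
    Deg-^* irr G (suc e) = _ , Deg-* (Deg-p irr) (proj₂ (Deg-^* irr G e))

    ∣-^* : ∀ {d p a g} → Irreducible d p → ¬ (p ∣ a) → ∀ e → a ∣ (p ^* e) g → a ∣ g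
    ∣-^* irr p∤a zero    a∣g   = a∣g
    ∣-^* irr p∤a (suc e) a∣pᵉg = ∣-^* irr p∤a e (irreducible⇒prime irr p∤a a∣pᵉg)

    powers : Carrier → ℕ → List Carrier → List Carrier
    powers p zero    as = as
    powers p (suc e) as = as ++ List.map (p *_) (powers p e as)

    length-powers : ∀ p e as → length (powers p e as) ≡ suc e ℕ.* length as
    length-powers p zero    as = ≡.sym (ℕ.+-identityʳ _)
    length-powers p (suc e) as = ≡.trans (List.length-++ as) (≡.cong (length as ℕ.+_)
      (≡.trans (List.length-map _ (powers p e as)) (length-powers p e as)))

    covers-powers : ∀ {d p m g as} → Irreducible d p → Deg m g → Covers as g →
                    ∀ e → Covers (powers p e as) ((p ^* e) g)
    covers-powers irr G cov zero    = cov
    covers-powers irr G cov (suc e) = covers-* irr (proj₂ (Deg-^* irr G e))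
      (λ p∤a a∣pᵉg → cov (∣-^* irr p∤a e a∣pᵉg)) (covers-powers irr G cov e)

    n<2^n : ∀ n → n ℕ.< 2 ℕ.^ n
    n<2^n zero    = s≤s z≤n
    n<2^n (suc n) = ℕ.≤-trans (s≤s (n<2^n n))
      (ℕ.≤-trans (ℕ.+-monoˡ-≤ (2 ℕ.^ n) (ℕ.≤-trans (s≤s z≤n) (n<2^n n)))
        (ℕ.≤-reflexive (≡.cong (2 ℕ.^ n ℕ.+_) (≡.sym (ℕ.+-identityʳ _)))))

    1+e≤L*2^[e/L] : ∀ e → suc e ℕ.≤ L ℕ.* 2 ℕ.^ (e ℕ./ L)
    1+e≤L*2^[e/L] e = begin
      suc e                            ≡⟨ ≡.cong suc (ℕ.m≡m%n+[m/n]*n e L) ⟩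
      suc (e ℕ.% L) ℕ.+ e ℕ./ L ℕ.* L  ≤⟨ ℕ.+-monoˡ-≤ _ (ℕ.m%n<n e L) ⟩
      suc (e ℕ./ L) ℕ.* L              ≤⟨ ℕ.*-monoˡ-≤ L (n<2^n (e ℕ./ L)) ⟩
      2 ℕ.^ (e ℕ./ L) ℕ.* L            ≡⟨ ℕ.*-comm _ L ⟩
      L ℕ.* 2 ℕ.^ (e ℕ./ L)            ∎
      where open ℕ.≤-Reasoning

    -- e + 1 ≤ L 2^(e / L) is what keeps powers of small irreducibles cheap.
    bounded-^* : ∀ {M d p m g e n} → Irreducible d p → Deg m g → m ℕ.+ e ℕ.≤ n →
                 Bounded M m g → Bounded (M ℕ.* L) n ((p ^* e) g)
    bounded-^* {M} {p = p} {m} {e = e} {n} irr G m+e≤n (bounded as j Lj≤m len cov) =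
      bounded (powers p e as) (j ℕ.+ e ℕ./ L) L[j+e/L]≤n length≤ (covers-powers irr G cov e)
      where
      open ℕ.≤-Reasoning
      L[j+e/L]≤n : L ℕ.* (j ℕ.+ e ℕ./ L) ℕ.≤ n
      L[j+e/L]≤n = begin
        L ℕ.* (j ℕ.+ e ℕ./ L)         ≡⟨ ℕ.*-distribˡ-+ L j _ ⟩
        L ℕ.* j ℕ.+ L ℕ.* (e ℕ./ L)   ≤⟨ ℕ.+-mono-≤ Lj≤m (ℕ.≤-trans (ℕ.≤-reflexive (ℕ.*-comm L _)) (ℕ.m/n*n≤m e L)) ⟩
        m ℕ.+ e                       ≤⟨ m+e≤n ⟩
        n                             ∎
      length≤ : length (powers p e as) ℕ.≤ M ℕ.* L ℕ.* 2 ℕ.^ (j ℕ.+ e ℕ./ L)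
      length≤ = begin
        length (powers p e as)                             ≡⟨ length-powers p e as ⟩
        suc e ℕ.* length as                                ≤⟨ ℕ.*-mono-≤ (1+e≤L*2^[e/L] e) len ⟩
        L ℕ.* 2 ℕ.^ (e ℕ./ L) ℕ.* (M ℕ.* 2 ℕ.^ j)          ≡⟨ rearrange L (2 ℕ.^ (e ℕ./ L)) M (2 ℕ.^ j) ⟩
        M ℕ.* L ℕ.* (2 ℕ.^ j ℕ.* 2 ℕ.^ (e ℕ./ L))          ≡⟨ ≡.cong (M ℕ.* L ℕ.*_) (ℕ.^-distribˡ-+-* 2 j _) ⟨
        M ℕ.* L ℕ.* 2 ℕ.^ (j ℕ.+ e ℕ./ L)                  ∎
        where
        open +-*-Solver using () renaming (solve to solveℕ; _:=_ to _:=ℕ_; _:*_ to _:*ℕ_)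
        rearrange : ∀ a b c d → a ℕ.* b ℕ.* (c ℕ.* d) ≡ c ℕ.* a ℕ.* (d ℕ.* b)
        rearrange = solveℕ 4 (λ a b c d → a :*ℕ b :*ℕ (c :*ℕ d) :=ℕ c :*ℕ a :*ℕ (d :*ℕ b)) ≡.refl

    relax : ∀ {M n f} → Bounded M n f → Bounded (M ℕ.* L) n f
    relax {M} (bounded as j Lj≤n len cov) = bounded as j Lj≤n
      (ℕ.≤-trans len (ℕ.*-monoˡ-≤ (2 ℕ.^ j) (ℕ.m≤m*n M L))) cov

    RoughOutside : List Carrier → Carrier → Set _
    RoughOutside ps f = ∀ {d p} → Irreducible d p → p ∣ f → L ℕ.≤ suc d ⊎ Any (p ≈_) ps

    roughOutside⇒bounded : ∀ ps {n f} → Deg n f → RoughOutside ps f →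
      Bounded (List.foldr (λ _ M → M ℕ.* L) (length units) ps) n f
    roughOutside⇒bounded [] F rough = rough⇒bounded F λ irr p∣f →
      case rough irr p∣f of λ { (inj₁ L≤) → L≤ }
    roughOutside⇒bounded (p ∷ ps) {n} {f} F rough = split (degree p)
      where
      drop : (∀ {d p′} → Irreducible d p′ → ¬ (p′ ≈ p)) → Bounded _ n f
      drop reducible = relax (roughOutside⇒bounded ps F λ irr p′∣f → skip irr (rough irr p′∣f))
        where
        skip : ∀ {d p′} → Irreducible d p′ → L ℕ.≤ suc d ⊎ Any (p′ ≈_) (p ∷ ps) →
               L ℕ.≤ suc d ⊎ Any (p′ ≈_) ps
        skip irr (inj₁ L≤)          = inj₁ L≤
        skip irr (inj₂ (here p′≈p)) = contradiction p′≈p (reducible irr)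
        skip irr (inj₂ (there p′∈)) = inj₂ p′∈

      split : p ≈ 0# ⊎ (∃[ d ] Deg d p) → Bounded _ n f
      split (inj₁ p≈0) = drop λ irr p′≈p → Deg⇒≉0 (Deg-p irr) (trans p′≈p p≈0)
      split (inj₂ (zero , D)) = drop λ irr p′≈p →
        case Deg-unique (Deg-cong p′≈p (Deg-p irr)) D of λ ()
      split (inj₂ (suc d , D)) with irreducible-or-divisor D
      ... | inj₂ (a , e , a∣p , 0<e , e<1+d , A) = drop λ {d′} irr p′≈p →
        case trivial irr (∣-respʳ (sym p′≈p) a∣p) A of λ
          { (inj₁ ≡.refl) → contradiction 0<e λ ()
          ; (inj₂ ≡.refl) → contradiction
              (≡.subst (ℕ._< suc d) (Deg-unique (Deg-cong p′≈p (Deg-p irr)) D) e<1+d) (ℕ.<-irrefl ≡.refl) }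
      ... | inj₁ irr with strip irr F
      ...   | e , g , pᵉg≈f , p∤g , m , G , m+e≤n = Bounded-resp pᵉg≈f (bounded-^* irr G m+e≤n
        (roughOutside⇒bounded ps G λ irr′ p′∣g → skip irr′ p′∣g
          (rough irr′ (∣-trans p′∣g (∣-respʳ pᵉg≈f (∣pᵉ e))))))
        where
        ∣pᵉ : ∀ e → g ∣ (p ^* e) g
        ∣pᵉ zero    = 1# , *-identityˡ g
        ∣pᵉ (suc e) = ∣-trans (∣pᵉ e) (p , refl)
        skip : ∀ {d p′} → Irreducible d p′ → p′ ∣ g → L ℕ.≤ suc d ⊎ Any (p′ ≈_) (p ∷ ps) →
               L ℕ.≤ suc d ⊎ Any (p′ ≈_) ps
        skip irr′ p′∣g (inj₁ L≤)          = inj₁ L≤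
        skip irr′ p′∣g (inj₂ (here p′≈p)) = contradiction (∣-respˡ p′≈p p′∣g) p∤g
        skip irr′ p′∣g (inj₂ (there p′∈)) = inj₂ p′∈

    divisor-bound : ∃[ M ] ∀ {n f} → Deg n f → Bounded M n f
    divisor-bound = _ , λ F → roughOutside⇒bounded (proj₁ (enumerate L)) F λ {d} irr p∣f →
      case L ℕ.≤? suc d of λ
        { (yes L≤) → inj₁ L≤
        ; (no L≰)  → inj₂ (proj₂ (enumerate L) (Deg-p irr) (ℕ.<⇒≤ (ℕ.≰⇒> L≰))) }

-- Relations satisfied by a sequence

module Annihilators {c ℓ₁ ℓ₂} (K : HeytingField c ℓ₁ ℓ₂) {q : ℕ} (enumeration : HasSize K q) where
  open HeytingField K hiding (zero) renaming (Carrier to k)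
  open FiniteField K enumeration using (tuple; code; tuple-code; _≟_)
  open FiniteFieldProperties K enumeration
  K-ring : CommutativeRing c ℓ₁
  K-ring = HeytingCommutativeRing.commutativeRing heytingCommutativeRing
  module KΣ = FiniteSums +-*-commutativeSemiring
  open Series K-ring public
  open PolynomialDegree K-ring _≟_ inverse public
  open SetoidReasoning setoid

  Zero : ∀ {n} → Vector k n → Set ℓ₁
  Zero x = ∀ i → x i ≈ 0#

  zero? : ∀ {n} (x : Vector k n) → Dec (Zero x)
  zero? x = Fin.all? λ i → x i ≟ 0#

  extend : ∀ {n} → Vector k n → Series
  extend {zero}  x _       = 0#
  extend {suc n} x zero    = x zero
  extend {suc n} x (suc i) = extend (tail x) i

  extend-cong : ∀ {n} {x y : Vector k n} → (∀ i → x i ≈ y i) → extend x ≈ˢ extend y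
  extend-cong {zero}  x≈y i       = refl
  extend-cong {suc n} x≈y zero    = x≈y zero
  extend-cong {suc n} x≈y (suc i) = extend-cong (x≈y ∘ suc) i

  extend-toℕ : ∀ {n} (x : Vector k n) i → extend x (toℕ i) ≡ x i
  extend-toℕ x zero    = ≡.refl
  extend-toℕ x (suc i) = extend-toℕ (tail x) i

  Below-extend : ∀ {n} (x : Vector k n) → Below n (extend x)
  Below-extend {zero}  x i       _         = refl
  Below-extend {suc n} x (suc i) (s≤s n≤i) = Below-extend (tail x) i n≤i

  ≈-on-Fin : ∀ {n f g} → Below n f → Below n g → (∀ (i : Fin n) → f (toℕ i) ≈ g (toℕ i)) → f ≈ˢ g
  ≈-on-Fin {n} {f} {g} f< g< f≈g i with i ℕ.<? n
  ... | yes i<n = ≡.subst (λ j → f j ≈ g j) (Fin.toℕ-fromℕ< i<n) (f≈g (fromℕ< i<n))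
  ... | no i≮n  = trans (f< i (ℕ.≮⇒≥ i≮n)) (sym (g< i (ℕ.≮⇒≥ i≮n)))

  polynomial : ∀ {n} → Vector k n → Polynomial
  polynomial {n} x = extend x , n , λ i n<i → Below-extend x i (ℕ.<⇒≤ n<i)

  euclideanDegree : EuclideanDegree polynomialRing ℓ₁
  euclideanDegree = record
    { Deg = Deg ; degree = degree ; Deg-cong = λ {d} {f} {g} → Deg-cong {d} {f} {g}
    ; Deg⇒≉0 = λ {d} {f} → Deg⇒≉0 {d} {f} ; Deg-unique = λ {d} {e} {f} → Deg-unique {d} {e} {f}
    ; Deg-* = λ {d} {e} {f} {g} → Deg-* {d} {e} {f} {g} ; Deg0⇒unit = λ {f} → Deg0⇒unit {f}
    ; divide = λ {d} {g} → divide {d} {g}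
    ; enumerate = λ n → List.tabulate (λ t → polynomial (tuple {suc n} t)) , λ {d} {f} D d≤n →
        Any.tabulate⁺ (code (restrict n f)) (≈-on-Fin
          (λ i n<i → proj₂ D i (ℕ.≤-trans (s≤s d≤n) n<i))
          (Below-extend (tuple {suc n} (code (restrict n f))))
          (λ i → sym (trans (reflexive (extend-toℕ (tuple (code (restrict n f))) i)) (tuple-code (restrict n f) i))))
    }
    where
    restrict : ∀ n → Polynomial → Vector k (suc n)
    restrict n f i = coefficients f (toℕ i)

  pairing : ℕ → Series → Series → k
  pairing n f s = KΣ.sum {n} (λ l → f (toℕ l) * s (toℕ l))

  pairing-Below : ∀ {p n f} s → Below p f → p ℕ.≤ n → pairing n f s ≈ pairing p f s
  pairing-Below {zero} {n} s f< _ = KΣ.sum-zero {n} _ λ l → trans (*-congʳ (f< (toℕ l) z≤n)) (zeroˡ _)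
  pairing-Below {suc p} {suc n} s f< (s≤s p≤n) =
    +-congˡ (pairing-Below (s ∘ suc) (λ i p≤i → f< (suc i) (s≤s p≤i)) p≤n)

  pairing-⋆ : ∀ {m} (a : Vector k m) {p n g} s → Below p g → m ℕ.+ p ℕ.≤ suc n →
    pairing n (extend a ⋆ g) s ≈ KΣ.sum (λ i → a i * pairing p g (λ j → s (toℕ i ℕ.+ j)))
  pairing-⋆ {zero} a {n = n} {g} s g< _ =
    KΣ.sum-zero {n} _ λ l → trans (*-congʳ (⋆-zeroˡ g (λ _ → refl) (toℕ l))) (zeroˡ _)
  pairing-⋆ {suc zero} a {zero} {zero} s g< _ = sym (trans (+-identityʳ _) (zeroʳ _))
  pairing-⋆ {suc m} a {p} {suc n} {g} s g< (s≤s m+p≤1+n) = begin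
    f₀ * g 0 * s 0 + KΣ.sum {n} (λ l → (f₀ * g (suc (toℕ l)) + (f′ ⋆ g) (toℕ l)) * s (suc (toℕ l)))
      ≈⟨ +-cong (*-assoc _ _ _) (KΣ.sum-cong-≋ {n} λ l → trans (distribʳ _ _ _) (+-congʳ (*-assoc _ _ _))) ⟩
    f₀ * (g 0 * s 0) + KΣ.sum {n} (λ l → f₀ * (g (suc (toℕ l)) * s (suc (toℕ l))) + (f′ ⋆ g) (toℕ l) * s (suc (toℕ l)))
      ≈⟨ +-congˡ (KΣ.∑-distrib-+ {n} _ _) ⟩
    f₀ * (g 0 * s 0) + (KΣ.sum {n} (λ l → f₀ * (g (suc (toℕ l)) * s (suc (toℕ l)))) + pairing n (f′ ⋆ g) (s ∘ suc))
      ≈⟨ +-assoc _ _ _ ⟨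
    f₀ * (g 0 * s 0) + KΣ.sum {n} (λ l → f₀ * (g (suc (toℕ l)) * s (suc (toℕ l)))) + pairing n (f′ ⋆ g) (s ∘ suc)
      ≈⟨ +-congʳ (KΣ.*-distribˡ-sum {suc n} f₀ (λ l → g (toℕ l) * s (toℕ l))) ⟨
    f₀ * pairing (suc n) g s + pairing n (f′ ⋆ g) (s ∘ suc)
      ≈⟨ +-cong (*-congˡ (pairing-Below s g< (ℕ.≤-trans (ℕ.m≤n+m p m) m+p≤1+n)))
                (pairing-⋆ (tail a) (s ∘ suc) g< m+p≤1+n) ⟩
    KΣ.sum (λ i → a i * pairing p g (λ j → s (toℕ i ℕ.+ j))) ∎
    where
    f₀ = a zero
    f′ = extend (tail a)

  recurrence : ∀ {m} → Vector k m → Series → ℕ → k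
  recurrence a s j = KΣ.sum (λ i → a i * s (toℕ i ℕ.+ j))

  recurrence-cong : ∀ {m} {a b : Vector k m} {s t : Series} → (∀ i → a i ≈ b i) → s ≈ˢ t →
                    ∀ j → recurrence a s j ≈ recurrence b t j
  recurrence-cong {m} a≈b s≈t j = KΣ.sum-cong-≋ {m} λ i → *-cong (a≈b i) (s≈t _)

  Annihilates : ℕ → ∀ {m} → Vector k m → Series → Set ℓ₁
  Annihilates p a s = ∀ (j : Fin p) → recurrence a s (toℕ j) ≈ 0#

  annihilates? : ∀ p {m} (a : Vector k m) s → Dec (Annihilates p a s)
  annihilates? p a s = Fin.all? λ j → recurrence a s (toℕ j) ≟ 0#

  Annihilates-cong : ∀ {p m} {a b : Vector k m} {s t : Series} → (∀ i → a i ≈ b i) → s ≈ˢ t →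
                     Annihilates p a s → Annihilates p b t
  Annihilates-cong a≈b s≈t ann j = trans (sym (recurrence-cong a≈b s≈t (toℕ j))) (ann j)

  adjoint : ∀ {m p n} → m ℕ.+ p ℕ.≤ suc n → (a : Vector k m) (c : Vector k p) (x : Vector k n) →
    KΣ.sum (λ j → recurrence a (extend x) (toℕ j) * c j) ≈
    KΣ.sum (λ l → (extend a ⋆ extend c) (toℕ l) * x l)
  adjoint {m} {p} {n} m+p≤1+n a c x = begin
    KΣ.sum (λ j → KΣ.sum (λ i → a i * s (toℕ i ℕ.+ toℕ j)) * c j)
      ≈⟨ KΣ.sum-cong-≋ {p} (λ j → KΣ.*-distribʳ-sum {m} (c j) _) ⟩
    KΣ.sum (λ j → KΣ.sum (λ i → a i * s (toℕ i ℕ.+ toℕ j) * c j))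
      ≈⟨ KΣ.∑-comm {p} {m} _ ⟩
    KΣ.sum (λ i → KΣ.sum (λ j → a i * s (toℕ i ℕ.+ toℕ j) * c j))
      ≈⟨ KΣ.sum-cong-≋ {m} (λ i → trans (KΣ.sum-cong-≋ {p} λ j → trans (*-assoc _ _ _)
           (*-congˡ (trans (*-comm _ _) (*-congʳ (reflexive (≡.sym (extend-toℕ c j)))))))
           (sym (KΣ.*-distribˡ-sum {p} (a i) _))) ⟩
    KΣ.sum (λ i → a i * pairing p (extend c) (λ j → s (toℕ i ℕ.+ j)))
      ≈⟨ pairing-⋆ a s (Below-extend c) m+p≤1+n ⟨
    pairing n (extend a ⋆ extend c) s
      ≈⟨ KΣ.sum-cong-≋ {n} (λ l → *-congˡ (reflexive (extend-toℕ x l))) ⟩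
    KΣ.sum (λ l → (extend a ⋆ extend c) (toℕ l) * x l) ∎
    where s = extend x

  Below-product : ∀ {m p} (a : Vector k (suc m)) (c : Vector k p) → Below (m ℕ.+ p) (extend a ⋆ extend c)
  Below-product {m} a c = Below-⋆ m (Below-extend a) (Below-extend c)

  Zero⇒extend≈0 : ∀ {n} {x : Vector k n} → Zero x → ∀ i → extend x i ≈ 0#
  Zero⇒extend≈0 {zero}  x≈0 i       = refl
  Zero⇒extend≈0 {suc n} x≈0 zero    = x≈0 zero
  Zero⇒extend≈0 {suc n} x≈0 (suc i) = Zero⇒extend≈0 (x≈0 ∘ suc) i

  ≉0⇒Deg : ∀ {n} {x : Vector k n} → ¬ Zero x → ∃[ d ] Deg d (polynomial x)
  ≉0⇒Deg {x = x} x≉0 with degree (polynomial x)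
  ... | inj₁ x≈0 = contradiction (λ i → trans (reflexive (≡.sym (extend-toℕ x i))) (x≈0 (toℕ i))) x≉0
  ... | inj₂ D = D

  product-≉0 : ∀ {m p} {a : Vector k (suc m)} {c : Vector k p} → ¬ Zero a → ¬ Zero c →
    ∃[ l ] ¬ ((extend a ⋆ extend c) (toℕ {m ℕ.+ p} l) ≈ 0#)
  product-≉0 {m} {p} {a} {c} a≉0 c≉0 =
    fromℕ< d+e<m+p , λ top≈0 → proj₁ D (≡.subst (λ i → (extend a ⋆ extend c) i ≈ 0#) (Fin.toℕ-fromℕ< d+e<m+p) top≈0)
    where
    d = proj₁ (≉0⇒Deg a≉0)
    e = proj₁ (≉0⇒Deg c≉0)
    D : Deg (d ℕ.+ e) (CommutativeRing._*_ polynomialRing (polynomial a) (polynomial c))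
    D = Deg-* {f = polynomial a} {polynomial c} (proj₂ (≉0⇒Deg a≉0)) (proj₂ (≉0⇒Deg c≉0))
    d+e<m+p : d ℕ.+ e ℕ.< m ℕ.+ p
    d+e<m+p = Below⇒< {f = CommutativeRing._*_ polynomialRing (polynomial a) (polynomial c)} D (Below-product a c)

module LinearRecurrences {c ℓ₁ ℓ₂} (K : HeytingField c ℓ₁ ℓ₂) {q : ℕ} (enumeration : HasSize K q) where
  open HeytingField K hiding (zero) renaming (Carrier to k)
  open FiniteField K enumeration using (element; tuple; code; tuple-code; _≟_; ∃-tuple?; strictlyInverseˡ)
  open FiniteFieldProperties K enumeration
  open Annihilators K enumeration
  open IntegerCoefficients K-ring using (solve; _:=_; _:+_; _:*_; _:-_; :-_; con)
  open import Algebra.Properties.Monoid.Sum (CommutativeRing.+-monoid K-ring) using (sum-init-last)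
  open SetoidReasoning setoid

  LinearRecurrence : ℕ → ℕ → Series → Set _
  LinearRecurrence p t s = ∃[ b ] ∀ (j : Fin p) → recurrence {t} b s (toℕ j) ≈ s (t ℕ.+ toℕ j)

  linearRecurrence? : ∀ p t s → Dec (LinearRecurrence p t s)
  linearRecurrence? p t s = ∃-tuple?
    (λ b≈b′ eq j → trans (sym (recurrence-cong {s = s} b≈b′ (λ _ → refl) (toℕ j))) (eq j))
    (λ b → Fin.all? λ j → recurrence b s (toℕ j) ≟ s (t ℕ.+ toℕ j))

  LinearRecurrence-local : ∀ {p p′ t s s′} → p ℕ.≤ p′ → (∀ l → l ℕ.< t ℕ.+ p → s l ≈ s′ l) →
                           LinearRecurrence p′ t s → LinearRecurrence p t s′
  LinearRecurrence-local {p} {p′} {t} {s} {s′} p≤p′ s≈s′ (b , eq) = b , λ j → begin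
    KΣ.sum (λ i → b i * s′ (toℕ i ℕ.+ toℕ j))
      ≈⟨ KΣ.sum-cong-≋ {t} (λ i → *-congˡ (s≈s′ _ (ℕ.+-mono-<-≤ (Fin.toℕ<n i) (Fin.toℕ≤n j)))) ⟨
    recurrence b s (toℕ j)
      ≡⟨ ≡.cong (recurrence b s) (Fin.toℕ-inject≤ j p≤p′) ⟨
    recurrence b s (toℕ (Fin.inject≤ j p≤p′))
      ≈⟨ eq (Fin.inject≤ j p≤p′) ⟩
    s (t ℕ.+ toℕ (Fin.inject≤ j p≤p′))
      ≡⟨ ≡.cong (λ i → s (t ℕ.+ i)) (Fin.toℕ-inject≤ j p≤p′) ⟩
    s (t ℕ.+ toℕ j)
      ≈⟨ s≈s′ _ (ℕ.+-monoʳ-< t (Fin.toℕ<n j)) ⟩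
    s′ (t ℕ.+ toℕ j) ∎

  annihilator⇒linearRecurrence : ∀ {m p d s} (a : Vector k m) → Deg d (polynomial a) →
                                 Annihilates p a s → LinearRecurrence p d s
  annihilator⇒linearRecurrence {m} {p} {d} {s} a D@(ad≉0 , a<) ann = b , λ j → begin
    KΣ.sum {d} (λ i → - y * A (toℕ i) * s (toℕ i ℕ.+ toℕ j))
      ≈⟨ KΣ.sum-cong-≋ {d} (λ i → *-assoc (- y) (A (toℕ i)) _) ⟩
    KΣ.sum {d} (λ i → - y * (A (toℕ i) * s (toℕ i ℕ.+ toℕ j)))
      ≈⟨ KΣ.*-distribˡ-sum {d} (- y) _ ⟨
    - y * σ j
      ≈⟨ solve 4 (λ y σ α x → :- y :* σ := :- y :* (σ :+ α :* x) :+ (y :* α) :* x) refl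
           y (σ j) (A d) (s (d ℕ.+ toℕ j)) ⟩
    - y * (σ j + A d * s (d ℕ.+ toℕ j)) + (y * A d) * s (d ℕ.+ toℕ j)
      ≈⟨ +-cong (trans (*-congˡ (vanish j)) (zeroʳ _)) (trans (*-congʳ yad≈1) (*-identityˡ _)) ⟩
    0# + s (d ℕ.+ toℕ j)
      ≈⟨ +-identityˡ _ ⟩
    s (d ℕ.+ toℕ j) ∎
    where
    A = extend a
    y = proj₁ (inverse ad≉0)
    yad≈1 = proj₂ (inverse ad≉0)
    b : Vector k d
    b i = - y * A (toℕ i)
    σ : Fin p → k
    σ j = pairing d A (λ i → s (i ℕ.+ toℕ j))
    vanish : ∀ j → σ j + A d * s (d ℕ.+ toℕ j) ≈ 0#
    vanish j = begin
      σ j + A d * s (d ℕ.+ toℕ j)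
        ≈⟨ +-cong (KΣ.sum-cong-≋ {d} λ i → reflexive (≡.cong term (Fin.toℕ-inject₁ i)))
                  (reflexive (≡.cong term (Fin.toℕ-fromℕ d))) ⟨
      KΣ.sum {d} (λ i → term (toℕ (inject₁ i))) + term (toℕ (Fin.fromℕ d))
        ≈⟨ sum-init-last {d} (λ i → term (toℕ i)) ⟨
      pairing (suc d) A (λ i → s (i ℕ.+ toℕ j))
        ≈⟨ pairing-Below (λ i → s (i ℕ.+ toℕ j)) a< (Below⇒< {f = polynomial a} D (Below-extend a)) ⟨
      pairing m A (λ i → s (i ℕ.+ toℕ j))
        ≈⟨ KΣ.sum-cong-≋ {m} (λ i → *-congʳ (reflexive (extend-toℕ a i))) ⟩
      recurrence a s (toℕ j)
        ≈⟨ ann j ⟩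
      0# ∎
      where
      term : ℕ → k
      term i = A i * s (i ℕ.+ toℕ j)

  characteristic : ∀ {t} → Vector k t → Series
  characteristic {t} b i = extend b i - monomial t i
    where
    monomial : ℕ → Series
    monomial zero    zero    = 1#
    monomial zero    (suc _) = 0#
    monomial (suc t) zero    = 0#
    monomial (suc t) (suc i) = monomial t i

  characteristic-top : ∀ {t} (b : Vector k t) → characteristic b t ≈ - 1#
  characteristic-top {zero}  b = +-identityˡ _
  characteristic-top {suc t} b = characteristic-top (tail b)

  characteristic-Below : ∀ {t} (b : Vector k t) → Below (suc t) (characteristic b)
  characteristic-Below {zero}  b (suc i) _         = -‿inverseʳ 0#
  characteristic-Below {suc t} b (suc i) (s≤s t<i) = characteristic-Below (tail b) i t<i

  pairing-characteristic : ∀ {t} (b : Vector k t) s →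
    pairing (suc t) (characteristic b) s ≈ KΣ.sum (λ i → b i * s (toℕ i)) - s t
  pairing-characteristic {zero} b s =
    solve 1 (λ s → (con (+ 0) :- con (+ 1)) :* s :+ con (+ 0) := con (+ 0) :- s) refl (s 0)
  pairing-characteristic {suc t} b s = trans
    (+-congˡ (pairing-characteristic (tail b) (s ∘ suc)))
    (solve 4 (λ b s σ u → (b :- con (+ 0)) :* s :+ (σ :- u) := (b :* s :+ σ) :- u) refl
      (b zero) (s 0) (KΣ.sum (λ i → b (suc i) * s (suc (toℕ i)))) (s (suc t)))

  padded : ∀ m {t} → Vector k t → Vector k (suc m)
  padded m b i = characteristic b (toℕ i)

  padded-annihilates : ∀ {m p t s} → t ℕ.≤ m → ((b , _) : LinearRecurrence p t s) → Annihilates p (padded m b) s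
  padded-annihilates {m} {p} {t} {s} t≤m (b , eq) j = begin
    pairing (suc m) (characteristic b) (λ i → s (i ℕ.+ toℕ j))
      ≈⟨ pairing-Below (λ i → s (i ℕ.+ toℕ j)) (characteristic-Below b) (s≤s t≤m) ⟩
    pairing (suc t) (characteristic b) (λ i → s (i ℕ.+ toℕ j))
      ≈⟨ pairing-characteristic b (λ i → s (i ℕ.+ toℕ j)) ⟩
    recurrence b s (toℕ j) - s (t ℕ.+ toℕ j)
      ≈⟨ +-congʳ (eq j) ⟩
    s (t ℕ.+ toℕ j) - s (t ℕ.+ toℕ j)
      ≈⟨ -‿inverseʳ _ ⟩
    0# ∎

  -1≉0 : ¬ (- 1# ≈ 0#)
  -1≉0 -1≈0 = 1≉0 (trans (solve 0 (con (+ 1) := :- (:- con (+ 1))) refl)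
    (trans (-‿cong -1≈0) (solve 0 (:- con (+ 0) := con (+ 0)) refl)))

  padded-top : ∀ m {t} (t<1+m : t ℕ.< suc m) (b : Vector k t) → padded m b (fromℕ< t<1+m) ≈ - 1#
  padded-top m t<1+m b = trans (reflexive (≡.cong (characteristic b) (Fin.toℕ-fromℕ< t<1+m))) (characteristic-top b)

  Recurrent : ℕ → ℕ → Series → Set _
  Recurrent m p s = ∃[ t ] t ℕ.< suc m × LinearRecurrence p t s

  record Least (p : ℕ) (s : Series) (t : ℕ) : Set (c Level.⊔ ℓ₁) where
    constructor leastRecurrence
    field
      satisfied : LinearRecurrence p t s
      minimal   : ∀ {t′} → t′ ℕ.< t → ¬ LinearRecurrence p t′ s

  least : ∀ p s m → Recurrent m p s → ∃[ t ] t ℕ.< suc m × Least p s t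
  least p s m (t , t≤m , rec) with search (suc m)
    where
    search : ∀ m → (∀ {t} → t ℕ.< m → ¬ LinearRecurrence p t s) ⊎ (∃[ t ] t ℕ.< m × Least p s t)
    search zero = inj₁ λ ()
    search (suc m) with search m
    ... | inj₂ (t , t<m , l) = inj₂ (t , ℕ.m≤n⇒m≤1+n t<m , l)
    ... | inj₁ none with linearRecurrence? p m s
    ...   | yes rec = inj₂ (m , ℕ.≤-refl , leastRecurrence rec none)
    ...   | no ¬rec = inj₁ λ {t} t<1+m rec → case-≡ t<1+m rec (t ℕ.≟ m)
      where
      case-≡ : ∀ {t} → t ℕ.< suc m → LinearRecurrence p t s → Dec (t ≡ m) → _
      case-≡ _ rec (yes ≡.refl) = ¬rec rec
      case-≡ t<1+m rec (no t≢m) = none (ℕ.≤∧≢⇒< (ℕ.≤-pred t<1+m) t≢m) rec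
  ... | inj₁ none = contradiction rec (none t≤m)
  ... | inj₂ found = found

  recurrent? : ∀ m p s → Dec (Recurrent m p s)
  recurrent? m p s = map′
    (λ (t , rec) → toℕ t , Fin.toℕ<n t , rec)
    (λ (t , t≤m , rec) → fromℕ< t≤m , ≡.subst (λ u → LinearRecurrence p u s) (≡.sym (Fin.toℕ-fromℕ< t≤m)) rec)
    (Fin.any? λ (t : Fin (suc m)) → linearRecurrence? p (toℕ t) s)

  recurrent⇒annihilator : ∀ {m p s} → Recurrent m p s → ∃[ a ] (¬ Zero {suc m} a × Annihilates p a s)
  recurrent⇒annihilator {m} {s = s} (t , t≤m , rec) = padded m (proj₁ rec) ,
    (λ a≈0 → -1≉0 (trans (sym (padded-top m t≤m (proj₁ rec))) (a≈0 (fromℕ< t≤m)))) ,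
    padded-annihilates {s = s} (ℕ.≤-pred t≤m) rec

  annihilator⇒recurrent : ∀ {m p s} {a : Vector k (suc m)} → ¬ Zero a → Annihilates p a s → Recurrent m p s
  annihilator⇒recurrent {m} {p} {s} {a} a≉0 ann = at-degree (≉0⇒Deg a≉0)
    where
    at-degree : ∃[ d ] Deg d (polynomial a) → Recurrent m p s
    at-degree (d , D) = d , Below⇒< {f = polynomial a} D (Below-extend a) ,
      annihilator⇒linearRecurrence {s = s} a D ann

  extend-insertAt-< : ∀ {n} (x : Vector k n) i v {l} → l ℕ.< toℕ i → extend (insertAt x i v) l ≡ extend x l
  extend-insertAt-< {suc n} x (suc i) v {zero}  _         = ≡.refl
  extend-insertAt-< {suc n} x (suc i) v {suc l} (s≤s l<i) = extend-insertAt-< (tail x) i v l<i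

  extend-insertAt-≡ : ∀ {n} (x : Vector k n) i v → extend (insertAt x i v) (toℕ i) ≡ v
  extend-insertAt-≡ x zero v            = ≡.refl
  extend-insertAt-≡ {suc n} x (suc i) v = extend-insertAt-≡ (tail x) i v

  module Prolongation {n m p} (m+p≤n : m ℕ.+ p ℕ.≤ n) where

    position : ∀ {t} → t ℕ.< suc m → Fin (suc n)
    position t≤m = fromℕ< (s≤s (ℕ.≤-trans (ℕ.+-monoˡ-≤ p (ℕ.≤-pred t≤m)) m+p≤n))

    toℕ-position : ∀ {t} (t≤m : t ℕ.< suc m) → toℕ (position t≤m) ≡ t ℕ.+ p
    toℕ-position t≤m = Fin.toℕ-fromℕ< _

    prolong : ∀ (x : Vector k n) {t} → t ℕ.< suc m → LinearRecurrence p t (extend x) → Vector k (suc n)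
    prolong x t≤m (b , _) = insertAt x (position t≤m) (recurrence b (extend x) p)

    prolong-agrees : ∀ (x : Vector k n) {t} (t≤m : t ℕ.< suc m) rec {l} → l ℕ.< t ℕ.+ p →
                     extend (prolong x t≤m rec) l ≡ extend x l
    prolong-agrees x t≤m rec l<t+p = extend-insertAt-< x (position t≤m) _
      (ℕ.<-≤-trans l<t+p (ℕ.≤-reflexive (≡.sym (toℕ-position t≤m))))

    prolong-recurrence : ∀ (x : Vector k n) {t} (t≤m : t ℕ.< suc m) rec →
                         LinearRecurrence (suc p) t (extend (prolong x t≤m rec))
    prolong-recurrence x {t} t≤m rec@(b , eq) = b , holds
      where
      y = prolong x t≤m rec
      agrees : ∀ {l} → l ℕ.< t ℕ.+ p → extend y l ≈ extend x l
      agrees l< = reflexive (prolong-agrees x t≤m rec l<)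
      same : ∀ j → j ℕ.≤ p → recurrence b (extend y) j ≈ recurrence b (extend x) j
      same j j≤p = KΣ.sum-cong-≋ {t} λ i → *-congˡ (agrees (ℕ.+-mono-<-≤ (Fin.toℕ<n i) j≤p))
      holds : ∀ (j : Fin (suc p)) → recurrence b (extend y) (toℕ j) ≈ extend y (t ℕ.+ toℕ j)
      holds j with toℕ j ℕ.<? p
      ... | yes j<p = trans (same (toℕ j) (ℕ.<⇒≤ j<p)) (trans
        (≡.subst (λ i → recurrence b (extend x) i ≈ extend x (t ℕ.+ i)) (Fin.toℕ-fromℕ< j<p) (eq (fromℕ< j<p)))
        (sym (agrees (ℕ.+-monoʳ-< t j<p))))
      ... | no j≮p = ≡.subst (λ i → recurrence b (extend y) i ≈ extend y (t ℕ.+ i))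
        (ℕ.≤-antisym (ℕ.≮⇒≥ j≮p) (ℕ.≤-pred (Fin.toℕ<n j)))
        (trans (same p ℕ.≤-refl) (reflexive (≡.sym (≡.trans
          (≡.cong (extend y) (≡.sym (toℕ-position t≤m))) (extend-insertAt-≡ x (position t≤m) _)))))

    prolong-minimal : ∀ (x : Vector k n) {t} (t≤m : t ℕ.< suc m) (l : Least p (extend x) t) {t′} → t′ ℕ.< t →
      ¬ LinearRecurrence (suc p) t′ (extend (prolong x t≤m (Least.satisfied l)))
    prolong-minimal x t≤m l t′<t rec′ = Least.minimal l t′<t (LinearRecurrence-local (ℕ.n≤1+n p)
      (λ i i<t′+p → reflexive (prolong-agrees x t≤m (Least.satisfied l)
        (ℕ.<-trans i<t′+p (ℕ.+-monoˡ-< p t′<t)))) rec′)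

    prolong-injective : ∀ (x x′ : Vector k n) {t t′} (t≤m : t ℕ.< suc m) (t′≤m : t′ ℕ.< suc m)
      (l : Least p (extend x) t) (l′ : Least p (extend x′) t′) →
      (∀ i → prolong x t≤m (Least.satisfied l) i ≈ prolong x′ t′≤m (Least.satisfied l′) i) → ∀ i → x i ≈ x′ i
    prolong-injective x x′ {t} {t′} t≤m t′≤m l l′ y≈y′ with ℕ.<-cmp t t′
    ... | tri< t<t′ _ _ = contradiction
      (LinearRecurrence-local ℕ.≤-refl (λ i _ → extend-cong y≈y′ i) (prolong-recurrence x t≤m (Least.satisfied l)))
      (prolong-minimal x′ t′≤m l′ t<t′)
    ... | tri> _ _ t′<t = contradiction
      (LinearRecurrence-local ℕ.≤-refl (λ i _ → sym (extend-cong y≈y′ i)) (prolong-recurrence x′ t′≤m (Least.satisfied l′)))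
      (prolong-minimal x t≤m l t′<t)
    ... | tri≈ _ ≡.refl _ = λ i → begin
      x i
        ≡⟨ insertAt-punchIn x (position t≤m) _ i ⟨
      prolong x t≤m (Least.satisfied l) (Fin.punchIn (position t≤m) i)
        ≈⟨ y≈y′ _ ⟩
      prolong x′ t≤m (Least.satisfied l′) (Fin.punchIn (position t≤m) i)
        ≡⟨ insertAt-punchIn x′ (position t≤m) _ i ⟩
      x′ i ∎

  1<q : 1 ℕ.< q
  1<q = ℕ.≰⇒> λ q≤1 → 1≉0 (trans (sym (strictlyInverseˡ 1#)) (trans
    (reflexive (≡.cong element (unique q≤1 _ _))) (strictlyInverseˡ 0#)))
    where
    unique : ∀ {n} → n ℕ.≤ 1 → (i j : Fin n) → i ≡ j
    unique (s≤s z≤n) zero zero = ≡.refl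

  x-y≈0⇒x≈y : ∀ {x y} → x - y ≈ 0# → x ≈ y
  x-y≈0⇒x≈y {x} {y} x-y≈0 = trans (solve 2 (λ x y → x := (x :- y) :+ y) refl x y)
                                   (trans (+-congʳ x-y≈0) (+-identityˡ y))

  recurrence-linear : ∀ {m} (a b : Vector k m) x s j →
    recurrence (λ i → a i + x * b i) s j ≈ recurrence a s j + x * recurrence b s j
  recurrence-linear {m} a b x s j = begin
    KΣ.sum (λ i → (a i + x * b i) * s (toℕ i ℕ.+ j))
      ≈⟨ KΣ.sum-cong-≋ {m} (λ i → solve 4 (λ a x b s → (a :+ x :* b) :* s := a :* s :+ x :* (b :* s)) refl
           (a i) x (b i) (s (toℕ i ℕ.+ j))) ⟩
    KΣ.sum (λ i → a i * s (toℕ i ℕ.+ j) + x * (b i * s (toℕ i ℕ.+ j)))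
      ≈⟨ KΣ.∑-distrib-+ {m} _ _ ⟩
    recurrence a s j + KΣ.sum (λ i → x * (b i * s (toℕ i ℕ.+ j)))
      ≈⟨ +-congˡ (KΣ.*-distribˡ-sum {m} x _) ⟨
    recurrence a s j + x * recurrence b s j ∎

  -- m homogeneous equations in m + 1 unknowns have a non-trivial solution, by the pigeonhole principle.
  recurrent-initially : ∀ m s → Recurrent m m s
  recurrent-initially m s = collide (Fin.pigeonhole (ℕ.^-monoʳ-< q 1<q (ℕ.n<1+n m)) values)
    where
    open TupleSums K enumeration +-*-commutativeSemiring using (tuple-injective)
    values : Fin (q ℕ.^ suc m) → Fin (q ℕ.^ m)
    values t = code (λ (j : Fin m) → recurrence (tuple {suc m} t) s (toℕ j))
    collide : ∃₂ (λ t u → t Fin.< u × values t ≡ values u) → Recurrent m m s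
    collide (t , u , t<u , same) = annihilator⇒recurrent {s = s}
      (λ a≈0 → Fin.<⇒≢ t<u (tuple-injective (suc m) λ i → x-y≈0⇒x≈y
        (trans (solve 2 (λ x y → x :- y := x :+ (:- con (+ 1)) :* y) refl (tuple {suc m} t i) (tuple {suc m} u i)) (a≈0 i))))
      (λ j → trans (recurrence-linear (tuple {suc m} t) (tuple u) (- 1#) s (toℕ j)) (trans
        (+-congʳ (trans (sym (tuple-code {m} _ j)) (trans (reflexive (≡.cong (λ z → tuple {m} z j) same)) (tuple-code {m} _ j))))
        (solve 1 (λ x → x :+ (:- con (+ 1)) :* x := con (+ 0)) refl _)))

  -- The relations X w + x v, for w a relation of length m and v the relation of least degree,
  -- are pairwise distinct: v is not of the form X w, since w would have lower degree.
  module LeastRelation {m p s t} (t≤m : t ℕ.< suc m) (l : Least p s t) where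
    open Least l renaming (satisfied to recurs)

    v : Vector k (suc m)
    v = padded m (proj₁ recurs)

    shift : Vector k m → Vector k (suc m)
    shift w zero    = 0#
    shift w (suc i) = w i

    image : Vector k (suc m) → Vector k (suc m)
    image u i = shift (tail u) i + u zero * v i

    image-annihilates : ∀ u → Annihilates (suc p) (tail u) s → Annihilates p (image u) s
    image-annihilates u ann j = trans (recurrence-linear (shift (tail u)) v (u zero) s (toℕ j))
      (trans (+-cong
        (trans (+-cong (zeroˡ _) (KΣ.sum-cong-≋ {m} λ i → *-congˡ (reflexive (≡.cong s (≡.sym (ℕ.+-suc (toℕ i) (toℕ j)))))))
          (trans (+-identityˡ _) (ann (suc j))))
        (trans (*-congˡ (padded-annihilates {s = s} (ℕ.≤-pred t≤m) recurs j)) (zeroʳ _)))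
        (+-identityˡ _))

    shift≉v : ∀ w → Annihilates (suc p) w s → ¬ (∀ i → shift w i ≈ v i)
    shift≉v w ann Xw≈v with zero? w
    ... | yes w≈0 = -1≉0 (trans (sym (padded-top m t≤m (proj₁ recurs)))
      (trans (sym (Xw≈v _)) (Xw≈0 (fromℕ< t≤m))))
      where
      Xw≈0 : ∀ i → shift w i ≈ 0#
      Xw≈0 zero    = refl
      Xw≈0 (suc i) = w≈0 i
    ... | no w≉0 with ≉0⇒Deg w≉0
    ...   | d , D@(wd≉0 , _) = minimal (ℕ.≤-pred (ℕ.≰⇒> d≱t))
      (LinearRecurrence-local {s = s} (ℕ.n≤1+n p) (λ _ _ → refl) (annihilator⇒linearRecurrence {s = s} w D ann))
      where
      d<m : d ℕ.< m
      d<m = Below⇒< {f = polynomial w} D (Below-extend w)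
      d≱t : ¬ (suc t ℕ.≤ suc d)
      d≱t t≤d = wd≉0 (trans (reflexive (≡.trans (≡.cong (extend w) (≡.sym (Fin.toℕ-fromℕ< d<m))) (extend-toℕ w (fromℕ< d<m))))
        (trans (Xw≈v (suc (fromℕ< d<m))) (characteristic-Below (proj₁ recurs) _
          (ℕ.≤-trans t≤d (ℕ.≤-reflexive (≡.cong suc (≡.sym (Fin.toℕ-fromℕ< d<m))))))))

    image-injective : ∀ u u′ → Annihilates (suc p) (tail u) s → Annihilates (suc p) (tail u′) s →
                      (∀ i → image u i ≈ image u′ i) → ∀ i → u i ≈ u′ i
    image-injective u u′ ann ann′ same = compare (u zero ≟ u′ zero)
      where
      compare : Dec (u zero ≈ u′ zero) → ∀ i → u i ≈ u′ i
      compare (yes x≈x′) zero    = x≈x′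
      compare (yes x≈x′) (suc i) = trans
        (solve 3 (λ w x v → w := (w :+ x :* v) :- x :* v) refl (u (suc i)) (u zero) (v (suc i)))
        (trans (+-cong (same (suc i)) (-‿cong (*-congʳ x≈x′)))
        (solve 3 (λ w x v → (w :+ x :* v) :- x :* v := w) refl (u′ (suc i)) (u′ zero) (v (suc i))))
      compare (no x≉x′) = contradiction Xw≈v (shift≉v w w-ann)
        where
        inv : ∃[ y ] y * (u zero - u′ zero) ≈ 1#
        inv = inverse (λ x-x′≈0 → x≉x′ (x-y≈0⇒x≈y x-x′≈0))
        y = proj₁ inv
        Δ w : Vector k m
        Δ i = u′ (suc i) + (- 1#) * u (suc i)
        w i = y * Δ i
        w-ann : Annihilates (suc p) w s
        w-ann j = trans
          (KΣ.sum-cong-≋ {m} λ i → solve 3 (λ y b s → y :* b :* s := (con (+ 0) :+ y :* b) :* s) refl y (Δ i) (s (toℕ i ℕ.+ toℕ j)))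
          (trans (recurrence-linear {m} (λ _ → 0#) Δ y s (toℕ j))
          (trans (+-cong (KΣ.sum-zero {m} _ λ i → zeroˡ (s (toℕ i ℕ.+ toℕ j)))
            (*-congˡ (trans (recurrence-linear (tail u′) (tail u) (- 1#) s (toℕ j))
              (+-cong (ann′ j) (*-congˡ (ann j))))))
          (solve 1 (λ y → con (+ 0) :+ y :* (con (+ 0) :+ (:- con (+ 1)) :* con (+ 0)) := con (+ 0)) refl y)))
        yΔ≈v : ∀ i → y * (shift (tail u′) i + (- 1#) * shift (tail u) i) ≈ v i
        yΔ≈v i = trans
          (solve 6 (λ y w w′ x x′ v → y :* (w′ :+ (:- con (+ 1)) :* w) :=
            y :* ((w′ :+ x′ :* v) :- (w :+ x :* v)) :+ y :* (x :- x′) :* v)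
            refl y (shift (tail u) i) (shift (tail u′) i) (u zero) (u′ zero) (v i))
          (trans (+-cong (*-congˡ (trans (+-congʳ (sym (same i))) (-‿inverseʳ _))) (*-congʳ (proj₂ inv)))
          (solve 2 (λ y v → y :* con (+ 0) :+ con (+ 1) :* v := v) refl y (v i)))
        Xw≈v : ∀ i → shift w i ≈ v i
        Xw≈v zero = trans (solve 1 (λ y → con (+ 0) := y :* (con (+ 0) :+ (:- con (+ 1)) :* con (+ 0))) refl y) (yΔ≈v zero)
        Xw≈v (suc i) = yΔ≈v (suc i)

module AnnihilatorCounts {r r₁ r₂ c ℓ₁ ℓ₂} (F : OrderedField r r₁ r₂)
  (K : HeytingField c ℓ₁ ℓ₂) {q : ℕ} (enumeration : HasSize K q) where
  open OrderedField F hiding (zero)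
  open OrderedFieldProperties F
  open Counting F
  open FiniteSums commutativeSemiring
  open TupleSums K enumeration commutativeSemiring
  open FiniteField K enumeration using (tuple; code; tuple-code)
  open Annihilators K enumeration
  open LinearRecurrences K enumeration
  private module K = HeytingField K
  open K using () renaming (Carrier to k; _≈_ to _≈ₖ_; _+_ to _+ₖ_; _*_ to _*ₖ_; -_ to -ₖ_; 0# to 0ₖ; 1# to 1ₖ)
  open IntegerCoefficients commutativeRing using (solve; _:=_; _:+_; _:*_; _:-_; :-_; con)
  open ≤-Reasoning

  annihilatorCount : ℕ → ℕ → Series → Carrier
  annihilatorCount m p s = tupleSum m (λ a → [ annihilates? p a s ])

  recurrentCount : ℕ → ℕ → ℕ → Carrier
  recurrentCount n m p = tupleSum n (λ x → [ recurrent? m p (extend x) ])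

  recurrentCount-prolong : ∀ {n m p} → m ℕ.+ p ℕ.≤ n → recurrentCount n m p ≤ recurrentCount (suc n) m (suc p)
  recurrentCount-prolong {n} {m} {p} m+p≤n = count-injection {q ℕ.^ n} {q ℕ.^ suc n}
    (λ t → recurrent? m p (extend (tuple {n} t)))
    (λ t → recurrent? m (suc p) (extend (tuple {suc n} t)))
    (λ t rec → code (longer t rec))
    (λ t rec → let u , u≤m , l = least p _ m rec in u , u≤m ,
      LinearRecurrence-local ℕ.≤-refl (λ i _ → extend-cong (λ j → K.sym (tuple-code (longer t rec) j)) i)
        (prolong-recurrence (tuple t) u≤m (Least.satisfied l)))
    (λ {t} {t′} rec rec′ eq → tuple-injective n (
      let u , u≤m , l = least p _ m rec
          u′ , u′≤m , l′ = least p _ m rec′ in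
      prolong-injective (tuple t) (tuple t′) u≤m u′≤m l l′ λ i →
        K.trans (K.sym (tuple-code (longer t rec) i))
          (K.trans (K.reflexive (≡.cong (λ v → tuple v i) eq)) (tuple-code (longer t′ rec′) i))))
    where
    open Prolongation {n} {m} {p} m+p≤n
    longer : ∀ t → Recurrent m p (extend (tuple {n} t)) → Vector k (suc n)
    longer t rec = let u , u≤m , l = least p _ m rec in prolong (tuple t) u≤m (Least.satisfied l)

  recurrentCount-≥ : ∀ m e → fromℕ q ^ (m ℕ.+ m) ≤ recurrentCount (e ℕ.+ (m ℕ.+ m)) m (e ℕ.+ m)
  recurrentCount-≥ m zero = begin
    fromℕ q ^ (m ℕ.+ m)                            ≈⟨ fromℕ-^ q (m ℕ.+ m) ⟨
    fromℕ (q ℕ.^ (m ℕ.+ m))                        ≈⟨ sum-ones (q ℕ.^ (m ℕ.+ m)) ⟨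
    sum {q ℕ.^ (m ℕ.+ m)} (λ _ → 1#)               ≈⟨ sum-cong-≋ {q ℕ.^ (m ℕ.+ m)} (λ t →
                                                        [yes] (recurrent? m m (extend (tuple {m ℕ.+ m} t))) (recurrent-initially m (extend (tuple {m ℕ.+ m} t)))) ⟨
    recurrentCount (m ℕ.+ m) m m                   ∎
  recurrentCount-≥ m (suc e) = ≤-trans (recurrentCount-≥ m e)
    (recurrentCount-prolong {e ℕ.+ (m ℕ.+ m)} {m} {e ℕ.+ m} (ℕ.≤-reflexive (≡.trans (≡.cong (m ℕ.+_) (ℕ.+-comm e m))
      (≡.trans (≡.sym (ℕ.+-assoc m m e)) (ℕ.+-comm (m ℕ.+ m) e)))))

  module _ {m p : ℕ} {s : Series} where

    q*annihilatorCount≤ : Recurrent m p s →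
      fromℕ q * annihilatorCount m (suc p) s ≤ annihilatorCount (suc m) p s
    q*annihilatorCount≤ rec = with-least (least p s m rec)
      where
      with-least : (∃[ t ] t ℕ.< suc m × Least p s t) →
        fromℕ q * annihilatorCount m (suc p) s ≤ annihilatorCount (suc m) p s
      with-least (t , t≤m , l) = begin
        fromℕ q * annihilatorCount m (suc p) s
          ≈⟨ sum-const q _ ⟨
        sum {q} (λ _ → annihilatorCount m (suc p) s)
          ≈⟨ tupleSum-head-tail m (λ _ b → [ annihilates? (suc p) b s ])
               (λ {_} {_} {u} {v} _ u≈v → []-cong (annihilates? (suc p) u s) (annihilates? (suc p) v s)
                 (Annihilates-cong {suc p} {m} {u} {v} {s} u≈v (λ _ → K.refl))
                 (Annihilates-cong {suc p} {m} {v} {u} {s} (λ i → K.sym (u≈v i)) (λ _ → K.refl))) ⟨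
        tupleSum (suc m) (λ u → [ annihilates? (suc p) (tail u) s ])
          ≤⟨ count-injection {q ℕ.^ suc m} {q ℕ.^ suc m}
               (λ τ → annihilates? (suc p) (tail (tuple {suc m} τ)) s)
               (λ τ → annihilates? p (tuple {suc m} τ) s)
               (λ τ _ → code (image (tuple {suc m} τ)))
               (λ τ ann → Annihilates-cong {p} {suc m} {image (tuple {suc m} τ)} {s = s} (λ i → K.sym (tuple-code (image (tuple {suc m} τ)) i))
                 (λ _ → K.refl) (image-annihilates (tuple {suc m} τ) ann))
               (λ {τ} {τ′} ann ann′ eq → tuple-injective (suc m) (image-injective (tuple {suc m} τ) (tuple {suc m} τ′) ann ann′ λ i →
                 K.trans (K.sym (tuple-code (image (tuple {suc m} τ)) i)) (K.trans
                   (K.reflexive (≡.cong (λ υ → tuple υ i) eq)) (tuple-code (image (tuple {suc m} τ′)) i)))) ⟩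
        annihilatorCount (suc m) p s ∎
        where open LeastRelation t≤m l

    annihilatorCount≤1 : ¬ Recurrent m p s → annihilatorCount m (suc p) s ≤ 1#
    annihilatorCount≤1 ¬rec = count≤1 {q ℕ.^ m} (λ t → annihilates? (suc p) (tuple {m} t) s)
      λ {t} {u} ann ann′ → tuple-injective m λ i →
        K.trans (vanishes (tuple {m} t) ann i) (K.sym (vanishes (tuple {m} u) ann′ i))
      where
      vanishes : ∀ a → Annihilates (suc p) a s → Zero {m} a
      vanishes a ann with zero? a
      ... | yes a≈0 = a≈0
      ... | no a≉0 with ≉0⇒Deg a≉0
      ...   | d , D = contradiction (d , ℕ.m≤n⇒m≤1+n (Below⇒< {f = polynomial a} D (Below-extend a)) ,
        LinearRecurrence-local {s = s} (ℕ.n≤1+n p) (λ _ _ → K.refl) (annihilator⇒linearRecurrence {s = s} a D ann)) ¬rec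

    1≤annihilatorCount : 1# ≤ annihilatorCount (suc m) p s
    1≤annihilatorCount = begin
      1#
        ≈⟨ [yes] (annihilates? p (tuple {suc m} 𝟘) s) zero-annihilates ⟨
      [ annihilates? p (tuple {suc m} 𝟘) s ]
        ≤⟨ summand≤sum {q ℕ.^ suc m} {λ t → [ annihilates? p (tuple {suc m} t) s ]}
             (λ t → 0≤[] (annihilates? p (tuple {suc m} t) s)) 𝟘 ⟩
      annihilatorCount (suc m) p s ∎
      where
      𝟘 : Fin (q ℕ.^ suc m)
      𝟘 = code {suc m} (λ _ → 0ₖ)
      zero-annihilates : Annihilates p (tuple {suc m} 𝟘) s
      zero-annihilates j = KΣ.sum-zero {suc m} _ λ i → K.trans (K.*-congʳ (tuple-code {suc m} (λ _ → 0ₖ) i)) (K.zeroˡ (s (toℕ i ℕ.+ toℕ j)))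

    0≤defect : 0# ≤ (fromℕ q - 1#) * (1# - [ recurrent? m p s ]) +
                    (annihilatorCount (suc m) p s - fromℕ q * annihilatorCount m (suc p) s)
    0≤defect = by-cases (recurrent? m p s)
      where
      Q  = fromℕ q
      M  = annihilatorCount (suc m) p s
      M′ = annihilatorCount m (suc p) s
      by-cases : (d : Dec (Recurrent m p s)) → 0# ≤ (Q - 1#) * (1# - [ d ]) + (M - Q * M′)
      by-cases (yes rec) = ≤-trans (x≤y⇒0≤y-x (q*annihilatorCount≤ rec)) (≤-reflexive
        (solve 3 (λ q x y → x :- y := (q :- con (+ 1)) :* (con (+ 1) :- con (+ 1)) :+ (x :- y)) refl Q M (Q * M′)))
      by-cases (no ¬rec) = begin
        0#                                             ≈⟨ +-identityˡ 0# ⟨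
        0# + 0#                                        ≤⟨ +-mono-≤
          (*-nonNeg (0≤fromℕ q) (x≤y⇒0≤y-x (annihilatorCount≤1 ¬rec))) (x≤y⇒0≤y-x 1≤annihilatorCount) ⟩
        Q * (1# - M′) + (M - 1#)                       ≈⟨ solve 3 (λ q m m′ →
          q :* (con (+ 1) :- m′) :+ (m :- con (+ 1)) :=
          (q :- con (+ 1)) :* (con (+ 1) :- con (+ 0)) :+ (m :- q :* m′)) refl Q M M′ ⟩
        (Q - 1#) * (1# - 0#) + (M - Q * M′)            ∎

-- The mean number of relations

module DivisorCounts {r r₁ r₂ c ℓ₁ ℓ₂} (F : OrderedField r r₁ r₂)
  (K : HeytingField c ℓ₁ ℓ₂) {q : ℕ} (enumeration : HasSize K q) where
  open OrderedField F hiding (zero)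
  open OrderedFieldProperties F
  open Counting F
  open FiniteSums commutativeSemiring
  open TupleSums K enumeration commutativeSemiring
  open FiniteField K enumeration using (tuple; _≟_)
  open Annihilators K enumeration
  open DivisorBound polynomialRing euclideanDegree using (Covers; *-cancelˡ)
  private module K = HeytingField K
  open K using () renaming (Carrier to k; _≈_ to _≈ₖ_)
  open ≤-Reasoning

  convolution : ∀ {m p} N → Vector k m → Vector k p → Vector k N
  convolution N a c l = (extend a ⋆ extend c) (toℕ l)

  module _ {m p : ℕ} where
    private
      N : ℕ
      N = m ℕ.+ p

    Factors : Vector k N → Vector k (suc m) → Vector k p → Set ℓ₁
    Factors y a c = (¬ Zero a × ¬ Zero c) × (∀ l → convolution N a c l ≈ₖ y l)

    factors? : ∀ y a c → Dec (Factors y a c)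
    factors? y a c = (¬? (zero? a) ×-dec ¬? (zero? c)) ×-dec Fin.all? λ l → convolution N a c l ≟ y l

    Factors⇒product : ∀ {y a c} → Factors y a c → extend a ⋆ extend c ≈ˢ extend y
    Factors⇒product {y} {a} {c} (_ , ac≈y) = ≈-on-Fin (Below-product a c) (Below-extend y)
      λ l → K.trans (ac≈y l) (K.reflexive (≡.sym (extend-toℕ y l)))

    Listed : List Polynomial → Vector k (suc m) → Set _
    Listed gs a = Any (λ g → ∀ i → a i ≈ₖ coefficients g (toℕ i)) gs

    listed? : ∀ gs a → Dec (Listed gs a)
    listed? gs a = Any.any? (λ g → Fin.all? λ i → a i ≟ coefficients g (toℕ i)) gs

    listed-count : ∀ gs → tupleSum (suc m) (λ a → [ listed? gs a ]) ≤ fromℕ (length gs)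
    listed-count [] = ≤-reflexive (sum-zero {q ℕ.^ suc m} _ λ t → [no] (listed? [] (tuple {suc m} t)) λ ())
    listed-count (g ∷ gs) = begin
      tupleSum (suc m) (λ a → [ listed? (g ∷ gs) a ])
        ≤⟨ ∑-mono-≤ {q ℕ.^ suc m} (λ t → union (tuple t)) ⟩
      tupleSum (suc m) (λ a → [ here? a ] + [ listed? gs a ])
        ≈⟨ ∑-distrib-+ {q ℕ.^ suc m} _ _ ⟩
      tupleSum (suc m) (λ a → [ here? a ]) + tupleSum (suc m) (λ a → [ listed? gs a ])
        ≤⟨ +-mono-≤ (count≤1 {q ℕ.^ suc m} (λ t → here? (tuple t))
             (λ p p′ → tuple-injective (suc m) λ i → K.trans (p i) (K.sym (p′ i)))) (listed-count gs) ⟩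
      fromℕ (length (g ∷ gs)) ∎
      where
      here? : ∀ a → Dec (∀ i → a i ≈ₖ coefficients g (toℕ i))
      here? a = Fin.all? λ i → a i ≟ coefficients g (toℕ i)
      union : ∀ a → [ listed? (g ∷ gs) a ] ≤ [ here? a ] + [ listed? gs a ]
      union a = by-cases (listed? (g ∷ gs) a)
        where
        by-cases : (d : Dec (Listed (g ∷ gs) a)) → [ d ] ≤ [ here? a ] + [ listed? gs a ]
        by-cases (no _) = ≤-trans (≤-reflexive (sym (+-identityˡ 0#))) (+-mono-≤ (0≤[] (here? a)) (0≤[] (listed? gs a)))
        by-cases (yes (here a≈g)) = ≤-trans (≤-reflexive (sym (+-identityʳ 1#)))
          (+-mono-≤ (≤-reflexive (sym ([yes] (here? a) a≈g))) (0≤[] (listed? gs a)))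
        by-cases (yes (there a∈gs)) = ≤-trans (≤-reflexive (sym (+-identityˡ 1#)))
          (+-mono-≤ (0≤[] (here? a)) (≤-reflexive (sym ([yes] (listed? gs a) a∈gs))))

    factorisation-count : ∀ {B} → (∀ {f n} → Deg n f → n ℕ.< N → ∃[ gs ] length gs ℕ.≤ B × Covers gs f) →
      ∀ y → tupleSum (suc m) (λ a → tupleSum p (λ c → [ factors? y a c ])) ≤ fromℕ B
    factorisation-count {B} cover y = by-degree (degree (polynomial y))
      where
      by-degree : extend y ≈ˢ (λ _ → K.0#) ⊎ (∃[ n ] Deg n (polynomial y)) →
        tupleSum (suc m) (λ a → tupleSum p (λ c → [ factors? y a c ])) ≤ fromℕ B
      by-degree (inj₁ y≈0) = ≤-trans (≤-reflexive (sum-zero {q ℕ.^ suc m} _ λ t → sum-zero {q ℕ.^ p} _ λ u →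
        [no] (factors? y (tuple t) (tuple u)) no-factors)) (0≤fromℕ B)
        where
        no-factors : ∀ {a c} → ¬ Factors y a c
        no-factors {a} {c} fac@((a≉0 , c≉0) , _) with product-≉0 {m} {p} {a} {c} a≉0 c≉0
        ... | l , ac≉0 = ac≉0 (K.trans (Factors⇒product fac (toℕ l)) (y≈0 (toℕ l)))
      by-degree (inj₂ (n , D)) = within (cover {polynomial y} D (Below⇒< {f = polynomial y} D (Below-extend y)))
        where
        within : (∃[ gs ] length gs ℕ.≤ B × Covers gs (polynomial y)) →
          tupleSum (suc m) (λ a → tupleSum p (λ c → [ factors? y a c ])) ≤ fromℕ B
        within (gs , len , covers) = begin
          tupleSum (suc m) (λ a → tupleSum p (λ c → [ factors? y a c ]))
            ≤⟨ ∑-mono-≤ {q ℕ.^ suc m} (λ t → cofactors (tuple t) (listed? gs (tuple t))) ⟩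
          tupleSum (suc m) (λ a → [ listed? gs a ])
            ≤⟨ listed-count gs ⟩
          fromℕ (length gs)
            ≤⟨ fromℕ-mono-≤ len ⟩
          fromℕ B ∎
          where
          cofactors : ∀ a (d : Dec (Listed gs a)) → tupleSum p (λ c → [ factors? y a c ]) ≤ [ d ]
          cofactors a (yes _) = count≤1 {q ℕ.^ p} (λ t → factors? y a (tuple t)) unique
            where
            unique : ∀ {t u : Fin (q ℕ.^ p)} → Factors y a (tuple t) → Factors y a (tuple u) → t ≡ u
            unique {t} {u} fac@((a≉0 , _) , _) fac′ = tuple-injective p λ i → K.trans
              (K.reflexive (≡.sym (extend-toℕ (tuple {p} t) i))) (K.trans
              (*-cancelˡ {p = polynomial a} {polynomial (tuple {p} t)} {polynomial (tuple {p} u)} (proj₂ (≉0⇒Deg a≉0))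
                (λ l → K.trans (Factors⇒product fac l) (K.sym (Factors⇒product fac′ l))) (toℕ i))
              (K.reflexive (extend-toℕ (tuple {p} u) i)))
          cofactors a (no a∉gs) = ≤-reflexive (sum-zero {q ℕ.^ p} _ λ t → [no] (factors? y a (tuple t)) λ fac →
            a∉gs (Any.map (λ a≈g i → K.trans (K.reflexive (≡.sym (extend-toℕ a i))) (a≈g (toℕ i)))
              (covers {polynomial a} (polynomial (tuple {p} t) , λ l → K.trans
                (⋆-comm (extend (tuple {p} t)) (extend a) l) (Factors⇒product fac l)))))

module RelationMoments {r r₁ r₂ c ℓ₁ ℓ₂} (R : RealNumbers r r₁ r₂) (K : HeytingField c ℓ₁ ℓ₂)
  {q : ℕ} (enumeration : HasSize K q)
  (ψ : HeytingField.Carrier K → Complex.ℂ R) (ψ-character : Distributions.IsNontrivialCharacter R K enumeration ψ) where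
  open Distributions R K enumeration
  open RealNumbers R hiding (zero)
  open Complex R
  open ComplexProperties R
  open CharacterSums R K enumeration ψ ψ-character
  open OrderedFieldProperties orderedField
  open Counting orderedField
  open FiniteSums commutativeSemiring
  open TupleSums K enumeration commutativeSemiring
  private module ℂᵀ = TupleSums K enumeration +ᶜ-*ᶜ-commutativeSemiring
  open FiniteField K enumeration using (element; tuple; code; tuple-code)
  open Annihilators K enumeration
  open AnnihilatorCounts orderedField K enumeration
  open DivisorCounts orderedField K enumeration
  open DivisorBound polynomialRing euclideanDegree using (Covers)
  private module K = HeytingField K
  open K using () renaming (Carrier to k; _≈_ to _≈ₖ_; 0# to 0ₖ)
  open IntegerCoefficients commutativeRing using (solve; _:=_; _:+_; _:*_; _:-_; :-_; con)
  open ≤-Reasoning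

  Q : Carrier
  Q = fromℕ q

  moment : (k → Carrier) → ℕ → ℕ → ℕ → Carrier
  moment μ N m p = tupleSum N (λ x → prod (μ ∘ x) * annihilatorCount m p (extend x))

  dualTerm : (k → Carrier) → ∀ N {m p} → Vector k m → Vector k p → Carrier
  dualTerm μ N a c = re (ℂΣ.prod (λ l → fourier ψ μ (convolution N a c l)))

  module _ (μ : k → Carrier) (μ-cong : ∀ {x y} → x ≈ₖ y → μ x ≈ μ y) where

    moment-dual : ∀ {N m p} → m ℕ.+ p ℕ.≤ suc N →
      Q ^ p * moment μ N m p ≈ tupleSum m (λ a → tupleSum p (λ c → dualTerm μ N a c))
    moment-dual {N} {m} {p} m+p≤1+N = begin-equality
      Q ^ p * tupleSum N (λ x → prod (μ ∘ x) * annihilatorCount m p (extend x))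
        ≈⟨ *-congˡ (sum-cong-≋ {q ℕ.^ N} λ t → *-distribˡ-sum {q ℕ.^ m} (prod (μ ∘ tuple {N} t)) _) ⟩
      Q ^ p * tupleSum N (λ x → tupleSum m (λ a → prod (μ ∘ x) * [ annihilates? p a (extend x) ]))
        ≈⟨ *-congˡ (∑-comm {q ℕ.^ N} {q ℕ.^ m} _) ⟩
      Q ^ p * tupleSum m (λ a → tupleSum N (λ x → prod (μ ∘ x) * [ annihilates? p a (extend x) ]))
        ≈⟨ *-distribˡ-sum {q ℕ.^ m} (Q ^ p) _ ⟩
      tupleSum m (λ a → Q ^ p * tupleSum N (λ x → prod (μ ∘ x) * [ annihilates? p a (extend x) ]))
        ≈⟨ sum-cong-≋ {q ℕ.^ m} (λ t → dual (tuple t)) ⟩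
      tupleSum m (λ a → tupleSum p (λ c → dualTerm μ N a c)) ∎
      where
      dual : ∀ a → Q ^ p * tupleSum N (λ x → prod (μ ∘ x) * [ annihilates? p a (extend x) ]) ≈
                   tupleSum p (λ c → dualTerm μ N a c)
      dual a = trans (proj₁ (poisson N p μ μ-cong
        (λ x j → recurrence a (extend x) (toℕ j)) (λ c → convolution N a c)
        (λ x c → adjoint m+p≤1+N a c x) (λ x → annihilates? p a (extend x))))
        (re-sum {q ℕ.^ p} _)

    module _ {m p : ℕ} where
      private
        N : ℕ
        N = m ℕ.+ p

        T : Carrier
        T = sum (λ t → μ (element t))

      nonzero? : (a : Vector k (suc m)) (c : Vector k p) → Dec (¬ Zero a × ¬ Zero c)
      nonzero? a c = ¬? (zero? a) ×-dec ¬? (zero? c)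

      error : Carrier
      error = tupleSum (suc m) (λ a → tupleSum p (λ c → [ nonzero? a c ] * dualTerm μ N a c))

      dualTerm-zero : ∀ {a : Vector k (suc m)} {c : Vector k p} → (∀ l → convolution N a c l ≈ₖ 0ₖ) → dualTerm μ N a c ≈ T ^ N
      dualTerm-zero {a} {c} ac≈0 = proj₁ (ℂ′.trans (ℂΣ.prod-cong {N} λ l → fourier-0 μ (ac≈0 l)) (power N))
        where
        power : ∀ n → ℂΣ.prod {n} (λ _ → real T) ≈ᶜ real (T ^ n)
        power zero    = ℂ′.refl
        power (suc n) = ℂ′.trans (ℂ′.*-congˡ {real T} (power n)) (ℂ′.sym (real-* T (T ^ n)))

      dualTerm-split : ∀ a c → dualTerm μ N {suc m} {p} a c ≈
        T ^ N * ([ zero? a ] + [ zero? c ] - [ zero? a ] * [ zero? c ]) + [ nonzero? a c ] * dualTerm μ N a c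
      dualTerm-split a c = by-cases (zero? a) (zero? c)
        where
        d = dualTerm μ N a c
        if-zero : (∀ l → (extend a ⋆ extend c) l ≈ₖ 0ₖ) → d ≈ T ^ N
        if-zero ac≈0 = dualTerm-zero {a} {c} (λ l → ac≈0 (toℕ l))
        by-cases : (z : Dec (Zero a)) (z′ : Dec (Zero c)) →
          d ≈ T ^ N * ([ z ] + [ z′ ] - [ z ] * [ z′ ]) + [ ¬? z ×-dec ¬? z′ ] * d
        by-cases (yes a≈0) (yes _) = trans (if-zero (⋆-zeroˡ (extend c) (Zero⇒extend≈0 a≈0)))
          (solve 2 (λ t d → t := t :* (con (+ 1) :+ con (+ 1) :- con (+ 1) :* con (+ 1)) :+ con (+ 0) :* d) refl (T ^ N) d)
        by-cases (yes a≈0) (no _) = trans (if-zero (⋆-zeroˡ (extend c) (Zero⇒extend≈0 a≈0)))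
          (solve 2 (λ t d → t := t :* (con (+ 1) :+ con (+ 0) :- con (+ 1) :* con (+ 0)) :+ con (+ 0) :* d) refl (T ^ N) d)
        by-cases (no _) (yes c≈0) = trans
          (if-zero λ l → K.trans (⋆-comm (extend a) (extend c) l) (⋆-zeroˡ (extend a) (Zero⇒extend≈0 c≈0) l))
          (solve 2 (λ t d → t := t :* (con (+ 0) :+ con (+ 1) :- con (+ 0) :* con (+ 1)) :+ con (+ 0) :* d) refl (T ^ N) d)
        by-cases (no _) (no _) =
          solve 2 (λ t d → d := t :* (con (+ 0) :+ con (+ 0) :- con (+ 0) :* con (+ 0)) :+ con (+ 1) :* d) refl (T ^ N) d

      count-zero : ∀ n → tupleSum n (λ a → [ zero? a ]) ≈ 1#
      count-zero n = trans (tupleSum-single n (λ a → [ zero? a ]) (λ _ → 0ₖ)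
        (λ {u} {v} u≈v → []-cong (zero? u) (zero? v) (λ u≈0 i → K.trans (K.sym (u≈v i)) (u≈0 i)) (λ v≈0 i → K.trans (u≈v i) (v≈0 i)))
        (λ x x≉0 → [no] (zero? x) x≉0))
        ([yes] (zero? {n} (λ _ → 0ₖ)) (λ _ → K.refl))

      tupleSum-const : ∀ n x → tupleSum n (λ _ → x) ≈ Q ^ n * x
      tupleSum-const n x = trans (sum-const (q ℕ.^ n) x) (*-congʳ (fromℕ-^ q n))

      moment-formula : Q ^ p * moment μ N (suc m) p ≈ T ^ N * (Q ^ suc m + Q ^ p - 1#) + error
      moment-formula = begin-equality
        Q ^ p * moment μ N (suc m) p
          ≈⟨ moment-dual {N} {suc m} {p} ℕ.≤-refl ⟩
        tupleSum (suc m) (λ a → tupleSum p (λ c → dualTerm μ N a c))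
          ≈⟨ sum-cong-≋ {q ℕ.^ suc m} (λ t → row (tuple t)) ⟩
        tupleSum (suc m) (λ a → T ^ N * ([ zero? a ] * (Q ^ p - 1#) + 1#) + tupleSum p (λ c → [ nonzero? a c ] * dualTerm μ N a c))
          ≈⟨ ∑-distrib-+ {q ℕ.^ suc m} _ _ ⟩
        tupleSum (suc m) (λ a → T ^ N * ([ zero? a ] * (Q ^ p - 1#) + 1#)) + error
          ≈⟨ +-congʳ (*-distribˡ-sum {q ℕ.^ suc m} (T ^ N) _) ⟨
        T ^ N * tupleSum (suc m) (λ a → [ zero? a ] * (Q ^ p - 1#) + 1#) + error
          ≈⟨ +-congʳ (*-congˡ (trans (∑-distrib-+ {q ℕ.^ suc m} _ _)
               (+-cong (sym (*-distribʳ-sum {q ℕ.^ suc m} (Q ^ p - 1#) _)) (tupleSum-const (suc m) 1#)))) ⟩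
        T ^ N * (tupleSum (suc m) (λ a → [ zero? a ]) * (Q ^ p - 1#) + Q ^ suc m * 1#) + error
          ≈⟨ +-congʳ (*-congˡ (+-congʳ (*-congʳ (count-zero (suc m))))) ⟩
        T ^ N * (1# * (Q ^ p - 1#) + Q ^ suc m * 1#) + error
          ≈⟨ +-congʳ (*-congˡ (solve 2 (λ a b → con (+ 1) :* (b :- con (+ 1)) :+ a :* con (+ 1) := a :+ b :- con (+ 1)) refl (Q ^ suc m) (Q ^ p))) ⟩
        T ^ N * (Q ^ suc m + Q ^ p - 1#) + error ∎
        where
        row : ∀ a → tupleSum p (λ c → dualTerm μ N a c) ≈
          T ^ N * ([ zero? a ] * (Q ^ p - 1#) + 1#) + tupleSum p (λ c → [ nonzero? a c ] * dualTerm μ N a c)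
        row a = begin-equality
          tupleSum p (λ c → dualTerm μ N a c)
            ≈⟨ sum-cong-≋ {q ℕ.^ p} (λ u → trans (dualTerm-split a (tuple u)) (+-congʳ (*-congˡ
                 (solve 2 (λ z z′ → z :+ z′ :- z :* z′ := z :+ (con (+ 1) :- z) :* z′) refl [ zero? a ] [ zero? (tuple {p} u) ])))) ⟩
          tupleSum p (λ c → T ^ N * (z + (1# - z) * [ zero? c ]) + [ nonzero? a c ] * dualTerm μ N a c)
            ≈⟨ ∑-distrib-+ {q ℕ.^ p} _ _ ⟩
          tupleSum p (λ c → T ^ N * (z + (1# - z) * [ zero? c ])) + rest
            ≈⟨ +-congʳ (*-distribˡ-sum {q ℕ.^ p} (T ^ N) _) ⟨
          T ^ N * tupleSum p (λ c → z + (1# - z) * [ zero? c ]) + rest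
            ≈⟨ +-congʳ (*-congˡ (trans (∑-distrib-+ {q ℕ.^ p} _ _)
                 (+-cong (tupleSum-const p z) (sym (*-distribˡ-sum {q ℕ.^ p} (1# - z) _))))) ⟩
          T ^ N * (Q ^ p * z + (1# - z) * tupleSum p (λ c → [ zero? c ])) + rest
            ≈⟨ +-congʳ (*-congˡ (+-congˡ (*-congˡ (count-zero p)))) ⟩
          T ^ N * (Q ^ p * z + (1# - z) * 1#) + rest
            ≈⟨ +-congʳ (*-congˡ (solve 2 (λ b z → b :* z :+ (con (+ 1) :- z) :* con (+ 1) := z :* (b :- con (+ 1)) :+ con (+ 1)) refl (Q ^ p) z)) ⟩
          T ^ N * (z * (Q ^ p - 1#) + 1#) + rest ∎
          where
          z = [ zero? a ]
          rest = tupleSum p (λ c → [ nonzero? a c ] * dualTerm μ N a c)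

      ∣error∣≤ : ∀ {B} → (∀ {f n} → Deg n f → n ℕ.< N → ∃[ gs ] length gs ℕ.≤ B × Covers gs f) →
        error ≤ fromℕ B * ‖ fourier ψ μ ‖₁ ^ N × - error ≤ fromℕ B * ‖ fourier ψ μ ‖₁ ^ N
      ∣error∣≤ {B} cover =
        ≤-trans (∑-mono-≤ {q ℕ.^ suc m} λ t → ∑-mono-≤ {q ℕ.^ p} λ u →
          *-monoˡ-≤ (0≤[] (nonzero? (tuple t) (tuple u))) (proj₁ (∣re-prod∣≤ {N} _))) total ,
        ≤-trans (≤-reflexive neg) (≤-trans (∑-mono-≤ {q ℕ.^ suc m} λ t → ∑-mono-≤ {q ℕ.^ p} λ u →
          *-monoˡ-≤ (0≤[] (nonzero? (tuple t) (tuple u))) (proj₂ (∣re-prod∣≤ {N} _))) total)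
        where
        W : Vector k N → Carrier
        W y = prod (λ l → ∣ fourier ψ μ (y l) ∣)

        ∣∣-cong : ∀ {x y} → x ≈ₖ y → ∣ fourier ψ μ x ∣ ≈ ∣ fourier ψ μ y ∣
        ∣∣-cong {x} {y} x≈y = square-cancel-≈ 0≤∣ _ ∣ 0≤∣ _ ∣ (trans (√-square (0≤normSquared (fourier ψ μ x)))
          (trans (+-cong (*-cong (proj₁ same) (proj₁ same)) (*-cong (proj₂ same) (proj₂ same)))
            (sym (√-square (0≤normSquared (fourier ψ μ y))))))
          where same = fourier-cong μ x≈y

        0≤W : ∀ y → 0# ≤ W y
        0≤W y = proj₁ (prod-modulus (λ l → fourier ψ μ (y l)))

        neg : - error ≈ tupleSum (suc m) (λ a → tupleSum p (λ c → [ nonzero? a c ] * - dualTerm μ N a c))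
        neg = begin-equality
          - error
            ≈⟨ solve 1 (λ x → :- x := (:- con (+ 1)) :* x) refl error ⟩
          - 1# * error
            ≈⟨ *-distribˡ-sum {q ℕ.^ suc m} (- 1#) _ ⟩
          tupleSum (suc m) (λ a → - 1# * tupleSum p (λ c → [ nonzero? a c ] * dualTerm μ N a c))
            ≈⟨ sum-cong-≋ {q ℕ.^ suc m} (λ t → *-distribˡ-sum {q ℕ.^ p} (- 1#) _) ⟩
          tupleSum (suc m) (λ a → tupleSum p (λ c → - 1# * ([ nonzero? a c ] * dualTerm μ N a c)))
            ≈⟨ sum-cong-≋ {q ℕ.^ suc m} (λ t → sum-cong-≋ {q ℕ.^ p} λ u →
                 solve 2 (λ n d → (:- con (+ 1)) :* (n :* d) := n :* :- d) refl
                   [ nonzero? (tuple t) (tuple u) ] (dualTerm μ N {suc m} {p} (tuple t) (tuple u))) ⟩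
          tupleSum (suc m) (λ a → tupleSum p (λ c → [ nonzero? a c ] * - dualTerm μ N a c)) ∎

        spread : ∀ a c → [ nonzero? a c ] * W (convolution N a c) ≤ tupleSum N (λ y → W y * [ factors? {m} {p} y a c ])
        spread a c = by-cases (nonzero? a c)
          where
          y₀ = code (convolution N a c)
          terms≥0 : ∀ t → 0# ≤ W (tuple t) * [ factors? {m} {p} (tuple t) a c ]
          terms≥0 t = *-nonNeg (0≤W (tuple t)) (0≤[] (factors? {m} {p} (tuple t) a c))
          by-cases : (d : Dec (¬ Zero a × ¬ Zero c)) →
            [ d ] * W (convolution N a c) ≤ tupleSum N (λ y → W y * [ factors? {m} {p} y a c ])
          by-cases (no _) = ≤-trans (≤-reflexive (zeroˡ _)) (sum-nonNeg {q ℕ.^ N} terms≥0)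
          by-cases (yes nz) = begin
            1# * W (convolution N a c)
              ≈⟨ trans (*-identityˡ _) (prod-cong {N} λ l → ∣∣-cong (K.sym (tuple-code (convolution N a c) l))) ⟩
            W (tuple y₀)
              ≈⟨ *-identityʳ _ ⟨
            W (tuple y₀) * 1#
              ≈⟨ *-congˡ ([yes] (factors? {m} {p} (tuple y₀) a c) (nz , λ l → K.sym (tuple-code (convolution N a c) l))) ⟨
            W (tuple y₀) * [ factors? {m} {p} (tuple y₀) a c ]
              ≤⟨ summand≤sum {q ℕ.^ N} terms≥0 y₀ ⟩
            tupleSum N (λ y → W y * [ factors? {m} {p} y a c ]) ∎

        total : tupleSum (suc m) (λ a → tupleSum p (λ c → [ nonzero? a c ] * W (convolution N a c))) ≤
                fromℕ B * ‖ fourier ψ μ ‖₁ ^ N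
        total = begin
          tupleSum (suc m) (λ a → tupleSum p (λ c → [ nonzero? a c ] * W (convolution N a c)))
            ≤⟨ ∑-mono-≤ {q ℕ.^ suc m} (λ t → ∑-mono-≤ {q ℕ.^ p} λ u → spread (tuple t) (tuple u)) ⟩
          tupleSum (suc m) (λ a → tupleSum p (λ c → tupleSum N (λ y → W y * [ factors? y a c ])))
            ≈⟨ sum-cong-≋ {q ℕ.^ suc m} (λ t → ∑-comm {q ℕ.^ p} {q ℕ.^ N} _) ⟩
          tupleSum (suc m) (λ a → tupleSum N (λ y → tupleSum p (λ c → W y * [ factors? y a c ])))
            ≈⟨ ∑-comm {q ℕ.^ suc m} {q ℕ.^ N} _ ⟩
          tupleSum N (λ y → tupleSum (suc m) (λ a → tupleSum p (λ c → W y * [ factors? y a c ])))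
            ≈⟨ sum-cong-≋ {q ℕ.^ N} (λ s → trans (*-distribˡ-sum {q ℕ.^ suc m} (W (tuple s)) _)
                 (sum-cong-≋ {q ℕ.^ suc m} λ t → *-distribˡ-sum {q ℕ.^ p} (W (tuple s)) _)) ⟨
          tupleSum N (λ y → W y * tupleSum (suc m) (λ a → tupleSum p (λ c → [ factors? y a c ])))
            ≤⟨ ∑-mono-≤ {q ℕ.^ N} (λ s → *-monoˡ-≤ (0≤W (tuple s)) (factorisation-count {m} {p} (λ {f} {n} → cover {f} {n}) (tuple s))) ⟩
          tupleSum N (λ y → W y * fromℕ B)
            ≈⟨ *-distribʳ-sum {q ℕ.^ N} (fromℕ B) _ ⟨
          tupleSum N W * fromℕ B
            ≈⟨ *-comm _ _ ⟩
          fromℕ B * tupleSum N W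
            ≈⟨ *-congˡ (trans (tupleSum-prod N (λ _ x → ∣ fourier ψ μ x ∣) (λ _ → ∣∣-cong)) (prod-const N)) ⟩
          fromℕ B * ‖ fourier ψ μ ‖₁ ^ N ∎

  error-uniform : ∀ {m p} → error (λ _ → 1#) (λ _ → refl) {m} {p} ≈ 0#
  error-uniform {m} {p} = sum-zero {q ℕ.^ suc m} _ λ t → sum-zero {q ℕ.^ p} _ λ u →
    vanish (tuple t) (tuple u) (nonzero? (λ _ → 1#) (λ _ → refl) {m} {p} (tuple t) (tuple u))
    where
    vanish : ∀ a c (d : Dec (¬ Zero {suc m} a × ¬ Zero {p} c)) → [ d ] * dualTerm (λ _ → 1#) (m ℕ.+ p) a c ≈ 0#
    vanish a c (no _) = zeroˡ _
    vanish a c (yes (a≉0 , c≉0)) = at (product-≉0 a≉0 c≉0)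
      where
      at : ∃[ l ] ¬ ((extend a ⋆ extend c) (toℕ {m ℕ.+ p} l) ≈ₖ 0ₖ) → 1# * dualTerm (λ _ → 1#) (m ℕ.+ p) a c ≈ 0#
      at (l , ac≉0) = trans (*-identityˡ _) (proj₁ (ℂΣ.prod-zero
        (λ l → fourier ψ (λ _ → 1#) (convolution (m ℕ.+ p) a c l)) l (fourier-constant ac≉0)))

module RecurrenceProbability {r r₁ r₂ c ℓ₁ ℓ₂} (R : RealNumbers r r₁ r₂) (K : HeytingField c ℓ₁ ℓ₂)
  {q : ℕ} (enumeration : HasSize K q)
  (ψ : HeytingField.Carrier K → Complex.ℂ R) (ψ-character : Distributions.IsNontrivialCharacter R K enumeration ψ) where
  open Distributions R K enumeration
  open RealNumbers R hiding (zero)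
  open OrderedFieldProperties orderedField
  open Counting orderedField
  open FiniteSums commutativeSemiring
  open TupleSums K enumeration commutativeSemiring
  open FiniteField K enumeration using (element; tuple; q-nonZero)
  open Annihilators K enumeration
  open LinearRecurrences K enumeration
  open AnnihilatorCounts orderedField K enumeration
  open RelationMoments R K enumeration ψ ψ-character
  private module K = HeytingField K
  open K using () renaming (Carrier to k; _≈_ to _≈ₖ_)
  open IntegerCoefficients commutativeRing using (solve; _:=_; _:+_; _:*_; _:-_; :-_; con)
  open Exp semiring using (^-homo-*; ^-congˡ)
  open ≤-Reasoning

  recurrentMean : (k → Carrier) → ℕ → ℕ → ℕ → Carrier
  recurrentMean μ N m p = tupleSum N (λ x → prod (μ ∘ x) * [ recurrent? m p (extend x) ])

  defect : ℕ → ℕ → Series → Carrier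
  defect m p s = (Q - 1#) * (1# - [ recurrent? m p s ]) +
                 (annihilatorCount (suc m) p s - Q * annihilatorCount m (suc p) s)

  module _ (μ : k → Carrier) (μ-cong : ∀ {x y} → x ≈ₖ y → μ x ≈ μ y) where
    private
      T : Carrier
      T = sum (λ t → μ (element t))

    tupleSum-weight : ∀ N → tupleSum N (λ x → prod (μ ∘ x)) ≈ T ^ N
    tupleSum-weight N = trans (tupleSum-prod N (λ _ → μ) (λ _ → μ-cong)) (prod-const N)

    mean-defect : ∀ N m p → tupleSum N (λ x → prod (μ ∘ x) * defect m p (extend x)) ≈
      (Q - 1#) * (T ^ N - recurrentMean μ N m p) + (moment μ N (suc m) p - Q * moment μ N m (suc p))
    mean-defect N m p = begin-equality
      tupleSum N (λ x → prod (μ ∘ x) * defect m p (extend x))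
        ≈⟨ sum-cong-≋ {q ℕ.^ N} (λ t → solve 5 (λ w Q r M M′ →
             w :* ((Q :- con (+ 1)) :* (con (+ 1) :- r) :+ (M :- Q :* M′)) :=
             ((Q :- con (+ 1)) :* w :+ (con (+ 1) :- Q) :* (w :* r)) :+ (w :* M :+ (:- Q) :* (w :* M′))) refl
             (prod (μ ∘ tuple {N} t)) Q [ recurrent? m p (extend (tuple {N} t)) ]
             (annihilatorCount (suc m) p (extend (tuple {N} t))) (annihilatorCount m (suc p) (extend (tuple {N} t)))) ⟩
      tupleSum N (λ x → ((Q - 1#) * w x + (1# - Q) * (w x * ρ x)) + (w x * M x + - Q * (w x * M′ x)))
        ≈⟨ ∑-distrib-+ {q ℕ.^ N} _ _ ⟩
      tupleSum N (λ x → (Q - 1#) * w x + (1# - Q) * (w x * ρ x)) + tupleSum N (λ x → w x * M x + - Q * (w x * M′ x))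
        ≈⟨ +-cong (∑-distrib-+ {q ℕ.^ N} _ _) (∑-distrib-+ {q ℕ.^ N} _ _) ⟩
      (tupleSum N (λ x → (Q - 1#) * w x) + tupleSum N (λ x → (1# - Q) * (w x * ρ x))) +
      (moment μ N (suc m) p + tupleSum N (λ x → - Q * (w x * M′ x)))
        ≈⟨ +-cong (+-cong (*-distribˡ-sum {q ℕ.^ N} (Q - 1#) _) (*-distribˡ-sum {q ℕ.^ N} (1# - Q) _))
                  (+-congˡ (*-distribˡ-sum {q ℕ.^ N} (- Q) _)) ⟨
      ((Q - 1#) * tupleSum N w + (1# - Q) * recurrentMean μ N m p) + (moment μ N (suc m) p + - Q * moment μ N m (suc p))
        ≈⟨ +-congʳ (+-congʳ (*-congˡ (tupleSum-weight N))) ⟩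
      ((Q - 1#) * T ^ N + (1# - Q) * recurrentMean μ N m p) + (moment μ N (suc m) p + - Q * moment μ N m (suc p))
        ≈⟨ solve 5 (λ Q t r M M′ → ((Q :- con (+ 1)) :* t :+ (con (+ 1) :- Q) :* r) :+ (M :+ (:- Q) :* M′) :=
             (Q :- con (+ 1)) :* (t :- r) :+ (M :- Q :* M′)) refl
             Q (T ^ N) (recurrentMean μ N m p) (moment μ N (suc m) p) (moment μ N m (suc p)) ⟩
      (Q - 1#) * (T ^ N - recurrentMean μ N m p) + (moment μ N (suc m) p - Q * moment μ N m (suc p)) ∎
      where
      w ρ M M′ : Vector k N → Carrier
      w x  = prod (μ ∘ x)
      ρ x  = [ recurrent? m p (extend x) ]
      M x  = annihilatorCount (suc m) p (extend x)
      M′ x = annihilatorCount m (suc p) (extend x)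

    error-difference : ℕ → ℕ → Carrier
    error-difference m p = error μ μ-cong {suc m} {p} - error μ μ-cong {m} {suc p}

    mean-defect-formula : ∀ {N m p} → N ≡ suc m ℕ.+ p →
      Q ^ p * tupleSum N (λ x → prod (μ ∘ x) * defect (suc m) p (extend x)) ≈
      (Q - 1#) * (T ^ N * Q ^ suc m - Q ^ p * recurrentMean μ N (suc m) p) + error-difference m p
    mean-defect-formula {N} {m} {p} N≡ = begin-equality
      Q ^ p * tupleSum N (λ x → prod (μ ∘ x) * defect (suc m) p (extend x))
        ≈⟨ *-congˡ (mean-defect N (suc m) p) ⟩
      Q ^ p * ((Q - 1#) * (T ^ N - E) + (moment μ N (suc (suc m)) p - Q * moment μ N (suc m) (suc p)))
        ≈⟨ solve 6 (λ a Q t E M M′ → a :* ((Q :- con (+ 1)) :* (t :- E) :+ (M :- Q :* M′)) :=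
             (Q :- con (+ 1)) :* (a :* t :- a :* E) :+ (a :* M :- (Q :* a) :* M′)) refl
             (Q ^ p) Q (T ^ N) E (moment μ N (suc (suc m)) p) (moment μ N (suc m) (suc p)) ⟩
      (Q - 1#) * (Q ^ p * T ^ N - Q ^ p * E) + (Q ^ p * moment μ N (suc (suc m)) p - Q ^ suc p * moment μ N (suc m) (suc p))
        ≈⟨ +-congˡ (+-cong (formula (suc m) p N≡) (-‿cong (formula m (suc p) (≡.trans N≡ (≡.sym (ℕ.+-suc m p)))))) ⟩
      (Q - 1#) * (Q ^ p * T ^ N - Q ^ p * E) +
      ((T ^ N * (Q ^ suc (suc m) + Q ^ p - 1#) + error μ μ-cong {suc m} {p}) -
       (T ^ N * (Q ^ suc m + Q ^ suc p - 1#) + error μ μ-cong {m} {suc p}))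
        ≈⟨ solve 7 (λ Q a b t E e e′ →
             (Q :- con (+ 1)) :* (a :* t :- a :* E) :+
             ((t :* (Q :* b :+ a :- con (+ 1)) :+ e) :- (t :* (b :+ Q :* a :- con (+ 1)) :+ e′)) :=
             (Q :- con (+ 1)) :* (t :* b :- a :* E) :+ (e :- e′)) refl
             Q (Q ^ p) (Q ^ suc m) (T ^ N) E (error μ μ-cong {suc m} {p}) (error μ μ-cong {m} {suc p}) ⟩
      (Q - 1#) * (T ^ N * Q ^ suc m - Q ^ p * E) + error-difference m p ∎
      where
      E = recurrentMean μ N (suc m) p
      formula : ∀ m p → N ≡ m ℕ.+ p →
        Q ^ p * moment μ N (suc m) p ≈ T ^ N * (Q ^ suc m + Q ^ p - 1#) + error μ μ-cong {m} {p}
      formula m p ≡.refl = moment-formula μ μ-cong {m} {p}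

  0<Q : 0# < Q
  0<Q = 0<fromℕ q

  1≤Q-1 : 1# ≤ Q - 1#
  1≤Q-1 = begin
    1#                          ≈⟨ solve 0 (con (+ 1) := (con (+ 1) :+ (con (+ 1) :+ con (+ 0))) :- con (+ 1)) refl ⟩
    (1# + (1# + 0#)) - 1#       ≤⟨ +-monoˡ-≤ (- 1#) (fromℕ-mono-≤ 1<q) ⟩
    Q - 1#                      ∎

  private
    one : k → Carrier
    one _ = 1#

  tupleSum-unweighted : ∀ N (f : Vector k N → Carrier) → tupleSum N (λ x → prod (one ∘ x) * f x) ≈ tupleSum N f
  tupleSum-unweighted N f = sum-cong-≋ {q ℕ.^ N} λ t → trans (*-congʳ (trans (prod-const N) (1^n≈1 N))) (*-identityˡ (f (tuple t)))

  sum-defect : ∀ {N m p} → N ≡ suc m ℕ.+ p →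
    Q ^ p * tupleSum N (λ x → defect (suc m) p (extend x)) ≈
    (Q - 1#) * (Q ^ N * Q ^ suc m - Q ^ p * recurrentCount N (suc m) p)
  sum-defect {N} {m} {p} N≡ = begin-equality
    Q ^ p * tupleSum N (λ x → defect (suc m) p (extend x))
      ≈⟨ *-congˡ (tupleSum-unweighted N (λ x → defect (suc m) p (extend x))) ⟨
    Q ^ p * tupleSum N (λ x → prod (one ∘ x) * defect (suc m) p (extend x))
      ≈⟨ mean-defect-formula one (λ _ → refl) {N} {m} {p} N≡ ⟩
    (Q - 1#) * (sum {q} (λ _ → 1#) ^ N * Q ^ suc m - Q ^ p * recurrentMean one N (suc m) p) +
    error-difference one (λ _ → refl) m p
      ≈⟨ +-cong (*-congˡ (+-cong (*-congʳ (^-congˡ N (sum-ones q)))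
           (-‿cong (*-congˡ (tupleSum-unweighted N (λ x → [ recurrent? (suc m) p (extend x) ]))))))
           (trans (+-cong (error-uniform {suc m} {p}) (-‿cong (error-uniform {m} {suc p}))) (-‿inverseʳ 0#)) ⟩
    (Q - 1#) * (Q ^ N * Q ^ suc m - Q ^ p * recurrentCount N (suc m) p) + 0#
      ≈⟨ +-identityʳ _ ⟩
    (Q - 1#) * (Q ^ N * Q ^ suc m - Q ^ p * recurrentCount N (suc m) p) ∎

  sum-defect≤0 : ∀ {N m p} → N ≡ suc m ℕ.+ p → Q ^ (suc m ℕ.+ suc m) ≤ recurrentCount N (suc m) p →
    tupleSum N (λ x → defect (suc m) p (extend x)) ≤ 0#
  sum-defect≤0 {N} {m} {p} N≡ many = *-cancelˡ-≤ (^-pos p 0<Q) (begin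
    Q ^ p * tupleSum N (λ x → defect (suc m) p (extend x))
      ≈⟨ sum-defect {N} {m} {p} N≡ ⟩
    (Q - 1#) * (Q ^ N * Q ^ suc m - Q ^ p * recurrentCount N (suc m) p)
      ≤⟨ *-monoˡ-≤ (<⇒≤ (1≤x⇒0<x 1≤Q-1)) (+-monoʳ-≤ (Q ^ N * Q ^ suc m) (-‿mono-≤
           (*-monoˡ-≤ (^-nonNeg p (<⇒≤ 0<Q)) many))) ⟩
    (Q - 1#) * (Q ^ N * Q ^ suc m - Q ^ p * Q ^ (suc m ℕ.+ suc m))
      ≈⟨ *-congˡ (trans (+-cong (trans (sym (^-homo-* Q N (suc m))) (reflexive (≡.cong (Q ^_) exponents)))
           (-‿cong (sym (^-homo-* Q p (suc m ℕ.+ suc m))))) (-‿inverseʳ _)) ⟩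
    (Q - 1#) * 0#
      ≈⟨ trans (zeroʳ _) (sym (zeroʳ _)) ⟩
    Q ^ p * 0# ∎)
    where
    exponents : N ℕ.+ suc m ≡ p ℕ.+ (suc m ℕ.+ suc m)
    exponents = ≡.trans (≡.cong (ℕ._+ suc m) (≡.trans N≡ (ℕ.+-comm (suc m) p))) (ℕ.+-assoc p (suc m) (suc m))

  -- The defect is non-negative and the uniform count shows that its sum is not positive.
  defect≈0 : ∀ {N m p} → N ≡ suc m ℕ.+ p → Q ^ (suc m ℕ.+ suc m) ≤ recurrentCount N (suc m) p →
    ∀ t → defect (suc m) p (extend (tuple {N} t)) ≈ 0#
  defect≈0 {N} {m} {p} N≡ many t = ≤-antisym
    (≤-trans (summand≤sum {q ℕ.^ N} {λ t → defect (suc m) p (extend (tuple {N} t))} 0≤ t) (sum-defect≤0 {N} {m} {p} N≡ many))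
    (0≤ t)
    where
    0≤ : ∀ t → 0# ≤ defect (suc m) p (extend (tuple {N} t))
    0≤ t = 0≤defect {suc m} {p} {extend (tuple {N} t)}

module LimitingProbability {r r₁ r₂ c ℓ₁ ℓ₂} (R : RealNumbers r r₁ r₂) (K : HeytingField c ℓ₁ ℓ₂)
  {q : ℕ} (enumeration : HasSize K q)
  (ψ : HeytingField.Carrier K → Complex.ℂ R) (ψ-character : Distributions.IsNontrivialCharacter R K enumeration ψ)
  (μ : HeytingField.Carrier K → RealNumbers.Carrier R) (μ-distribution : Distributions.IsDistribution R K enumeration μ)
  (‖μ̂‖<√q : RealNumbers._<_ R (Distributions.‖_‖₁ R K enumeration (Distributions.fourier R K enumeration ψ μ))
                                (RealNumbers.√ R (RealNumbers.fromℕ R q))) where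
  open Distributions R K enumeration
  open RealNumbers R hiding (zero)
  open ComplexProperties R using (0≤normSquared)
  open Convergence R
  open OrderedFieldProperties orderedField
  open Counting orderedField
  open FiniteSums commutativeSemiring
  open TupleSums K enumeration commutativeSemiring
  open FiniteField K enumeration using (element; tuple; q-nonZero)
  open Annihilators K enumeration
  open LinearRecurrences K enumeration
  open AnnihilatorCounts orderedField K enumeration
  open RelationMoments R K enumeration ψ ψ-character
  open RecurrenceProbability R K enumeration ψ ψ-character
  open DivisorBound polynomialRing euclideanDegree using (Covers; Bounded; bounded; divisor-bound)
  open IntegerCoefficients commutativeRing using (solve; _:=_; _:+_; _:*_; _:-_; :-_; con)
  open Exp semiring using (^-homo-*; ^-congˡ)
  open IsDistribution μ-distribution using (total) renaming (cong to μ-cong)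
  open ≤-Reasoning

  0≤‖μ̂‖ : 0# ≤ ‖ fourier ψ μ ‖₁
  0≤‖μ̂‖ = sum-nonNeg {q} (λ t → √-nonNeg (0≤normSquared (fourier ψ μ (element t))))

  √Q² : √ Q * √ Q ≈ Q
  √Q² = √-square (<⇒≤ 0<Q)

  1≤Q : 1# ≤ Q
  1≤Q = begin
    1#            ≈⟨ +-identityʳ 1# ⟨
    fromℕ 1       ≤⟨ fromℕ-mono-≤ (ℕ.<⇒≤ 1<q) ⟩
    Q             ∎

  1≤√Q : 1# ≤ √ Q
  1≤√Q = square-cancel-≤ (√-nonNeg (<⇒≤ 0<Q)) (begin
    1# * 1#       ≈⟨ *-identityˡ 1# ⟩
    1#            ≤⟨ 1≤Q ⟩
    Q             ≈⟨ √Q² ⟨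
    √ Q * √ Q     ∎)

  open GeometricDecay R ‖ fourier ψ μ ‖₁ (√ Q) 0≤‖μ̂‖ 1≤√Q ‖μ̂‖<√q

  ErrorBound : ℕ → Set _
  ErrorBound M = ∀ {m p} → m ℕ.≤ p →
    error μ μ-cong {m} {p} ≤ fromℕ M * (Q ^ p * σ ^ m) × - error μ μ-cong {m} {p} ≤ fromℕ M * (Q ^ p * σ ^ m)

  errorBound : ∃[ M ] ErrorBound M
  errorBound = with-halving halving
    where
    with-halving : (∃[ h ] σ ^ suc h * fromℕ 2 ≤ 1#) → ∃[ M ] ErrorBound M
    with-halving (h , half) = with-divisors (divisor-bound (2 ℕ.* suc h))
      where
      with-divisors : (∃[ M ] ∀ {n f} → Deg n f → Bounded (2 ℕ.* suc h) M n f) → ∃[ M ] ErrorBound M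
      with-divisors (M , bound) = M , λ {m} {p} m≤p →
        ≤-trans (proj₁ (bounds m p)) (final m≤p) , ≤-trans (proj₂ (bounds m p)) (final m≤p)
        where
        J : ℕ → ℕ
        J N = N ℕ./ (2 ℕ.* suc h)

        cover : ∀ N {f n} → Deg n f → n ℕ.< N → ∃[ gs ] length gs ℕ.≤ M ℕ.* 2 ℕ.^ J N × Covers gs f
        cover N {f} {n} D n<N = covered (bound {n} {f} D)
          where
          covered : Bounded (2 ℕ.* suc h) M n f → ∃[ gs ] length gs ℕ.≤ M ℕ.* 2 ℕ.^ J N × Covers gs f
          covered (bounded gs j Lj≤n len covers) = gs ,
            ℕ.≤-trans len (ℕ.*-monoʳ-≤ M (ℕ.^-monoʳ-≤ 2 j≤J)) , λ {a} → covers {a}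
            where
            j≤J : j ℕ.≤ J N
            j≤J = ℕ.≤-trans (ℕ.≤-reflexive (≡.sym (ℕ.m*n/n≡m j (2 ℕ.* suc h))))
              (ℕ./-monoˡ-≤ (2 ℕ.* suc h) (ℕ.≤-trans (ℕ.≤-reflexive (ℕ.*-comm j (2 ℕ.* suc h))) (ℕ.≤-trans Lj≤n (ℕ.<⇒≤ n<N))))

        bounds : ∀ m p → error μ μ-cong {m} {p} ≤ fromℕ (M ℕ.* 2 ℕ.^ J (m ℕ.+ p)) * ‖ fourier ψ μ ‖₁ ^ (m ℕ.+ p) ×
                         - error μ μ-cong {m} {p} ≤ fromℕ (M ℕ.* 2 ℕ.^ J (m ℕ.+ p)) * ‖ fourier ψ μ ‖₁ ^ (m ℕ.+ p)
        bounds m p = ∣error∣≤ μ μ-cong {m} {p} {M ℕ.* 2 ℕ.^ J (m ℕ.+ p)} (λ {f} {n} → cover (m ℕ.+ p) {f} {n})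

        final : ∀ {m p} → m ℕ.≤ p →
          fromℕ (M ℕ.* 2 ℕ.^ J (m ℕ.+ p)) * ‖ fourier ψ μ ‖₁ ^ (m ℕ.+ p) ≤ fromℕ M * (Q ^ p * σ ^ m)
        final {m} {p} m≤p = ≤-trans (2^J*A^N≤ h half m≤p M)
          (≤-reflexive (*-congˡ (*-congʳ (^-congˡ p √Q²))))

  T≈1 : ∀ N → sum (λ t → μ (element t)) ^ N ≈ 1#
  T≈1 N = trans (^-congˡ N total) (1^n≈1 N)

  mean-formula : ∀ {N m p} → N ≡ suc m ℕ.+ p → Q ^ (suc m ℕ.+ suc m) ≤ recurrentCount N (suc m) p →
    (Q - 1#) * (Q ^ p * recurrentMean μ N (suc m) p - Q ^ suc m) ≈ error-difference μ μ-cong m p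
  mean-formula {N} {m} {p} N≡ many = begin-equality
    (Q - 1#) * (Q ^ p * E - Q ^ suc m)
      ≈⟨ solve 4 (λ Q a b e → (Q :- con (+ 1)) :* (a :- b) :=
           e :- ((Q :- con (+ 1)) :* (con (+ 1) :* b :- a) :+ e)) refl Q (Q ^ p * E) (Q ^ suc m) Δ ⟩
    Δ - ((Q - 1#) * (1# * Q ^ suc m - Q ^ p * E) + Δ)
      ≈⟨ +-congˡ (-‿cong (begin-equality
           (Q - 1#) * (1# * Q ^ suc m - Q ^ p * E) + Δ
             ≈⟨ +-congʳ (*-congˡ (+-congʳ (*-congʳ (T≈1 N)))) ⟨
           (Q - 1#) * (sum (λ t → μ (element t)) ^ N * Q ^ suc m - Q ^ p * E) + Δ
             ≈⟨ mean-defect-formula μ μ-cong {N} {m} {p} N≡ ⟨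
           Q ^ p * tupleSum N (λ x → prod (μ ∘ x) * defect (suc m) p (extend x))
             ≈⟨ *-congˡ (sum-zero {q ℕ.^ N} _ λ t → trans (*-congˡ (defect≈0 {N} {m} {p} N≡ many t)) (zeroʳ (prod (μ ∘ tuple {N} t)))) ⟩
           Q ^ p * 0#
             ≈⟨ zeroʳ _ ⟩
           0# ∎)) ⟩
    Δ - 0#
      ≈⟨ solve 1 (λ x → x :- con (+ 0) := x) refl Δ ⟩
    Δ ∎
    where
    E = recurrentMean μ N (suc m) p
    Δ = error-difference μ μ-cong m p

  error-difference-bound : ∀ {M} → ErrorBound M → ∀ {m p} → suc m ℕ.≤ p →
    error-difference μ μ-cong m p ≤ Q ^ p * ((1# + Q) * fromℕ M * σ ^ m) ×
    - error-difference μ μ-cong m p ≤ Q ^ p * ((1# + Q) * fromℕ M * σ ^ m)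
  error-difference-bound {M} bound {m} {p} m<p = both-signs (bound m<p) (bound (ℕ.m≤n⇒m≤1+n (ℕ.<⇒≤ m<p)))
    where
    e e′ b : Carrier
    e  = error μ μ-cong {suc m} {p}
    e′ = error μ μ-cong {m} {suc p}
    b  = fromℕ M * (Q ^ p * σ ^ m)
    smaller : fromℕ M * (Q ^ p * σ ^ suc m) ≤ b
    smaller = *-monoˡ-≤ (0≤fromℕ M) (*-monoˡ-≤ (^-nonNeg p (<⇒≤ 0<Q)) (^-antimonoʳ-≤ 0≤σ (<⇒≤ σ<1) (ℕ.n≤1+n m)))
    total-bound : ∀ {x y} → x ≤ fromℕ M * (Q ^ p * σ ^ suc m) → y ≤ fromℕ M * (Q ^ suc p * σ ^ m) →
                  x + y ≤ Q ^ p * ((1# + Q) * fromℕ M * σ ^ m)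
    total-bound {x} {y} x≤ y≤ = begin
      x + y                                             ≤⟨ +-mono-≤ (≤-trans x≤ smaller) y≤ ⟩
      b + fromℕ M * (Q ^ suc p * σ ^ m)                 ≈⟨ solve 4 (λ M a s Q → M :* (a :* s) :+ M :* ((Q :* a) :* s) :=
                                                             a :* ((con (+ 1) :+ Q) :* M :* s)) refl (fromℕ M) (Q ^ p) (σ ^ m) Q ⟩
      Q ^ p * ((1# + Q) * fromℕ M * σ ^ m)              ∎
    both-signs : e ≤ fromℕ M * (Q ^ p * σ ^ suc m) × - e ≤ fromℕ M * (Q ^ p * σ ^ suc m) →
              e′ ≤ fromℕ M * (Q ^ suc p * σ ^ m) × - e′ ≤ fromℕ M * (Q ^ suc p * σ ^ m) →
              e - e′ ≤ Q ^ p * ((1# + Q) * fromℕ M * σ ^ m) × - (e - e′) ≤ Q ^ p * ((1# + Q) * fromℕ M * σ ^ m)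
    both-signs (e≤ , -e≤) (e′≤ , -e′≤) = total-bound e≤ -e′≤ ,
      ≤-trans (≤-reflexive (solve 2 (λ e e′ → :- (e :- e′) := :- e :+ e′) refl e e′)) (total-bound -e≤ e′≤)

  [Q-1]x≤b⇒x≤b : ∀ {x b} → 0# ≤ b → (Q - 1#) * x ≤ b → x ≤ b
  [Q-1]x≤b⇒x≤b {x} {b} 0≤b [Q-1]x≤b b<x = [Q-1]x≤b (<-≤-trans b<x (begin
    x                ≈⟨ *-identityˡ x ⟨
    1# * x           ≤⟨ *-monoʳ-≤ (<⇒≤ (≤-<-trans 0≤b b<x)) 1≤Q-1 ⟩
    (Q - 1#) * x     ∎))

  mean-near-limit : ∀ {M} → ErrorBound M → ∀ e {N m p} → p ≡ e ℕ.+ suc m → N ≡ e ℕ.+ (suc m ℕ.+ suc m) →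
    recurrentMean μ N (suc m) p - 1/fromℕ q ^ e ≤ (1# + Q) * fromℕ M * σ ^ m ×
    1/fromℕ q ^ e - recurrentMean μ N (suc m) p ≤ (1# + Q) * fromℕ M * σ ^ m
  mean-near-limit {M} bound e {N} {m} {p} ≡.refl ≡.refl =
    near (proj₁ Δ-bound) (begin-equality
      Q ^ p * ((Q - 1#) * (E - l))                ≈⟨ scaled ⟩
      (Q - 1#) * (Q ^ p * E - Q ^ suc m)          ≈⟨ mean-formula {N} {m} {p} N≡ (recurrentCount-≥ (suc m) e) ⟩
      Δ                                           ∎) ,
    near (proj₂ Δ-bound) (begin-equality
      Q ^ p * ((Q - 1#) * (l - E))                ≈⟨ solve 4 (λ a Q E l → a :* ((Q :- con (+ 1)) :* (l :- E)) :=
                                                      :- (a :* ((Q :- con (+ 1)) :* (E :- l)))) refl (Q ^ p) Q E l ⟩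
      - (Q ^ p * ((Q - 1#) * (E - l)))            ≈⟨ -‿cong scaled ⟩
      - ((Q - 1#) * (Q ^ p * E - Q ^ suc m))      ≈⟨ -‿cong (mean-formula {N} {m} {p} N≡ (recurrentCount-≥ (suc m) e)) ⟩
      - Δ                                         ∎)
    where
    E l Δ b : Carrier
    E = recurrentMean μ N (suc m) p
    l = 1/fromℕ q ^ e
    Δ = error-difference μ μ-cong m p
    b = (1# + Q) * fromℕ M * σ ^ m
    N≡ : N ≡ suc m ℕ.+ p
    N≡ = ≡.trans (≡.sym (ℕ.+-assoc e (suc m) (suc m))) (ℕ.+-comm (e ℕ.+ suc m) (suc m))
    Δ-bound = error-difference-bound {M} bound {m} {p} (ℕ.m≤n+m (suc m) e)
    0≤b : 0# ≤ b
    0≤b = *-nonNeg (*-nonNeg (≤-trans (<⇒≤ 0<1) (≤-trans (≤-reflexive (sym (+-identityʳ 1#))) (+-monoʳ-≤ 1# (<⇒≤ 0<Q))))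
            (0≤fromℕ M)) (^-nonNeg m 0≤σ)
    Q^p*l : Q ^ p * l ≈ Q ^ suc m
    Q^p*l = begin-equality
      Q ^ (e ℕ.+ suc m) * 1/fromℕ q ^ e             ≈⟨ *-congʳ (^-homo-* Q e (suc m)) ⟩
      Q ^ e * Q ^ suc m * 1/fromℕ q ^ e             ≈⟨ solve 3 (λ a b c → a :* b :* c := (c :* a) :* b) refl (Q ^ e) (Q ^ suc m) (1/fromℕ q ^ e) ⟩
      (1/fromℕ q ^ e * Q ^ e) * Q ^ suc m           ≈⟨ *-congʳ (trans (sym (^-distrib-* e (1/fromℕ q) Q))
                                                         (trans (^-congˡ e (1/fromℕ-inverse q)) (1^n≈1 e))) ⟩
      1# * Q ^ suc m                                ≈⟨ *-identityˡ _ ⟩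
      Q ^ suc m                                     ∎
    scaled : Q ^ p * ((Q - 1#) * (E - l)) ≈ (Q - 1#) * (Q ^ p * E - Q ^ suc m)
    scaled = trans (solve 4 (λ a Q E l → a :* ((Q :- con (+ 1)) :* (E :- l)) := (Q :- con (+ 1)) :* (a :* E :- a :* l)) refl (Q ^ p) Q E l)
      (*-congˡ (+-congˡ (-‿cong Q^p*l)))
    near : ∀ {x δ} → δ ≤ Q ^ p * b → Q ^ p * ((Q - 1#) * x) ≈ δ → x ≤ b
    near δ≤ eq = [Q-1]x≤b⇒x≤b 0≤b (*-cancelˡ-≤ (^-pos p 0<Q) (≤-trans (≤-reflexive eq) δ≤))

  mean⟶ : ∀ e (s : ℕ → Carrier) →
    (∀ m → ∃₂ λ N p → p ≡ e ℕ.+ suc m × N ≡ e ℕ.+ (suc m ℕ.+ suc m) × s (suc m) ≈ recurrentMean μ N (suc m) p) →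
    s ⟶ 1/fromℕ q ^ e
  mean⟶ e s s≈ = converge errorBound
    where
    l = 1/fromℕ q ^ e
    converge : (∃[ M ] ErrorBound M) → s ⟶ l
    converge (M , bound) = geometric-error⇒⟶ {s} {l} {σ} {(1# + Q) * fromℕ M} 0≤σ σ<1
      (*-nonNeg (≤-trans (<⇒≤ 0<1) (≤-trans (≤-reflexive (sym (+-identityʳ 1#))) (+-monoʳ-≤ 1# (<⇒≤ 0<Q)))) (0≤fromℕ M))
      (λ m → close m (s≈ m))
      where
      close : ∀ m → (∃₂ λ N p → p ≡ e ℕ.+ suc m × N ≡ e ℕ.+ (suc m ℕ.+ suc m) × s (suc m) ≈ recurrentMean μ N (suc m) p) →
        s (suc m) - l ≤ (1# + Q) * fromℕ M * σ ^ m × l - s (suc m) ≤ (1# + Q) * fromℕ M * σ ^ m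
      close m (N , p , p≡ , N≡ , s≈E) =
        ≤-trans (≤-reflexive (+-congʳ s≈E)) (proj₁ (mean-near-limit {M} bound e {N} {m} {p} p≡ N≡)) ,
        ≤-trans (≤-reflexive (+-congˡ (-‿cong s≈E))) (proj₂ (mean-near-limit {M} bound e {N} {m} {p} p≡ N≡))

open import Data.Nat.Base using (_+_; _*_)

-- Hankel matrices

module HankelRecurrences {c ℓ₁ ℓ₂} (K : HeytingField c ℓ₁ ℓ₂) {q : ℕ} (enumeration : HasSize K q) where
  open HeytingField K hiding (zero; _+_; _*_) renaming (Carrier to k)
  open HeytingField K using () renaming (_+_ to _+ₖ_; _*_ to _*ₖ_)
  open FiniteField K enumeration
  open Annihilators K enumeration
  open LinearRecurrences K enumeration
  open TupleSums K enumeration (CommutativeRing.commutativeSemiring K-ring) using (tuple-injective)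
  open IntegerCoefficients K-ring using (solve; _:=_; _:+_; _:*_; _:-_; :-_; con)
  open SetoidReasoning setoid

  extend-at : ∀ {n} (x : Vector k n) i {l} → toℕ i ≡ l → extend x l ≡ x i
  extend-at x i ≡.refl = extend-toℕ x i

  module _ {m n : ℕ} (2m≤1+n : 2 * m ℕ.≤ suc n) (x : Vector k (suc n)) where

    extend-index+ : ∀ i j → extend x (toℕ i + toℕ j) ≡ x (index+ m n 2m≤1+n i j)
    extend-index+ i j = extend-at x (index+ m n 2m≤1+n i j) (Fin.toℕ-fromℕ< (s≤s (ℕ.≤-trans
      (ℕ.+-mono-≤ (Fin.toℕ≤pred[n] i) (Fin.toℕ≤pred[n] j))
      (ℕ.≤-reflexive (ℕ.m+[n∸m]≡n (2m≤1+n⇒m≤n m n 2m≤1+n))))))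

    recurrence-index+ : ∀ a j → recurrence a (extend x) (toℕ j) ≈ ∑ (λ i → a i *ₖ x (index+ m n 2m≤1+n i j))
    recurrence-index+ a j = KΣ.sum-cong-≋ {suc m} λ i → *-congˡ {a i} (reflexive (extend-index+ i j))

    H⇒recurrent : H m n 2m≤1+n x → Recurrent m (suc (n ℕ.∸ m)) (extend x)
    H⇒recurrent (a , a≉0 , ann) = annihilator⇒recurrent {s = extend x} a≉0 λ j → trans (recurrence-index+ a j) (ann j)

    recurrent⇒H : Recurrent m (suc (n ℕ.∸ m)) (extend x) → H m n 2m≤1+n x
    recurrent⇒H rec = let a , a≉0 , ann = recurrent⇒annihilator {s = extend x} rec in
      a , a≉0 , λ j → trans (sym (recurrence-index+ a j)) (ann j)

  injective⇒surjective : ∀ {n} (f : Fin n → Fin n) → (∀ {i j} → f i ≡ f j → i ≡ j) → ∀ j → ∃[ i ] f i ≡ j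
  injective⇒surjective {suc n} f f-injective j with Fin.any? (λ i → f i Fin.≟ j)
  ... | yes found = found
  ... | no missed = contradiction (Fin.injective⇒≤ {f = λ i → punchOut (missed′ i)} λ {i} {i′} eq →
          f-injective (Fin.punchOut-injective (missed′ i) (missed′ i′) eq)) ℕ.1+n≰n
    where
    missed′ : ∀ i → ¬ (j ≡ f i)
    missed′ i j≡fi = missed (i , ≡.sym j≡fi)

  sum-1ᴹˡ : ∀ {n} (f : Vector k n) j → ∑ (λ i → f i *ₖ 1ᴹ i j) ≈ f j
  sum-1ᴹˡ f j = trans (KΣ.sum-single _ j λ i i≢j → trans (*-congˡ (KΣ.[no] (i Fin.≟ j) i≢j)) (zeroʳ _))
    (trans (*-congˡ (KΣ.[yes] (j Fin.≟ j) ≡.refl)) (*-identityʳ _))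

  sum-1ᴹʳ : ∀ {n} (f : Vector k n) i → ∑ (λ j → 1ᴹ i j *ₖ f j) ≈ f i
  sum-1ᴹʳ f i = trans (KΣ.sum-single _ i λ j j≢i → trans (*-congʳ (KΣ.[no] (i Fin.≟ j) (j≢i ∘ ≡.sym))) (zeroˡ _))
    (trans (*-congʳ (KΣ.[yes] (i Fin.≟ i) ≡.refl)) (*-identityˡ _))

  sum-assoc : ∀ {n} (a : Vector k n) (B C : Matrix n) j →
    ∑ (λ i → ∑ (λ l → a l *ₖ B l i) *ₖ C i j) ≈ ∑ (λ l → a l *ₖ (B *ᴹ C) l j)
  sum-assoc {n} a B C j = begin
    ∑ (λ i → ∑ (λ l → a l *ₖ B l i) *ₖ C i j)
      ≈⟨ KΣ.sum-cong-≋ {n} (λ i → KΣ.*-distribʳ-sum {n} (C i j) (λ l → a l *ₖ B l i)) ⟩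
    ∑ (λ i → ∑ (λ l → a l *ₖ B l i *ₖ C i j))
      ≈⟨ KΣ.∑-comm {n} {n} (λ i l → a l *ₖ B l i *ₖ C i j) ⟩
    ∑ (λ l → ∑ (λ i → a l *ₖ B l i *ₖ C i j))
      ≈⟨ KΣ.sum-cong-≋ {n} (λ l → trans (KΣ.sum-cong-≋ {n} λ i → *-assoc (a l) (B l i) (C i j))
           (sym (KΣ.*-distribˡ-sum {n} (a l) (λ i → B l i *ₖ C i j)))) ⟩
    ∑ (λ l → a l *ₖ (B *ᴹ C) l j) ∎

  annihilated⇒singular : ∀ {n} {A : Matrix n} a → ¬ Zero a → (∀ j → ∑ (λ i → a i *ₖ A i j) ≈ 0#) → Singular A
  annihilated⇒singular {n} {A} a a≉0 aA≈0 (B , _ , AB≈1) = a≉0 λ j → begin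
    a j                                               ≈⟨ sum-1ᴹˡ a j ⟨
    ∑ (λ l → a l *ₖ 1ᴹ l j)                           ≈⟨ KΣ.sum-cong-≋ {n} (λ l → *-congˡ {a l} (AB≈1 l j)) ⟨
    ∑ (λ l → a l *ₖ (A *ᴹ B) l j)                     ≈⟨ sum-assoc a A B j ⟨
    ∑ (λ i → ∑ (λ l → a l *ₖ A l i) *ₖ B i j)         ≈⟨ KΣ.sum-zero {n} _ (λ i → trans (*-congʳ {B i j} (aA≈0 i)) (zeroˡ (B i j))) ⟩
    0#                                                ∎

  module _ {m : ℕ} (x : Vector k (suc (2 * m))) where
    private
      A : Matrix (suc m)
      A = hankel m x

    extend-hankel : ∀ i j → extend x (toℕ i + toℕ j) ≡ A i j
    extend-hankel i j = extend-at x _ (Fin.toℕ-fromℕ< (s≤s (ℕ.+-mono-≤ (Fin.toℕ≤pred[n] i)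
      (ℕ.≤-trans (Fin.toℕ≤pred[n] j) (ℕ.m≤m+n m 0)))))

    recurrence-hankel : ∀ a j → recurrence a (extend x) (toℕ j) ≈ ∑ (λ i → a i *ₖ A i j)
    recurrence-hankel a j = KΣ.sum-cong-≋ {suc m} λ i → *-congˡ {a i} (reflexive (extend-hankel i j))

    recurrent⇒singular : Recurrent m (suc m) (extend x) → Singular A
    recurrent⇒singular rec = from-annihilator (recurrent⇒annihilator {s = extend x} rec)
      where
      from-annihilator : ∃[ a ] (¬ Zero {suc m} a × Annihilates (suc m) a (extend x)) → Singular A
      from-annihilator (a , a≉0 , ann) = annihilated⇒singular {A = A} a a≉0 λ j → trans (sym (recurrence-hankel a j)) (ann j)

    module _ (¬recurrent : ¬ Recurrent m (suc m) (extend x)) where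

      annihilator⇒zero : ∀ a → (∀ j → ∑ (λ i → a i *ₖ A i j) ≈ 0#) → Zero a
      annihilator⇒zero a ann with zero? a
      ... | yes a≈0 = a≈0
      ... | no a≉0 = contradiction (annihilator⇒recurrent {s = extend x} a≉0 λ j → trans (recurrence-hankel a j) (ann j)) ¬recurrent

      rows-injective : ∀ a b → (∀ j → ∑ (λ i → a i *ₖ A i j) ≈ ∑ (λ i → b i *ₖ A i j)) → ∀ i → a i ≈ b i
      rows-injective a b same i = x-y≈0⇒x≈y (trans
        (solve 2 (λ x y → x :- y := x :+ (:- con (+ 1)) :* y) refl (a i) (b i))
        (annihilator⇒zero (λ i → a i +ₖ (- 1#) *ₖ b i) (λ j → begin
          ∑ (λ i → (a i +ₖ (- 1#) *ₖ b i) *ₖ A i j)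
            ≈⟨ recurrence-hankel (λ i → a i +ₖ (- 1#) *ₖ b i) j ⟨
          recurrence (λ i → a i +ₖ (- 1#) *ₖ b i) (extend x) (toℕ j)
            ≈⟨ recurrence-linear a b (- 1#) (extend x) (toℕ j) ⟩
          recurrence a (extend x) (toℕ j) +ₖ (- 1#) *ₖ recurrence b (extend x) (toℕ j)
            ≈⟨ +-cong (trans (recurrence-hankel a j) (same j)) (*-congˡ (recurrence-hankel b j)) ⟩
          ∑ (λ i → b i *ₖ A i j) +ₖ (- 1#) *ₖ ∑ (λ i → b i *ₖ A i j)
            ≈⟨ solve 1 (λ x → x :+ (:- con (+ 1)) :* x := con (+ 0)) refl _ ⟩
          0# ∎) i))

      _·A : Vector k (suc m) → Vector k (suc m)
      (a ·A) j = ∑ (λ i → a i *ₖ A i j)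

      image : Fin (q ℕ.^ suc m) → Fin (q ℕ.^ suc m)
      image t = code (tuple {suc m} t ·A)

      image-injective : ∀ {t u} → image t ≡ image u → t ≡ u
      image-injective {t} {u} eq = tuple-injective (suc m) (rows-injective (tuple t) (tuple u) λ j →
        trans (sym (tuple-code (tuple {suc m} t ·A) j))
          (trans (reflexive (≡.cong (λ s → tuple {suc m} s j) eq)) (tuple-code (tuple {suc m} u ·A) j)))

      preimage : ∀ (y : Vector k (suc m)) → ∃[ b ] ∀ j → ∑ (λ i → b i *ₖ A i j) ≈ y j
      preimage y = from-code (injective⇒surjective image image-injective (code y))
        where
        from-code : ∃[ t ] image t ≡ code y → ∃[ b ] ∀ j → ∑ (λ i → b i *ₖ A i j) ≈ y j
        from-code (t , eq) = tuple {suc m} t , λ j →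
          trans (sym (tuple-code (tuple {suc m} t ·A) j))
            (trans (reflexive (≡.cong (λ s → tuple {suc m} s j) eq)) (tuple-code y j))

      ¬recurrent⇒¬singular : ¬ Singular A
      ¬recurrent⇒¬singular singular = singular (B , BA≈1 , AB≈1)
        where
        B : Matrix (suc m)
        B i = proj₁ (preimage (1ᴹ i))
        BA≈1 : B *ᴹ A ≈ᴹ 1ᴹ
        BA≈1 i = proj₂ (preimage (1ᴹ i))
        AB≈1 : A *ᴹ B ≈ᴹ 1ᴹ
        AB≈1 i = rows-injective ((A *ᴹ B) i) (1ᴹ i) λ j → begin
          ∑ (λ l → (A *ᴹ B) i l *ₖ A l j)      ≈⟨ sum-assoc (A i) B A j ⟩
          ∑ (λ l → A i l *ₖ (B *ᴹ A) l j)      ≈⟨ KΣ.sum-cong-≋ {suc m} (λ l → *-congˡ {A i l} (BA≈1 l j)) ⟩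
          ∑ (λ l → A i l *ₖ 1ᴹ l j)            ≈⟨ sum-1ᴹˡ (A i) j ⟩
          A i j                                ≈⟨ sum-1ᴹʳ (λ l → A l j) i ⟨
          ∑ (λ l → 1ᴹ i l *ₖ A l j)            ∎

    singular⇒recurrent : Singular A → Recurrent m (suc m) (extend x)
    singular⇒recurrent singular with recurrent? m (suc m) (extend x)
    ... | yes rec = rec
    ... | no ¬rec = contradiction singular (¬recurrent⇒¬singular ¬rec)

mainTheorem3 :
  ∀ {r r₁ r₂ c ℓ₁ ℓ₂ : Level}
  (R : RealNumbers r r₁ r₂) (K : HeytingField c ℓ₁ ℓ₂)
  (q : ℕ) (enumeration : HasSize K q) →
  let module ℝ = RealNumbers R
      module K = HeytingField K
      open FiniteField K enumeration
      open Distributions R K enumeration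
  in
  (ψ₀ : K.Carrier → Complex.ℂ R) → IsNontrivialCharacter ψ₀ →
  (α : ℕ) (μ : K.Carrier → ℝ.Carrier) → IsDistribution μ →
  ‖ fourier ψ₀ μ ‖₁ ℝ.< ℝ.√ (ℝ.fromℕ q) →
  ((λ m → Pr μ (H? m (2 * m + α) (2m≤1+[2m+α] m α))) ℝ.⟶ ((ℝ.1/fromℕ q) ℝ.^ suc α)) ×
  ((λ m → Pr μ (λ x → singular? (hankel m x))) ℝ.⟶ (ℝ.1/fromℕ q))
mainTheorem3 {r} {r₁} {r₂} {c} {ℓ₁} {ℓ₂} R K q enumeration ψ₀ ψ₀-character α μ μ-distribution ‖μ̂‖<√q =
  mean⟶ (suc α) PrH (λ m → suc (2 * suc m + α) , suc (2 * suc m + α ℕ.∸ suc m) , p≡ m , N≡ m ,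
    Pr≈recurrentMean (H? (suc m) (2 * suc m + α) (2m≤1+[2m+α] (suc m) α))
      (λ x → H⇒recurrent (2m≤1+[2m+α] (suc m) α) x) (λ x → recurrent⇒H (2m≤1+[2m+α] (suc m) α) x)) ,
  ⟶-cong (ℝ.*-identityʳ _) (mean⟶ 1 PrS (λ m → suc (2 * suc m) , suc (suc m) , ≡.refl , N≡′ m ,
    Pr≈recurrentMean (λ x → singular? (hankel (suc m) x))
      (λ x → singular⇒recurrent x) (λ x → recurrent⇒singular x)))
  where
  module ℝ = RealNumbers R
  open FiniteField K enumeration
  open Distributions R K enumeration
  open Counting ℝ.orderedField
  open FiniteSums commutativeSemiring
  open Annihilators K enumeration
  open LinearRecurrences K enumeration
  open HankelRecurrences K enumeration
  open RecurrenceProbability R K enumeration ψ₀ ψ₀-character using (recurrentMean)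
  open LimitingProbability R K enumeration ψ₀ ψ₀-character μ μ-distribution ‖μ̂‖<√q using (mean⟶)

  PrH PrS : ℕ → ℝ.Carrier
  PrH m = Pr μ (H? m (2 * m + α) (2m≤1+[2m+α] m α))
  PrS m = Pr μ (λ x → singular? (hankel m x))

  Pr≈recurrentMean : ∀ {n m p e} {E : Unary.Pred (Vector (HeytingField.Carrier K) n) e} (E? : Unary.Decidable E) →
    (∀ x → E x → Recurrent m p (extend x)) → (∀ x → Recurrent m p (extend x) → E x) →
    Pr μ E? ℝ.≈ recurrentMean μ n m p
  Pr≈recurrentMean {n} {m} {p} E? E⇒rec rec⇒E = sum-cong-≋ {q ℕ.^ n} λ t →
    ℝ.trans (if-then-0≈* (E? (tuple t)) _) (ℝ.trans (ℝ.*-comm _ _) (ℝ.*-congˡ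
      ([]-cong (E? (tuple t)) (recurrent? m p (extend (tuple {n} t))) (E⇒rec (tuple t)) (rec⇒E (tuple t)))))

  ⟶-cong : ∀ {s l l′} → l ℝ.≈ l′ → s ℝ.⟶ l → s ℝ.⟶ l′
  ⟶-cong l≈l′ s⟶l ε 0<ε = let N , close = s⟶l ε 0<ε in N , λ n N≤n →
    ℝ.<-respˡ-≈ (ℝ.+-congˡ (ℝ.-‿cong l≈l′)) (proj₁ (close n N≤n)) ,
    ℝ.<-respˡ-≈ (ℝ.+-congʳ l≈l′) (proj₂ (close n N≤n))

  open +-*-Solver using (solve; _:=_; _:+_; _:*_; con)

  p≡ : ∀ m → suc (2 * suc m + α ℕ.∸ suc m) ≡ suc α + suc m
  p≡ m = ≡.cong suc (≡.trans
    (≡.cong (ℕ._∸ suc m) (solve 2 (λ m α → con 2 :* m :+ α := (α :+ m) :+ m) ≡.refl (suc m) α))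
    (ℕ.m+n∸n≡m (α + suc m) (suc m)))

  N≡ : ∀ m → suc (2 * suc m + α) ≡ suc α + (suc m + suc m)
  N≡ m = ≡.cong suc (solve 2 (λ m α → con 2 :* m :+ α := α :+ (m :+ m)) ≡.refl (suc m) α)

  N≡′ : ∀ m → suc (2 * suc m) ≡ 1 + (suc m + suc m)
  N≡′ m = ≡.cong suc (≡.cong (λ n → suc m + n) (ℕ.+-identityʳ (suc m)))
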